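{- Let $k$ be a positive integer, and let $G$ be a graph without components isomorphic to $P_3$. Then $G$ is a disconnected cograph minimal $(\infty,k)$-polar obstruction without isolated vertices if and only if there exist positive integers $k_1,k_2$ and cographs $H_1,H_2$ such that: (1) $G = H_1 + H_2$; (2) $k = k_1 + k_2 - 1$; (3) for each $i \in \{1,2\}$, either $H_i$ is a cograph minimal $(1,k_i-1)$-polar obstruction that is neither a cograph minimal $(1,\infty)$-polar obstruction nor isomorphic to $k_iK_2$, or $k_i \ge 2$ and $H_i \cong (k_i-2)K_2 + (K_1 \oplus 2K_2)$; and (4) for $\{i,j\}=\{1,2\}$, if $H_i \cong (k_i-2)K_2 + (K_1 \oplus 2K_2)$ and $G - H_i$ (which is $H_j$) is a cograph minimal $(1,k_j-1)$-polar obstruction, then $G - H_i$ has exactly one component not isomorphic to $K_2$.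
   Context: All graphs are finite and simple. A cograph is a graph with no induced subgraph isomorphic to $P_4$. $G+H$ denotes disjoint union, $G \oplus H$ the join (disjoint union plus all edges between $G$ and $H$), $nG$ the disjoint union of $n$ copies of $G$ ($0G$ is the empty graph); $K_n$, $P_n$ denote the complete graph and path on $n$ vertices. A component is trivial (an isolated vertex) if it is isomorphic to $K_1$. A cluster is a disjoint union of complete graphs. For $s,k \in \mathbb{Z}_{\ge 0}\cup\{\infty\}$, an $(s,k)$-polar partition of $G$ is a partition $(A,B)$ of $V(G)$ (parts may be empty) such that $G[A]$ is a complete multipartite graph with at most $s$ parts and $G[B]$ is a cluster with at most $k$ components; $\infty$ means unbounded. $G$ is $(s,k)$-polar if it has such a partition. A cograph minimal $(s,k)$-polar obstruction is a cograph that is not $(s,k)$-polar but all of whose proper induced subgraphs are $(s,k)$-polar. -}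

module Defs where

open import Data.Nat using (ℕ; zero; suc; _+_; _∸_; _<_; _≤_)
open import Data.Fin using (Fin; splitAt; _↑ˡ_; _↑ʳ_)
open import Data.Bool using (Bool; true; false)
open import Data.Sum using (_⊎_; inj₁; inj₂)
open import Data.Product using (Σ; ∃; _×_; _,_)
open import Data.Empty using (⊥)
open import Relation.Nullary using (¬_)
open import Relation.Binary.PropositionalEquality using (_≡_; _≢_; refl)
open import Relation.Binary.Construct.Closure.ReflexiveTransitive using (Star)
open import Function.Definitions using (Injective)
open import Function.Bundles using (_⇔_)

record Graph : Set where
  field
    size   : ℕ
    adj    : Fin size → Fin size → Bool
    sym    : ∀ u v → adj u v ≡ adj v u
    irrefl : ∀ v → adj v v ≡ false
open Graph public

Adj : (G : Graph) → Fin (size G) → Fin (size G) → Set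
Adj G u v = adj G u v ≡ true

record _≅_ (G H : Graph) : Set where
  field
    to       : Fin (size G) → Fin (size H)
    from     : Fin (size H) → Fin (size G)
    from-to  : ∀ v → from (to v) ≡ v
    to-from  : ∀ v → to (from v) ≡ v
    preserve : ∀ u v → adj H (to u) (to v) ≡ adj G u v
infix 4 _≅_

induce : (G : Graph) {m : ℕ} (e : Fin m → Fin (size G)) → Injective _≡_ _≡_ e → Graph
induce G {m} e inj = record
  { size = m
  ; adj = λ i j → adj G (e i) (e j)
  ; sym = λ i j → sym G (e i) (e j)
  ; irrefl = λ i → irrefl G (e i)
  }

record InducedEmb (G : Graph) (m : ℕ) : Set where
  field
    emb : Fin m → Fin (size G)
    inj : Injective _≡_ _≡_ emb
open InducedEmb public

sub : (G : Graph) {m : ℕ} → InducedEmb G m → Graph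
sub G E = induce G (emb E) (inj E)

Kₙ : ℕ → Graph
Kₙ n = record
  { size = n
  ; adj = λ i j → neq i j
  ; sym = neq-sym
  ; irrefl = neq-irr
  }
  where
  neq : ∀ {n} → Fin n → Fin n → Bool
  neq Fin.zero Fin.zero = false
  neq Fin.zero (Fin.suc _) = true
  neq (Fin.suc _) Fin.zero = true
  neq (Fin.suc i) (Fin.suc j) = neq i j
  neq-sym : ∀ {n} (i j : Fin n) → neq i j ≡ neq j i
  neq-sym Fin.zero Fin.zero = refl
  neq-sym Fin.zero (Fin.suc _) = refl
  neq-sym (Fin.suc _) Fin.zero = refl
  neq-sym (Fin.suc i) (Fin.suc j) = neq-sym i j
  neq-irr : ∀ {n} (i : Fin n) → neq i i ≡ false
  neq-irr Fin.zero = refl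
  neq-irr (Fin.suc i) = neq-irr i

K₁ K₂ : Graph
K₁ = Kₙ 1
K₂ = Kₙ 2

Pₙ : ℕ → Graph
Pₙ n = record
  { size = n
  ; adj = λ i j → nb i j
  ; sym = nb-sym
  ; irrefl = nb-irr
  }
  where
  isZ : ∀ {n} → Fin n → Bool
  isZ Fin.zero = true
  isZ (Fin.suc _) = false
  nb : ∀ {n} → Fin n → Fin n → Bool
  nb Fin.zero Fin.zero = false
  nb Fin.zero (Fin.suc j) = isZ j
  nb (Fin.suc i) Fin.zero = isZ i
  nb (Fin.suc i) (Fin.suc j) = nb i j
  nb-sym : ∀ {n} (i j : Fin n) → nb i j ≡ nb j i
  nb-sym Fin.zero Fin.zero = refl
  nb-sym Fin.zero (Fin.suc j) = refl
  nb-sym (Fin.suc i) Fin.zero = refl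
  nb-sym (Fin.suc i) (Fin.suc j) = nb-sym i j
  nb-irr : ∀ {n} (i : Fin n) → nb i i ≡ false
  nb-irr Fin.zero = refl
  nb-irr (Fin.suc i) = nb-irr i

P₃ P₄ : Graph
P₃ = Pₙ 3
P₄ = Pₙ 4

private
  sumAdj : ∀ {n m} → Bool → (Fin n → Fin n → Bool) → (Fin m → Fin m → Bool)
         → Fin n ⊎ Fin m → Fin n ⊎ Fin m → Bool
  sumAdj c a b (inj₁ i) (inj₁ j) = a i j
  sumAdj c a b (inj₂ i) (inj₂ j) = b i j
  sumAdj c a b (inj₁ i) (inj₂ j) = c
  sumAdj c a b (inj₂ i) (inj₁ j) = c

  sumAdj-sym : ∀ {n m} c (a : Fin n → Fin n → Bool) (b : Fin m → Fin m → Bool)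
             → (∀ i j → a i j ≡ a j i) → (∀ i j → b i j ≡ b j i)
             → ∀ x y → sumAdj c a b x y ≡ sumAdj c a b y x
  sumAdj-sym c a b sa sb (inj₁ i) (inj₁ j) = sa i j
  sumAdj-sym c a b sa sb (inj₂ i) (inj₂ j) = sb i j
  sumAdj-sym c a b sa sb (inj₁ i) (inj₂ j) = refl
  sumAdj-sym c a b sa sb (inj₂ i) (inj₁ j) = refl

  sumAdj-irr : ∀ {n m} c (a : Fin n → Fin n → Bool) (b : Fin m → Fin m → Bool)
             → (∀ i → a i i ≡ false) → (∀ i → b i i ≡ false)
             → ∀ x → sumAdj c a b x x ≡ false
  sumAdj-irr c a b ia ib (inj₁ i) = ia i
  sumAdj-irr c a b ia ib (inj₂ i) = ib i

  combine : Bool → Graph → Graph → Graph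
  combine c G H = record
    { size = size G + size H
    ; adj = λ x y → sumAdj c (adj G) (adj H) (splitAt (size G) x) (splitAt (size G) y)
    ; sym = λ x y → sumAdj-sym c (adj G) (adj H) (sym G) (sym H)
                      (splitAt (size G) x) (splitAt (size G) y)
    ; irrefl = λ x → sumAdj-irr c (adj G) (adj H) (irrefl G) (irrefl H)
                      (splitAt (size G) x)
    }

_⊹_ : Graph → Graph → Graph
G ⊹ H = combine false G H

_⊕_ : Graph → Graph → Graph
G ⊕ H = combine true G H

infixl 6 _⊹_
infixl 7 _⊕_

Empty : Graph
Empty = Kₙ 0

copies : ℕ → Graph → Graph
copies zero G = Empty
copies (suc n) G = G ⊹ copies n G

Reach : (G : Graph) → Fin (size G) → Fin (size G) → Set
Reach G = Star (Adj G)

Connected : Graph → Set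
Connected G = ∀ u v → Reach G u v

Disconnected : Graph → Set
Disconnected G = ¬ Connected G

-- A component: a nonempty vertex set (image of an injective map) inducing a
-- connected subgraph and closed under adjacency (hence maximal connected).
record Component (G : Graph) : Set where
  field
    csize     : ℕ
    nonempty  : 0 < csize
    cemb      : InducedEmb G csize
    connected : Connected (sub G cemb)
    closed    : ∀ (i : Fin csize) (v : Fin (size G)) →
                Adj G (emb cemb i) v → ∃ λ j → emb cemb j ≡ v
open Component public

HasComponentIso : Graph → Graph → Set
HasComponentIso G H = Σ (Component G) λ C → sub G (cemb C) ≅ H

IsolatedVertex : (G : Graph) → Fin (size G) → Set
IsolatedVertex G v = ∀ u → adj G v u ≡ false

NoIsolatedVertices : Graph → Set
NoIsolatedVertices G = ∀ v → ¬ IsolatedVertex G v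

IsCograph : Graph → Set
IsCograph G = ¬ (Σ (InducedEmb G 4) λ E → sub G E ≅ P₄)

data ℕ∞ : Set where
  fin : ℕ → ℕ∞
  ∞   : ℕ∞

Lab : ℕ∞ → Set
Lab (fin n) = Fin n
Lab ∞ = ℕ

-- (A,B) is encoded by inA : V → Bool (A = {v | inA v ≡ true}).
-- G[A] complete multipartite with ≤ s parts: a labelling of A by at most s
-- part-labels such that two distinct vertices of A are adjacent iff they lie
-- in different parts (parts = label classes; parts are independent sets).
-- G[B] cluster with ≤ k components: a labelling of B by at most k labels such
-- that two distinct vertices of B are adjacent iff they have the same label
-- (label classes = the complete components).
record PolarPartition (s k : ℕ∞) (G : Graph) : Set where
  field
    inA   : Fin (size G) → Bool
    part  : (v : Fin (size G)) → inA v ≡ true → Lab s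
    clust : (v : Fin (size G)) → inA v ≡ false → Lab k
    multipartite : ∀ u v (pu : inA u ≡ true) (pv : inA v ≡ true) → u ≢ v →
                   (Adj G u v ⇔ (part u pu ≢ part v pv))
    cluster : ∀ u v (pu : inA u ≡ false) (pv : inA v ≡ false) → u ≢ v →
              (Adj G u v ⇔ (clust u pu ≡ clust v pv))

IsPolar : ℕ∞ → ℕ∞ → Graph → Set
IsPolar s k G = PolarPartition s k G

record CographMinObstruction (s k : ℕ∞) (G : Graph) : Set where
  field
    cograph  : IsCograph G
    notPolar : ¬ IsPolar s k G
    minimal  : ∀ {m} (E : InducedEmb G m) → m < size G → IsPolar s k (sub G E)

SameComponent : {G : Graph} → Component G → Component G → Set
SameComponent C D =
  (∀ i → ∃ λ j → emb (cemb C) i ≡ emb (cemb D) j) ×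
  (∀ j → ∃ λ i → emb (cemb D) j ≡ emb (cemb C) i)

{-# OPTIONS --safe #-}
module Submission where

-- Idea.  In a P₄-free graph the components are the classes of the relation "at
-- distance at most 2".  Let f be the least number of cliques left after removing
-- an independent set; f is additive over components.  A complete multipartite
-- graph with an edge is connected, so as soon as two components contain an induced
-- P₃, being (∞,k)-polar amounts to f ≤ k.  If f is finite on a component that is
-- not a split graph, the component is the join of an independent set with a
-- cluster of f cliques, and moving one of these cliques to the multipartite side
-- saves one clique.
--
-- An obstruction G without isolated vertices has induced P₃'s in two components.
-- If f drops below k + 1 at every vertex deletion, any bipartition of G separating
-- these components gives two critical pieces.  Otherwise the deletion of some v
-- leaves a cluster in the component of v, and an exchange of v with any vertex off
-- a butterfly K₁ ⊕ 2K₂ centred at v shows that this component is the butterfly.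
-- Conversely, a critical piece with finite f always loses exactly one clique for a
-- suitable deletion, so the bounds of the two pieces add up.

open import Defs renaming (sym to adj-sym; irrefl to adj-irrefl)
open import Axiom.UniquenessOfIdentityProofs.WithK using (uip)
open import Data.Bool using (Bool; true; false) renaming (_≟_ to _≟ᵇ_)
open import Data.Bool.Properties using (¬-not)
open import Data.Empty using (⊥; ⊥-elim)
open import Data.Fin using (Fin; zero; suc; _≟_; inject≤; splitAt; toℕ; _↑ˡ_; _↑ʳ_)
open import Data.Fin.Patterns using (0F; 1F; 2F; 3F; 4F)
import Data.Fin.Properties as Fin
open import Data.Fin.Subset using (Subset)
open import Data.Fin.Subset.Properties using (anySubset?)
open import Data.Nat using (ℕ; zero; suc; _+_; _∸_; _≤_; _<_; z≤n; s≤s)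
open import Data.Nat.Properties using (≤-refl; ≤-reflexive; ≤-trans; ≤-antisym; ≤-pred; ≰⇒>; <⇒≱; n≮n; n≤0⇒n≡0; m≤n⇒m≤1+n; m≤m+n; m≤n+m; m≤n⇒∃[o]m+o≡n; +-comm; +-suc; +-mono-≤; +-monoˡ-≤; +-monoʳ-≤; suc-injective; _≤?_) renaming (_≟_ to _≟ⁿ_)
open import Data.Product using (Σ; ∃; ∃₂; _×_; _,_; proj₁; proj₂)
open import Data.Sum using (_⊎_; inj₁; inj₂; [_,_]′)
open import Data.Vec using (lookup; tabulate)
open import Data.Vec.Properties using (lookup∘tabulate)
open import Function using (_∘_; id)
open import Function.Bundles using (_⇔_; mk⇔; Equivalence)
open import Relation.Binary.Construct.Closure.ReflexiveTransitive using (ε; _◅_)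
open import Relation.Binary.PropositionalEquality using (_≡_; _≢_; refl; sym; trans; cong; cong₂; subst)
open import Relation.Nullary using (¬_; Dec; yes; no; does)
open import Relation.Nullary.Decidable using (_×-dec_; _⊎-dec_; _→-dec_; ¬?; map′; decidable-stable)
open import Relation.Unary using (Decidable; U; _∩_; _∖_; _⊆_)
open import Relation.Unary.Properties using (U?)
open Equivalence using (to; from)

-- The value f may be infinite, so it never occurs as a number: `F S k` stands for f ≤ k on `S`, and
-- `F?` supplies excluded middle for it. In G = H₁ + H₂ each piece has f(Hᵢ) = kᵢ while f(G) = k +
-- 1, whence k = k₁ + k₂ - 1. Both pieces must contain an induced P₃, since only then is a
-- multipartite part with an edge useless; this is what rules out kᵢK₂, which is critical with f =
-- kᵢ but is a cluster. The obstacle is the butterfly. Deleting its hub leaves 2K₂, so f stays 2 and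
-- that side gains nothing. The side has become a cluster, however, and the multipartite part may be
-- spent on the other side, where it saves one clique as soon as the P₃'s there lie in a single
-- component. For a critical other side this is condition (4); a second butterfly with disjoint
-- edges has the property by itself. A component P₃ has f = 1, and every deletion destroys its only
-- P₃. In any larger component with a P₃ some deletion keeps that P₃, hence an edge, so a component
-- with f = 1 would gain nothing from it. Without components P₃, the components of an obstruction
-- that carry a P₃ therefore have f at least 2.

private
  variable
    m n : ℕ

-- Counting and enumerating decidable subsets of a finite set

count : {P : Fin n → Set} → Decidable P → ℕ
count {zero}  P? = 0
count {suc n} P? with P? zero
... | yes _ = suc (count (P? ∘ suc))
... | no  _ = count (P? ∘ suc)

count-mono : {P Q : Fin n → Set} (P? : Decidable P) (Q? : Decidable Q) →
             (∀ {v} → P v → Q v) → count P? ≤ count Q?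
count-mono {zero}  P? Q? P⊆Q = z≤n
count-mono {suc n} P? Q? P⊆Q with P? zero | Q? zero
... | yes _ | yes _ = s≤s (count-mono (P? ∘ suc) (Q? ∘ suc) P⊆Q)
... | yes p | no ¬q = ⊥-elim (¬q (P⊆Q p))
... | no _  | yes _ = m≤n⇒m≤1+n (count-mono (P? ∘ suc) (Q? ∘ suc) P⊆Q)
... | no _  | no _  = count-mono (P? ∘ suc) (Q? ∘ suc) P⊆Q

count-split : {P K : Fin n → Set} (P? : Decidable P) (K? : Decidable K) →
              count P? ≡ count (λ v → P? v ×-dec K? v) + count (λ v → P? v ×-dec ¬? (K? v))
count-split {zero}  P? K? = refl
count-split {suc n} P? K? with P? zero | K? zero
... | yes _ | yes _ = cong suc (count-split (P? ∘ suc) (K? ∘ suc))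
... | yes _ | no _  = trans (cong suc (count-split (P? ∘ suc) (K? ∘ suc))) (sym (+-suc _ _))
... | no _  | yes _ = count-split (P? ∘ suc) (K? ∘ suc)
... | no _  | no _  = count-split (P? ∘ suc) (K? ∘ suc)

count-remove : {Q : Fin n → Set} (Q? : Decidable Q) (w : Fin n) → Q w →
               suc (count (λ v → Q? v ×-dec ¬? (v ≟ w))) ≤ count Q?
count-remove {suc n} Q? zero q with Q? zero
... | yes _ = s≤s (count-mono (λ v → Q? (suc v) ×-dec ¬? (suc v ≟ zero)) (Q? ∘ suc) proj₁)
... | no ¬q = ⊥-elim (¬q q)
count-remove {suc n} Q? (suc w) q with Q? zero | count-remove (Q? ∘ suc) w q
... | yes _ | rec = s≤s (≤-trans (s≤s shift) rec)
  where shift = count-mono (λ v → Q? (suc v) ×-dec ¬? (suc v ≟ suc w)) (λ v → Q? (suc v) ×-dec ¬? (v ≟ w))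
                           λ (x , y) → x , y ∘ cong suc
... | no _  | rec = ≤-trans (s≤s shift) rec
  where shift = count-mono (λ v → Q? (suc v) ×-dec ¬? (suc v ≟ suc w)) (λ v → Q? (suc v) ×-dec ¬? (v ≟ w))
                           λ (x , y) → x , y ∘ cong suc

-- Induction on the domain: the image of the first counted element is struck from `Q`, and by
-- injectivity the remaining images avoid it.
count-injection : {P : Fin n → Set} {Q : Fin m → Set} (P? : Decidable P) (Q? : Decidable Q)
  (φ : ∀ v → P v → Fin m) → (∀ v p → Q (φ v p)) →
  (∀ u v p q → φ u p ≡ φ v q → u ≡ v) → count P? ≤ count Q?
count-injection {zero}  P? Q? φ into inj = z≤n
count-injection {suc n} P? Q? φ into inj with P? zero
... | yes p = ≤-trans
  (s≤s (count-injection (P? ∘ suc) (λ v → Q? v ×-dec ¬? (v ≟ φ zero p)) (φ ∘ suc)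
          (λ v q → into (suc v) q , λ e → Fin.0≢1+n (sym (inj (suc v) zero q p e)))
          (λ u v p q e → Fin.suc-injective (inj _ _ p q e))))
  (count-remove Q? (φ zero p) (into zero p))
... | no _ = count-injection (P? ∘ suc) Q? (φ ∘ suc) (into ∘ suc)
               (λ u v p q e → Fin.suc-injective (inj _ _ p q e))

count-U : ∀ n → count (U? {A = Fin n}) ≡ n
count-U zero    = refl
count-U (suc n) = cong suc (count-U n)

record Enumeration (P : Fin n → Set) (m : ℕ) : Set where
  field
    at        : Fin m → Fin n
    at-inj    : ∀ {i j} → at i ≡ at j → i ≡ j
    at-sound  : ∀ i → P (at i)
    index     : ∀ v → P v → Fin m
    at-index  : ∀ v p → at (index v p) ≡ v

enumerate : {P : Fin n → Set} (P? : Decidable P) → Enumeration P (count P?)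
enumerate {zero} P? = record
  { at = λ () ; at-inj = λ {} ; at-sound = λ () ; index = λ () ; at-index = λ () }
enumerate {suc n} {P} P? with P? zero | enumerate (P? ∘ suc)
... | yes p | e = record
  { at = at ; at-inj = at-inj ; at-sound = sound ; index = ix ; at-index = at-ix }
  where
  module e = Enumeration e
  at : Fin (suc _) → Fin (suc n)
  at zero    = zero
  at (suc i) = suc (e.at i)
  at-inj : ∀ {i j} → at i ≡ at j → i ≡ j
  at-inj {zero}  {zero}  _ = refl
  at-inj {zero}  {suc _} ()
  at-inj {suc _} {zero}  ()
  at-inj {suc i} {suc j} q = cong suc (e.at-inj (Fin.suc-injective q))
  sound : ∀ i → P (at i)
  sound zero    = p
  sound (suc i) = e.at-sound i
  ix : ∀ v → P v → Fin (suc _)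
  ix zero    _ = zero
  ix (suc v) q = suc (e.index v q)
  at-ix : ∀ v q → at (ix v q) ≡ v
  at-ix zero    _ = refl
  at-ix (suc v) q = cong suc (e.at-index v q)
... | no ¬p | e = record
  { at = suc ∘ e.at ; at-inj = e.at-inj ∘ Fin.suc-injective ; at-sound = e.at-sound
  ; index = ix ; at-index = at-ix }
  where
  module e = Enumeration e
  ix : ∀ v → P v → Fin _
  ix zero    q = ⊥-elim (¬p q)
  ix (suc v) q = e.index v q
  at-ix : ∀ v q → suc (e.at (ix v q)) ≡ v
  at-ix zero    q = ⊥-elim (¬p q)
  at-ix (suc v) q = cong suc (e.at-index v q)

-- This is the least element of P only if P d holds.
first : {P : Fin n → Set} → Decidable P → Fin n → Fin n
first {suc n} P? d with P? zero
first {suc n} P? d       | yes _ = zero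
first {suc n} P? zero    | no _  = zero
first {suc n} P? (suc d) | no _  = suc (first (P? ∘ suc) d)

first-holds : {P : Fin n → Set} (P? : Decidable P) (d : Fin n) → P d → P (first P? d)
first-holds {suc n} P? d p with P? zero
first-holds {suc n} P? d       p | yes q = q
first-holds {suc n} P? zero    p | no ¬q = p
first-holds {suc n} P? (suc d) p | no _  = first-holds (P? ∘ suc) d p

first-cong : {P Q : Fin n → Set} (P? : Decidable P) (Q? : Decidable Q) →
             (∀ {v} → P v → Q v) → (∀ {v} → Q v → P v) →
             ∀ d d′ → P d → Q d′ → first P? d ≡ first Q? d′
first-cong {suc n} P? Q? f g d d′ p q with P? zero | Q? zero
... | yes _ | yes _ = refl
... | yes x | no ¬x = ⊥-elim (¬x (f x))
... | no ¬x | yes x = ⊥-elim (¬x (g x))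
first-cong {suc n} P? Q? f g zero    d′       p q | no ¬x | no _ = ⊥-elim (¬x p)
first-cong {suc n} P? Q? f g (suc d) zero     p q | no _  | no ¬x = ⊥-elim (¬x q)
first-cong {suc n} P? Q? f g (suc d) (suc d′) p q | no _  | no _ =
  cong suc (first-cong (P? ∘ suc) (Q? ∘ suc) f g d d′ p q)

-- A record instead of a bare equation, so that unification can recover the set `A` from the type.
record _∈_ (v : Fin n) (A : Fin n → Bool) : Set where
  constructor mem
  field
    holds : A v ≡ true

_∈?_ : (v : Fin n) (A : Fin n → Bool) → Dec (v ∈ A)
v ∈? A with A v in eq
... | true  = yes (mem eq)
... | false = no λ { (mem e) → false≢true (trans (sym eq) e) }
  where
  false≢true : false ≢ true
  false≢true ()

⟪_⟫ : {P : Fin n → Set} → Decidable P → Fin n → Bool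
⟪ P? ⟫ v = does (P? v)

∈⟪⟫⁺ : {P : Fin n → Set} (P? : Decidable P) → ∀ {v} → P v → v ∈ ⟪ P? ⟫
∈⟪⟫⁺ P? {v} p = mem (go (P? v) p)
  where
  go : ∀ {X : Set} (d : Dec X) → X → does d ≡ true
  go (yes _) _ = refl
  go (no ¬x) x = ⊥-elim (¬x x)

∈⟪⟫⁻ : {P : Fin n → Set} (P? : Decidable P) → ∀ {v} → v ∈ ⟪ P? ⟫ → P v
∈⟪⟫⁻ P? {v} (mem e) = go (P? v) e
  where
  go : ∀ {X : Set} (d : Dec X) → does d ≡ true → X
  go (yes x) _ = x


-- Coinciding vertices are harmless: they make the premises contradictory or supply the edge at
-- once, so the condition can be phrased without injectivity.
P₄-free : Graph → Set
P₄-free G = ∀ {a b c d} → Adj G a b → Adj G b c → Adj G c d →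
            ¬ Adj G a c → ¬ Adj G b d → Adj G a d

-- Independent sets, clusters, complete multipartite sets and clique numbers

module Basics (G : Graph) where

  V : Set
  V = Fin (size G)

  infix 4 _~_ _~?_
  _~_ : V → V → Set
  _~_ = Adj G

  _~?_ : ∀ u v → Dec (u ~ v)
  u ~? v = adj G u v ≟ᵇ true

  ~-sym : ∀ {u v} → u ~ v → v ~ u
  ~-sym {u} {v} e = trans (adj-sym G v u) e

  ~-irrefl : ∀ {v} → ¬ v ~ v
  ~-irrefl {v} e with trans (sym e) (adj-irrefl G v)
  ... | ()

  ~⇒≢ : ∀ {u v} → u ~ v → u ≢ v
  ~⇒≢ e refl = ~-irrefl e

  E : V → V → Set
  E u v = u ≡ v ⊎ u ~ v

  E? : ∀ u v → Dec (E u v)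
  E? u v = (u ≟ v) ⊎-dec (u ~? v)

  E-sym : ∀ {u v} → E u v → E v u
  E-sym (inj₁ e) = inj₁ (sym e)
  E-sym (inj₂ e) = inj₂ (~-sym e)

  Closed : (V → Set) → Set
  Closed K = ∀ {u v} → u ~ v → K u → K v

  Closed-E : ∀ {K} → Closed K → ∀ {u v} → E u v → K u → K v
  Closed-E cl (inj₁ refl) k = k
  Closed-E cl (inj₂ e)    k = cl e k

  Closed-∁ : ∀ {K : V → Set} → Closed K → Closed (λ v → ¬ K v)
  Closed-∁ cl e ¬k k = ¬k (cl (~-sym e) k)

  -- Label-free forms of the conditions on the two parts: closed adjacency is transitive on a
  -- cluster, non-adjacency on a complete multipartite set. In this form they are visibly
  -- hereditary; labels are recovered from least representatives.
  Ind Clu MP : (V → Set) → Set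
  Ind A = ∀ {u v} → A u → A v → ¬ u ~ v
  Clu B = ∀ {u v w} → B u → B v → B w → E u v → E v w → E u w
  MP  A = ∀ {u v w} → A u → A v → A w → ¬ u ~ v → ¬ v ~ w → ¬ u ~ w

  Ind-⊆ : ∀ {A A′} → A′ ⊆ A → Ind A → Ind A′
  Ind-⊆ s ind p q = ind (s p) (s q)

  Clu-⊆ : ∀ {B B′} → B′ ⊆ B → Clu B → Clu B′
  Clu-⊆ s clu p q r = clu (s p) (s q) (s r)

  MP-⊆ : ∀ {A A′} → A′ ⊆ A → MP A → MP A′
  MP-⊆ s mp p q r = mp (s p) (s q) (s r)

  Ind⇒MP : ∀ {A} → Ind A → MP A
  Ind⇒MP ind p q r _ _ = ind p r

  clique⇒Clu : ∀ {B : V → Set} → (∀ {u v} → B u → B v → E u v) → Clu B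
  clique⇒Clu cl p q r _ _ = cl p r

  clique⇒MP : ∀ {A : V → Set} → (∀ {u v} → A u → A v → E u v) → MP A
  clique⇒MP cl p q r u≁v v≁w with cl p q | cl q r
  ... | inj₂ e    | _         = λ _ → u≁v e
  ... | _         | inj₂ e    = λ _ → v≁w e
  ... | inj₁ refl | inj₁ refl = ~-irrefl

  all²? : {P : V → V → Set} → (∀ u v → Dec (P u v)) → Dec (∀ {u v} → P u v)
  all²? P? = map′ (λ f {u} {v} → f u v) (λ f u v → f) (Fin.all? λ u → Fin.all? λ v → P? u v)

  all³? : {P : V → V → V → Set} → (∀ u v w → Dec (P u v w)) → Dec (∀ {u v w} → P u v w)
  all³? P? = map′ (λ f {u} {v} {w} → f u v w) (λ f u v w → f)
                  (Fin.all? λ u → Fin.all? λ v → Fin.all? λ w → P? u v w)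

  Ind? : ∀ {A} → Decidable A → Dec (Ind A)
  Ind? A? = all²? λ u v → A? u →-dec A? v →-dec ¬? (u ~? v)

  Clu? : ∀ {B} → Decidable B → Dec (Clu B)
  Clu? B? = all³? λ u v w → B? u →-dec B? v →-dec B? w →-dec E? u v →-dec E? v w →-dec E? u w

  -- The number of cliques of a cluster B, counted by their least vertices.
  rep : ∀ {B} → Decidable B → V → V
  rep B? v = first (λ u → B? u ×-dec E? u v) v

  cliques : ∀ {B} → Decidable B → ℕ
  cliques B? = count (λ v → B? v ×-dec (rep B? v ≟ v))

  module _ {B : V → Set} (B? : Decidable B) where

    rep-holds : ∀ {v} → B v → B (rep B? v) × E (rep B? v) v
    rep-holds {v} p = first-holds (λ u → B? u ×-dec E? u v) v (p , inj₁ refl)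

    module _ (clu : Clu B) where

      rep-cong : ∀ {u v} → B u → B v → E u v → rep B? u ≡ rep B? v
      rep-cong {u} {v} p q e = first-cong (λ w → B? w ×-dec E? w u) (λ w → B? w ×-dec E? w v)
        (λ (r , f) → r , clu r p q f e) (λ (r , f) → r , clu r q p f (E-sym e))
        u v (p , inj₁ refl) (q , inj₁ refl)

      rep-reflects : ∀ {u v} → B u → B v → rep B? u ≡ rep B? v → E u v
      rep-reflects {u} {v} p q e with rep-holds p | rep-holds q
      ... | x , f | y , g = clu p x q (E-sym f) (subst (λ z → E z v) (sym e) g)

      rep-idem : ∀ {v} → B v → rep B? (rep B? v) ≡ rep B? v
      rep-idem p with rep-holds p
      ... | x , f = rep-cong x p f

      -- Only representatives are counted, so `φ` has to separate different cliques but may vary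
      -- inside one.
      cliques-count : ∀ {m} {Q : Fin m → Set} (Q? : Decidable Q) (φ : ∀ v → B v → Fin m) →
        (∀ v p → Q (φ v p)) → (∀ u v p q → φ u p ≡ φ v q → E u v) → cliques B? ≤ count Q?
      cliques-count Q? φ into inj = count-injection _ Q? (λ v p → φ v (proj₁ p))
        (λ v p → into v (proj₁ p))
        (λ u v (p , e) (q , f) h → trans (sym e) (trans (rep-cong p q (inj u v p q h)) f))

      -- Pairwise separated members of a cluster meet every clique at most once.
      count-cliques : ∀ {m} {Q : Fin m → Set} (Q? : Decidable Q) (φ : Fin m → V) →
        (∀ i → B (φ i)) → (∀ i j → E (φ i) (φ j) → i ≡ j) → count Q? ≤ cliques B?
      count-cliques Q? φ into inj = count-injection Q? _ (λ i _ → rep B? (φ i))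
        (λ i _ → proj₁ (rep-holds (into i)) , rep-idem (into i))
        (λ i j _ _ e → inj i j (rep-reflects (into i) (into j) e))

      -- The label of a vertex is the position of its representative among all representatives; this
      -- turns a clique count back into the labels of a polar partition.
      cliques-labelling : ∀ {k} → cliques B? ≤ k →
        Σ (∀ v → B v → Fin k) λ lab → ∀ {u v} (p : B u) (q : B v) →
          (E u v → lab u p ≡ lab v q) × (lab u p ≡ lab v q → E u v)
      cliques-labelling le = (λ v p → inject≤ (index (rep B? v) (good p)) le) ,
        λ {u} {v} p q → (λ e → cong (λ i → inject≤ i le) (index-cong (rep-cong p q e))) ,
                λ e → rep-reflects p q
                  (trans (sym (at-index _ (good p)))
                    (trans (cong at (Fin.inject≤-injective le le _ _ e)) (at-index _ (good q))))
        where
        open Enumeration (enumerate (λ v → B? v ×-dec (rep B? v ≟ v)))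
        good : ∀ {v} → B v → B (rep B? v) × rep B? (rep B? v) ≡ rep B? v
        good p = proj₁ (rep-holds p) , rep-idem p
        index-cong : ∀ {u v p q} → u ≡ v → index u p ≡ index v q
        index-cong {u} {v} {p} {q} e = at-inj (trans (at-index u p) (trans e (sym (at-index v q))))

  cliques-map : ∀ {B B′} (B? : Decidable B) (B′? : Decidable B′) → Clu B → Clu B′ →
    (φ : ∀ v → B v → V) → (∀ v p → B′ (φ v p)) → (∀ u v p q → E (φ u p) (φ v q) → E u v) →
    cliques B? ≤ cliques B′?
  cliques-map B? B′? clu clu′ φ into inj =
    cliques-count B? clu _ (λ v p → rep B′? (φ v p))
      (λ v p → proj₁ (rep-holds B′? (into v p)) , rep-idem B′? clu′ (into v p))
      (λ u v p q e → inj u v p q (rep-reflects B′? clu′ (into u p) (into v q) e))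

  cliques-mono : ∀ {B B′} (B? : Decidable B) (B′? : Decidable B′) → Clu B′ → B ⊆ B′ →
                 cliques B? ≤ cliques B′?
  cliques-mono B? B′? clu s = cliques-map B? B′? (Clu-⊆ s clu) clu (λ v _ → v) (λ v p → s p) (λ _ _ _ _ e → e)

  module _ {B : V → Set} (B? : Decidable B) where

    cliques-clique : (∀ {u v} → B u → B v → E u v) → cliques B? ≤ 1
    cliques-clique cl = cliques-count B? (clique⇒Clu cl) (U? {A = Fin 1}) (λ _ _ → zero) (λ _ _ → _) (λ _ _ p q _ → cl p q)

    cliques-empty : (∀ {v} → ¬ B v) → cliques B? ≤ 0
    cliques-empty ¬b = cliques-count B? (λ b → ⊥-elim (¬b b)) (U? {A = Fin 0}) (λ v b → ⊥-elim (¬b b))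
                         (λ _ _ → _) (λ _ _ p _ _ → ⊥-elim (¬b p))

    cliques-nonempty : Clu B → ∀ {b} → B b → 1 ≤ cliques B?
    cliques-nonempty clu {b} p = count-cliques B? clu (U? {A = Fin 1}) (λ _ → b) (λ _ → p) λ { zero zero _ → refl }

    cliques-two : Clu B → ∀ {b b′} → B b → B b′ → ¬ E b b′ → 2 ≤ cliques B?
    cliques-two clu {b} {b′} p p′ ne = count-cliques B? clu (U? {A = Fin 2})
      (λ { zero → b ; (suc zero) → b′ }) (λ { zero → p ; (suc zero) → p′ })
      λ { zero zero _ → refl ; zero (suc zero) e → ⊥-elim (ne e)
        ; (suc zero) zero e → ⊥-elim (ne (E-sym e)) ; (suc zero) (suc zero) _ → refl }

    -- The closed neighbourhood in `B` of a vertex stays on its side of `K`, so the least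
    -- representative is the same in `B` and in the restriction.
    cliques-split : ∀ {K} (K? : Decidable K) → (∀ {u v} → B u → B v → u ~ v → K u → K v) →
      cliques B? ≡ cliques (λ v → B? v ×-dec K? v) + cliques (λ v → B? v ×-dec ¬? (K? v))
    cliques-split {K} K? cl = trans (count-split (λ v → B? v ×-dec (rep B? v ≟ v)) K?)
      (cong₂ _+_
        (count-≡ _ _ (λ ((b , r) , k) → (b , k) , trans (sym (in-rep b k)) r)
                     (λ ((b , k) , r) → (b , trans (in-rep b k) r) , k))
        (count-≡ _ _ (λ ((b , r) , k) → (b , k) , trans (sym (out-rep b k)) r)
                     (λ ((b , k) , r) → (b , trans (out-rep b k) r) , k)))
      where
      count-≡ : ∀ {P Q : V → Set} (P? : Decidable P) (Q? : Decidable Q) → P ⊆ Q → Q ⊆ P → count P? ≡ count Q?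
      count-≡ P? Q? s t = ≤-antisym (count-mono P? Q? s) (count-mono Q? P? t)
      clE : ∀ {u v} → B u → B v → E u v → K u → K v
      clE _ _ (inj₁ refl) k = k
      clE p q (inj₂ e)    k = cl p q e k
      in-rep : ∀ {v} → B v → K v → rep B? v ≡ rep (λ v → B? v ×-dec K? v) v
      in-rep {v} b k = first-cong _ _ (λ (x , e) → (x , clE b x (E-sym e) k) , e) (λ ((x , _) , e) → x , e)
                         v v (b , inj₁ refl) ((b , k) , inj₁ refl)
      out-rep : ∀ {v} → B v → ¬ K v → rep B? v ≡ rep (λ v → B? v ×-dec ¬? (K? v)) v
      out-rep {v} b ¬k = first-cong _ _ (λ (x , e) → (x , λ k → ¬k (clE x b e k)) , e) (λ ((x , _) , e) → x , e)
                         v v (b , inj₁ refl) ((b , ¬k) , inj₁ refl)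

  -- Cover Ind S k and Cover MP S k say that S induces a (1,k)-polar and an
  -- (∞,k)-polar graph, respectively; the parts a and b may overlap and
  -- contain vertices outside S.
  record Cover (Good : (V → Set) → Set) (S : V → Set) (k : ℕ) : Set where
    constructor mkCover
    field
      a b   : V → Bool
      good  : Good (_∈ a)
      clu   : Clu (_∈ b)
      bound : cliques (_∈? b) ≤ k
      cover : ∀ {v} → S v → v ∈ a ⊎ v ∈ b

  F Q : (V → Set) → ℕ → Set
  F = Cover Ind
  Q = Cover MP

  -- Building, deciding, splitting and gluing covers

  cover-mono : ∀ {Good S S′ k k′} → S′ ⊆ S → k ≤ k′ → Cover Good S k → Cover Good S′ k′
  cover-mono s le p = mkCover a b good clu (≤-trans bound le) (cover ∘ s)
    where open Cover p

  cover-from : ∀ {Good} → (∀ {A A′} → A′ ⊆ A → Good A → Good A′) →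
    ∀ {S A B k} (A? : Decidable A) (B? : Decidable B) →
    Good A → Clu B → cliques B? ≤ k → (∀ {v} → S v → A v ⊎ B v) → Cover Good S k
  cover-from hered A? B? good clu le cov = mkCover ⟪ A? ⟫ ⟪ B? ⟫
    (hered (∈⟪⟫⁻ A?) good) (Clu-⊆ (∈⟪⟫⁻ B?) clu)
    (≤-trans (cliques-mono (_∈? ⟪ B? ⟫) B? clu (∈⟪⟫⁻ B?)) le)
    ([ inj₁ ∘ ∈⟪⟫⁺ A? , inj₂ ∘ ∈⟪⟫⁺ B? ]′ ∘ cov)

  F-from : ∀ {S A B k} (A? : Decidable A) (B? : Decidable B) →
    Ind A → Clu B → cliques B? ≤ k → (∀ {v} → S v → A v ⊎ B v) → F S k
  F-from = cover-from Ind-⊆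

  Q-from : ∀ {S A B k} (A? : Decidable A) (B? : Decidable B) →
    MP A → Clu B → cliques B? ≤ k → (∀ {v} → S v → A v ⊎ B v) → Q S k
  Q-from = cover-from MP-⊆

  F⇒Q : ∀ {S k} → F S k → Q S k
  F⇒Q p = mkCover a b (Ind⇒MP good) clu bound cover
    where open Cover p

  abstract
    -- There are finitely many pairs of subsets to try. The arguments by contradiction rest on this
    -- decision; it is abstract so that type checking never runs the search.
    F? : ∀ {S} → Decidable S → ∀ k → Dec (F S k)
    F? {S} S? k = map′ found⇒F F⇒found (anySubset? λ x → anySubset? λ y →
        Ind? (_∈? lookup x) ×-dec Clu? (_∈? lookup y) ×-dec (cliques (_∈? lookup y) ≤? k)
        ×-dec Fin.all? λ v → S? v →-dec ((v ∈? lookup x) ⊎-dec (v ∈? lookup y)))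
      where
      Found : Subset (size G) → Subset (size G) → Set
      Found x y = Ind (_∈ lookup x) × Clu (_∈ lookup y) × cliques (_∈? lookup y) ≤ k
                × (∀ v → S v → v ∈ lookup x ⊎ v ∈ lookup y)
      found⇒F : (∃₂ λ x y → Found x y) → F S k
      found⇒F (x , y , ind , clu , le , cov) = mkCover (lookup x) (lookup y) ind clu le (λ {v} → cov v)
      F⇒found : F S k → ∃₂ λ x y → Found x y
      F⇒found p = tabulate a , tabulate b , Ind-⊆ (back a) good , Clu-⊆ (back b) clu ,
        ≤-trans (cliques-mono (_∈? lookup (tabulate b)) (_∈? b) clu (back b)) bound ,
        λ v s → [ inj₁ ∘ forth a , inj₂ ∘ forth b ]′ (cover s)
        where
        open Cover p
        back : ∀ (f : V → Bool) {v : V} → v ∈ lookup (tabulate f) → v ∈ f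
        back f {v} (mem e) = mem (trans (sym (lookup∘tabulate f v)) e)
        forth : ∀ (f : V → Bool) {v : V} → v ∈ f → v ∈ lookup (tabulate f)
        forth f {v} (mem e) = mem (trans (lookup∘tabulate f v) e)

  F-clu : ∀ {S B k} (B? : Decidable B) → Clu B → cliques B? ≤ k → S ⊆ B → F S k
  F-clu B? clu le s = F-from {A = λ _ → ⊥} (λ _ → no id) B? (λ ()) clu le (inj₂ ∘ s)

  F-disjoint : ∀ {S k} → F S k → Σ (F S k) λ p → ∀ {v} → v ∈ Cover.a p → v ∈ Cover.b p → ⊥
  F-disjoint p = F-from (_∈? a) b∖a? good (Clu-⊆ proj₁ clu)
      (≤-trans (cliques-mono b∖a? (_∈? b) clu proj₁) bound) cov ,
      λ p q → proj₂ (∈⟪⟫⁻ b∖a? q) (∈⟪⟫⁻ (_∈? a) p)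
    where
    open Cover p
    b∖a? = λ v → (v ∈? b) ×-dec ¬? (v ∈? a)
    cov : ∀ {v} → _ → v ∈ a ⊎ (v ∈ b × ¬ v ∈ a)
    cov {v} s with v ∈? a | cover s
    ... | yes p | _      = inj₁ p
    ... | no _  | inj₁ p = inj₁ p
    ... | no ¬p | inj₂ q = inj₂ (q , ¬p)

  abstract
    -- One half of the additivity of f: no clique crosses a closed set. The other half is `F-join`.
    F-split : ∀ {S K k} (K? : Decidable K) → Closed K → F S k →
              ∃₂ λ i j → F (S ∩ K) i × F (S ∖ K) j × i + j ≤ k
    F-split {k = k} K? cl p = _ , _ ,
        F-from (_∈? a) (λ v → (v ∈? b) ×-dec K? v) good (Clu-⊆ proj₁ clu) ≤-refl
          (λ (s , k) → [ inj₁ , (λ q → inj₂ (q , k)) ]′ (cover s)) ,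
        F-from (_∈? a) (λ v → (v ∈? b) ×-dec ¬? (K? v)) good (Clu-⊆ proj₁ clu) ≤-refl
          (λ (s , k) → [ inj₁ , (λ q → inj₂ (q , k)) ]′ (cover s)) ,
        subst (_≤ k) (cliques-split (_∈? b) K? (λ _ _ → cl)) bound
      where open Cover p

  module _ {K : V → Set} (K? : Decidable K) (cl : Closed K) where

    private
      Glue : (V → Set) → (V → Set) → V → Set
      Glue X Y v = (X v × K v) ⊎ (Y v × ¬ K v)

      glue? : ∀ {X Y} → Decidable X → Decidable Y → Decidable (Glue X Y)
      glue? X? Y? v = (X? v ×-dec K? v) ⊎-dec (Y? v ×-dec ¬? (K? v))

      glue-Clu : ∀ {X Y} → Clu X → Clu Y → Clu (Glue X Y)
      glue-Clu cx cy (inj₁ (p , _)) (inj₁ (q , _)) (inj₁ (r , _)) e f = cx p q r e f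
      glue-Clu cx cy (inj₂ (p , _)) (inj₂ (q , _)) (inj₂ (r , _)) e f = cy p q r e f
      glue-Clu cx cy (inj₁ (_ , k)) (inj₂ (_ , l)) _ e f = ⊥-elim (l (Closed-E cl e k))
      glue-Clu cx cy (inj₂ (_ , l)) (inj₁ (_ , k)) _ e f = ⊥-elim (l (Closed-E cl (E-sym e) k))
      glue-Clu cx cy _ (inj₁ (_ , k)) (inj₂ (_ , l)) e f = ⊥-elim (l (Closed-E cl f k))
      glue-Clu cx cy _ (inj₂ (_ , l)) (inj₁ (_ , k)) e f = ⊥-elim (l (Closed-E cl (E-sym f) k))

      glue-Ind : ∀ {X Y} → Ind X → Ind Y → Ind (Glue X Y)
      glue-Ind ix iy (inj₁ (p , _)) (inj₁ (q , _)) e = ix p q e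
      glue-Ind ix iy (inj₂ (p , _)) (inj₂ (q , _)) e = iy p q e
      glue-Ind ix iy (inj₁ (_ , k)) (inj₂ (_ , l)) e = l (cl e k)
      glue-Ind ix iy (inj₂ (_ , l)) (inj₁ (_ , k)) e = l (cl (~-sym e) k)

      glue-cliques : ∀ {X Y i j} (X? : Decidable X) (Y? : Decidable Y) → Clu X → Clu Y →
        cliques X? ≤ i → cliques Y? ≤ j → cliques (glue? X? Y?) ≤ i + j
      glue-cliques X? Y? cx cy le le′ = ≤-trans
        (≤-reflexive (cliques-split (glue? X? Y?) K? (λ _ _ → cl)))
        (+-mono-≤
          (≤-trans (cliques-mono (λ v → glue? X? Y? v ×-dec K? v) X? cx
            λ { (inj₁ (x , _) , _) → x ; (inj₂ (_ , ¬k) , k) → ⊥-elim (¬k k) }) le)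
          (≤-trans (cliques-mono (λ v → glue? X? Y? v ×-dec ¬? (K? v)) Y? cy
            λ { (inj₂ (y , _) , _) → y ; (inj₁ (_ , k) , ¬k) → ⊥-elim (¬k k) }) le′))

    F-join : ∀ {S S₁ S₂ i j} → F S₁ i → F S₂ j →
             S ∩ K ⊆ S₁ → S ∖ K ⊆ S₂ → F S (i + j)
    F-join {S} p q s t = F-from (glue? (_∈? p.a) (_∈? q.a)) (glue? (_∈? p.b) (_∈? q.b))
        (glue-Ind p.good q.good) (glue-Clu p.clu q.clu)
        (glue-cliques (_∈? p.b) (_∈? q.b) p.clu q.clu p.bound q.bound) cov
      where
      module p = Cover p
      module q = Cover q
      cov : ∀ {v} → S v → Glue (_∈ p.a) (_∈ q.a) v ⊎ Glue (_∈ p.b) (_∈ q.b) v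
      cov {v} x with K? v
      ... | yes k = [ (λ r → inj₁ (inj₁ (r , k))) , (λ r → inj₂ (inj₁ (r , k))) ]′ (p.cover (s (x , k)))
      ... | no ¬k = [ (λ r → inj₁ (inj₂ (r , ¬k))) , (λ r → inj₂ (inj₂ (r , ¬k))) ]′ (q.cover (t (x , ¬k)))

    -- The union of two complete multipartite sets across `K` need not be complete multipartite, so
    -- only one side may use such a part and the other is covered by a cluster alone.
    Q-join : ∀ {S S₁ T i j} (T? : Decidable T) → Q S₁ i → Clu T → cliques T? ≤ j →
             S ∩ K ⊆ S₁ → S ∖ K ⊆ T → Q S (i + j)
    Q-join {S} {T = T} T? p clu le s t = Q-from (λ v → (v ∈? p.a) ×-dec K? v) (glue? (_∈? p.b) T?)
        (MP-⊆ proj₁ p.good) (glue-Clu p.clu clu)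
        (glue-cliques (_∈? p.b) T? p.clu clu p.bound le) cov
      where
      module p = Cover p
      cov : ∀ {v} → S v → (v ∈ p.a × K v) ⊎ Glue (_∈ p.b) T v
      cov {v} x with K? v
      ... | yes k = [ (λ r → inj₁ (r , k)) , (λ r → inj₂ (inj₁ (r , k))) ]′ (p.cover (s (x , k)))
      ... | no ¬k = inj₂ (inj₂ (t (x , ¬k) , ¬k))

  -- The independent part takes at most one endpoint; the other one needs a clique.
  F-edge : ∀ {S k u v} → F S k → S u → S v → u ~ v → 1 ≤ k
  F-edge p su sv e with Cover.cover p su | Cover.cover p sv
  ... | inj₁ x | inj₁ y = ⊥-elim (Cover.good p x y e)
  ... | inj₂ x | _      = ≤-trans (cliques-nonempty (_∈? Cover.b p) (Cover.clu p) x) (Cover.bound p)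
  ... | inj₁ _ | inj₂ x = ≤-trans (cliques-nonempty (_∈? Cover.b p) (Cover.clu p) x) (Cover.bound p)

  -- In an independent part at most one endpoint of an edge is lost, so the
  -- other part still meets every clique of T.
  F-cliques : ∀ {S T k} (T? : Decidable T) → Clu T → (∀ {v} → T v → ∃ λ u → T u × v ~ u) →
              T ⊆ S → F S k → cliques T? ≤ k
  F-cliques {T = T} T? clu nbr s p = ≤-trans
      (cliques-map T? (_∈? b) clu clu-b φ into reflect) bound
    where
    open Cover p renaming (clu to clu-b)
    pick : ∀ v → T v → ∃ λ u → T u × E v u × u ∈ b
    pick v t with cover (s t) | nbr t
    ... | inj₂ q | _ = v , t , inj₁ refl , q
    ... | inj₁ q | u , t′ , e with cover (s t′)
    ...   | inj₁ q′ = ⊥-elim (good q q′ e)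
    ...   | inj₂ q′ = u , t′ , inj₂ e , q′
    φ : ∀ v → T v → V
    φ v t = proj₁ (pick v t)
    into : ∀ v t → φ v t ∈ b
    into v t = proj₂ (proj₂ (proj₂ (pick v t)))
    reflect : ∀ u v p q → E (φ u p) (φ v q) → E u v
    reflect u v p q e with pick u p | pick v q
    ... | x , tx , ex , _ | y , ty , ey , _ = clu p ty q (clu p tx ty ex e) (E-sym ey)

-- Components of a P₄-free graph and their shapes

module Classes (G : Graph) (p₄-free : P₄-free G) where

  open Basics G

  -- In a P₄-free graph any two vertices of a component are at distance at most 2.
  data R (u v : V) : Set where
    near : E u v → R u v
    via  : ∀ c → u ~ c → c ~ v → R u v

  R? : ∀ u v → Dec (R u v)
  R? u v = map′ [ near , (λ (c , e , f) → via c e f) ]′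
                (λ { (near e) → inj₁ e ; (via c e f) → inj₂ (c , e , f) })
                (E? u v ⊎-dec Fin.any? λ c → (u ~? c) ×-dec (c ~? v))

  R-refl : ∀ {u} → R u u
  R-refl = near (inj₁ refl)

  R-sym : ∀ {u v} → R u v → R v u
  R-sym (near e)    = near (E-sym e)
  R-sym (via c e f) = via c (~-sym f) (~-sym e)

  -- An edge appended to a path of length two leaves a path of length three. A chord shortens it to
  -- length two; without these chords P₄-freeness joins its ends.
  R-closed : ∀ {x} → Closed (R x)
  R-closed e (near (inj₁ refl)) = near (inj₂ e)
  R-closed e (near (inj₂ f))    = via _ f e
  R-closed {x} {u} {v} e (via c f g) with x ~? u | c ~? v
  ... | yes h | _     = via u h e
  ... | no _  | yes h = via c f h
  ... | no ¬h | no ¬i = near (inj₂ (p₄-free f g e ¬h ¬i))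

  Closed-R : ∀ {K} → Closed K → ∀ {u v} → R u v → K u → K v
  Closed-R cl (near e)    k = Closed-E cl e k
  Closed-R cl (via c e f) k = cl f (cl e k)

  R-trans : ∀ {u v w} → R u v → R v w → R u w
  R-trans r s = Closed-R R-closed s r

  infixl 6 _-_
  _-_ : (V → Set) → V → V → Set
  (S - w) v = S v × v ≢ w

  -? : ∀ {S} → Decidable S → ∀ w → Decidable (S - w)
  -? S? w v = S? v ×-dec ¬? (v ≟ w)

  -- The middle of an induced P₃ in `S`; clusters are the sets without such a vertex.
  Centre : (V → Set) → V → Set
  Centre S y = ∃₂ λ x z → S x × S y × S z × x ~ y × y ~ z × ¬ E x z

  Centre? : ∀ {S} → Decidable S → Decidable (Centre S)
  Centre? S? y = Fin.any? λ x → Fin.any? λ z →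
    S? x ×-dec S? y ×-dec S? z ×-dec (x ~? y) ×-dec (y ~? z) ×-dec ¬? (E? x z)

  Centre-⊆ : ∀ {S T} → S ⊆ T → ∀ {y} → Centre S y → Centre T y
  Centre-⊆ s (x , z , p , q , r , rest) = x , z , s p , s q , s r , rest

  ¬Clu-centre : ∀ {B} → Clu B → ∀ {y} → ¬ Centre B y
  ¬Clu-centre clu (x , z , p , q , r , e , f , ne) = ne (clu p q r (inj₂ e) (inj₂ f))

  no-centre⇒Clu : ∀ {S} → (∀ {y} → ¬ Centre S y) → Clu S
  no-centre⇒Clu nc p q r (inj₁ refl) f = f
  no-centre⇒Clu nc p q r e (inj₁ refl) = e
  no-centre⇒Clu nc {u} {v} {w} p q r (inj₂ e) (inj₂ f) with E? u w
  ... | yes h = h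
  ... | no ¬h = ⊥-elim (nc (u , w , p , q , r , e , f , ¬h))

  Clu-R : ∀ {B} → Closed B → Clu B → ∀ {u v} → B u → R u v → E u v
  Clu-R cl clu b (near e)    = e
  Clu-R cl clu b (via c e f) = clu b (cl e b) (cl f (cl e b)) (inj₂ e) (inj₂ f)

  edge⊎Ind : ∀ {A} → Decidable A → (∃₂ λ p q → A p × A q × p ~ q) ⊎ Ind A
  edge⊎Ind A? with Fin.any? (λ p → Fin.any? λ q → A? p ×-dec A? q ×-dec (p ~? q))
  ... | yes e = inj₁ e
  ... | no ¬e = inj₂ λ p q e → ¬e (_ , _ , p , q , e)

  -- In a complete multipartite set every vertex is adjacent to an endpoint of any given edge.
  MP-edge : ∀ {A p q} → MP A → A p → A q → p ~ q → A ⊆ R p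
  MP-edge {p = p} {q} mp ap aq e {v} av with p ~? v | v ~? q
  ... | yes f | _     = near (inj₂ f)
  ... | no _  | yes f = via q e (~-sym f)
  ... | no ¬f | no ¬g = ⊥-elim (mp ap av aq ¬f ¬g e)

  -- A complete multipartite part containing an edge lives in one class, so the
  -- part of the cover in every other class is a cluster.
  Q-cases : ∀ {S k} (q : Q S k) → F S k ⊎
    ∃ λ p → (∀ {v} → v ∈ Cover.a q → R p v) × (∀ {v} → S v → ¬ R p v → v ∈ Cover.b q)
  Q-cases q with edge⊎Ind (_∈? Cover.a q)
  ... | inj₂ ind = inj₁ (mkCover a b ind clu bound cover) where open Cover q
  ... | inj₁ (p , p′ , ap , ap′ , e) = inj₂ (p , inR , λ s ¬r →
          [ ⊥-elim ∘ ¬r ∘ inR , id ]′ (Cover.cover q s))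
    where
    inR : ∀ {v} → v ∈ Cover.a q → R p v
    inR = MP-edge (Cover.good q) ap ap′ e

  abstract
    -- An edge in the multipartite part would confine that part to one class, and a P₃ in another
    -- class would have to lie in the cluster. Hence the part is independent.
    two-centres : ∀ {S k y y′} → Q S k → Centre S y → Centre S y′ → ¬ R y y′ → F S k
    two-centres {S} q c c′ ¬r with Q-cases q
    ... | inj₁ f = f
    ... | inj₂ (p , _ , out) = ⊥-elim (¬r (R-trans (R-sym (inside c)) (inside c′)))
      where
      inside : ∀ {y} → Centre S y → R p y
      inside {y} (u , w , su , sy , sw , e , f , ne) = decidable-stable (R? p y) λ ¬py →
        ¬Clu-centre (Cover.clu q)
          (u , w , out su (¬py ∘ R-closed e) , out sy ¬py , out sw (¬py ∘ R-closed (~-sym f)) , e , f , ne)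

  -- The shape of a class that is not split. The vertices `b₁` and `b₂` witness two cliques in `b`;
  -- such a pair is what forces the join to be complete.
  record Join (x : V) (j : ℕ) : Set where
    field
      a b    : V → Bool
      a⊆     : ∀ {v} → v ∈ a → R x v
      b⊆     : ∀ {v} → v ∈ b → R x v
      ind    : Ind (_∈ a)
      clu    : Clu (_∈ b)
      bound  : cliques (_∈? b) ≤ j
      cover  : ∀ {v} → R x v → v ∈ a ⊎ v ∈ b
      joined : ∀ {u v} → u ∈ a → v ∈ b → u ~ v
      {b₁ b₂} : V
      b₁∈    : b₁ ∈ b
      b₂∈    : b₂ ∈ b
      b₁≁b₂  : ¬ E b₁ b₂

  module _ {x : V} {A B : V → Set} (A⊆ : A ⊆ R x) (B⊆ : B ⊆ R x) (ind : Ind A) (clu : Clu B)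
           (cover : ∀ {v} → R x v → A v ⊎ B v) (disjoint : ∀ {v} → A v → B v → ⊥)
           {b b′ : V} (bb : B b) (bb′ : B b′) (ne : ¬ E b b′) where

    private
      -- Vertices of different cliques are at distance two, and the middle vertex cannot lie in the
      -- cluster, where it would merge the two cliques.
      common : ∀ {y z} → B y → B z → ¬ E y z → ∃ λ a → A a × y ~ a × a ~ z
      common by bz ne with R-trans (R-sym (B⊆ by)) (B⊆ bz)
      ... | near e = ⊥-elim (ne e)
      ... | via c e f with cover (R-closed e (B⊆ by))
      ...   | inj₁ ac = c , ac , e , f
      ...   | inj₂ bc = ⊥-elim (ne (clu by bc bz (inj₂ e) (inj₂ f)))

      -- Otherwise `a`, `y`, `c`, `z` induce a P₄, where `c` is a common neighbour of `y` and `z`.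
      spread : ∀ {a y z} → A a → B y → B z → a ~ y → ¬ E y z → a ~ z
      spread {a} {y} {z} aa by bz e ne with a ~? z | common by bz ne
      ... | yes f | _ = f
      ... | no _  | c , ac , f , g = p₄-free e f g (ind aa ac) (ne ∘ inj₂)

      touch : ∀ {a} → A a → ∃ λ y → B y × a ~ y
      touch aa with R-trans (R-sym (A⊆ aa)) (B⊆ bb)
      ... | near (inj₁ refl) = ⊥-elim (disjoint aa bb)
      ... | near (inj₂ e)    = b , bb , e
      ... | via c e _ with cover (R-closed e (A⊆ aa))
      ...   | inj₁ ac = ⊥-elim (ind aa ac e)
      ...   | inj₂ bc = c , bc , e

      other : ∀ {y} → B y → ∃ λ z → B z × ¬ E y z
      other {y} by with E? y b | E? y b′
      ... | no ¬e | _     = b , bb , ¬e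
      ... | yes _ | no ¬e = b′ , bb′ , ¬e
      ... | yes e | yes f = ⊥-elim (ne (clu bb by bb′ (E-sym e) f))

    -- One neighbour of `a` in `B` spreads to all other cliques, and from one of these back to the
    -- rest of its own clique.
    complete-join : ∀ {a y} → A a → B y → a ~ y
    complete-join {a} {y} aa by with touch aa
    ... | y₀ , by₀ , e with E? y₀ y
    ...   | no ¬f = spread aa by₀ by e ¬f
    ...   | yes f with other by₀
    ...     | z , bz , ne′ = spread aa bz by (spread aa by₀ bz e ne′)
                               (λ g → ne′ (clu by₀ by bz f (E-sym g)))

  -- If the cluster part meets the class in at most one clique, the class is split; two cliques in
  -- it force a complete join.
  class-shape : ∀ {x j} → F (R x) j → F (R x) 1 ⊎ Join x j
  class-shape {x} p with F-disjoint p
  ... | q , disj with Fin.any? (λ u → Fin.any? λ v → (u ∈? Cover.b q) ×-dec (v ∈? Cover.b q)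
                        ×-dec R? x u ×-dec R? x v ×-dec ¬? (E? u v))
  ... | no ¬two = inj₁ (F-from (_∈? a) B? good (Clu-⊆ proj₁ clu)
            (cliques-clique B? clique)
            (λ r → [ inj₁ , (λ h → inj₂ (h , r)) ]′ (cover r)))
    where
    open Cover q
    B? = λ v → (v ∈? b) ×-dec R? x v
    clique : ∀ {u v} → u ∈ b × R x u → v ∈ b × R x v → E u v
    clique {u} {v} (h , r) (h′ , r′) = decidable-stable (E? u v) λ ne → ¬two (_ , _ , h , h′ , r , r′ , ne)
  ... | yes (b₁ , b₂ , h₁ , h₂ , r₁ , r₂ , ne) = inj₂ record
    { a = ⟪ A? ⟫ ; b = ⟪ B? ⟫
    ; a⊆ = proj₂ ∘ ∈⟪⟫⁻ A? ; b⊆ = proj₂ ∘ ∈⟪⟫⁻ B?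
    ; ind = Ind-⊆ (∈⟪⟫⁻ A?) (Ind-⊆ proj₁ good)
    ; clu = Clu-⊆ (∈⟪⟫⁻ B?) (Clu-⊆ proj₁ clu)
    ; bound = ≤-trans (cliques-mono (_∈? ⟪ B? ⟫) (_∈? b) clu (proj₁ ∘ ∈⟪⟫⁻ B?)) bound
    ; cover = λ r → [ (λ h → inj₁ (∈⟪⟫⁺ A? (h , r))) , (λ h → inj₂ (∈⟪⟫⁺ B? (h , r))) ]′ (cover r)
    ; joined = λ h h′ → complete-join proj₂ proj₂ (Ind-⊆ proj₁ good) (Clu-⊆ proj₁ clu)
        (λ r → [ (λ h → inj₁ (h , r)) , (λ h → inj₂ (h , r)) ]′ (cover r))
        (λ (h , _) (h′ , _) → disj h h′) (h₁ , r₁) (h₂ , r₂) ne (∈⟪⟫⁻ A? h) (∈⟪⟫⁻ B? h′)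
    ; b₁∈ = ∈⟪⟫⁺ B? (h₁ , r₁) ; b₂∈ = ∈⟪⟫⁺ B? (h₂ , r₂) ; b₁≁b₂ = ne }
    where
    open Cover q
    A? = λ v → (v ∈? a) ×-dec R? x v
    B? = λ v → (v ∈? b) ×-dec R? x v

  -- One whole clique of b can be moved to the complete multipartite side.
  Join⇒Q : ∀ {x j} → Join x j → ∃ λ i → Q (R x) i × suc i ≤ j
  Join⇒Q {x} J = _ ,
      Q-from (λ v → (v ∈? a) ⊎-dec ((v ∈? b) ×-dec E? b₁ v)) B′? mp (Clu-⊆ proj₁ clu) ≤-refl cov ,
      ≤-trans (+-monoˡ-≤ _ (cliques-nonempty (λ v → (v ∈? b) ×-dec E? b₁ v) (Clu-⊆ proj₁ clu) (b₁∈ , inj₁ refl)))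
        (≤-trans (≤-reflexive (sym (cliques-split (_∈? b) (E? b₁) (λ p q e f → clu b₁∈ p q f (inj₂ e))))) bound)
    where
    open Join J
    B′? = λ v → (v ∈? b) ×-dec ¬? (E? b₁ v)
    clique : ∀ {u v} → u ∈ b × E b₁ u → v ∈ b × E b₁ v → E u v
    clique (p , e) (q , f) = clu p b₁∈ q (E-sym e) f
    mp : MP (λ v → v ∈ a ⊎ (v ∈ b × E b₁ v))
    mp (inj₁ p) (inj₁ q) (inj₁ r) _ _ = ind p r
    mp (inj₁ p) (inj₂ (q , _)) _ f _ = ⊥-elim (f (joined p q))
    mp (inj₂ (q , _)) (inj₁ p) _ f _ = ⊥-elim (f (~-sym (joined p q)))
    mp _ (inj₁ p) (inj₂ (q , _)) _ f = ⊥-elim (f (joined p q))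
    mp _ (inj₂ (q , _)) (inj₁ p) _ f = ⊥-elim (f (~-sym (joined p q)))
    mp (inj₂ p) (inj₂ q) (inj₂ r) = clique⇒MP clique p q r
    cov : ∀ {v} → R x v → (v ∈ a ⊎ (v ∈ b × E b₁ v)) ⊎ (v ∈ b × ¬ E b₁ v)
    cov {v} r with cover r | E? b₁ v
    ... | inj₁ p | _     = inj₁ (inj₁ p)
    ... | inj₂ p | yes e = inj₁ (inj₂ (p , e))
    ... | inj₂ p | no ¬e = inj₂ (p , ¬e)

  cliques-remove : ∀ {B B′ K} (B? : Decidable B) (B′? : Decidable B′) (K? : Decidable K) →
    Clu B′ → (∀ {u v} → B u → B v → u ~ v → K u → K v) →
    (∀ {u v} → B u → B v → K u → K v → E u v) → B ∖ K ⊆ B′ → cliques B? ≤ suc (cliques B′?)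
  cliques-remove B? B′? K? clu cl clique s =
    ≤-trans (≤-reflexive (cliques-split B? K? cl))
      (+-mono-≤ (cliques-clique (λ v → B? v ×-dec K? v) (λ (p , k) (q , l) → clique p q k l))
                (cliques-mono (λ v → B? v ×-dec ¬? (K? v)) B′? clu s))

  -- The butterfly and wheels around a hub

  record Butterfly (v : V) : Set where
    field
      x₁ y₁ x₂ y₂ : V
      v~x₁  : v ~ x₁
      v~y₁  : v ~ y₁
      v~x₂  : v ~ x₂
      v~y₂  : v ~ y₂
      x₁~y₁ : x₁ ~ y₁
      x₂~y₂ : x₂ ~ y₂
      x₁≁x₂ : ¬ E x₁ x₂
      x₁≁y₂ : ¬ E x₁ y₂
      y₁≁x₂ : ¬ E y₁ x₂
      y₁≁y₂ : ¬ E y₁ y₂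

    at : Fin 5 → V
    at zero                         = v
    at (suc zero)                   = x₁
    at (suc (suc zero))             = y₁
    at (suc (suc (suc zero)))       = x₂
    at (suc (suc (suc (suc zero)))) = y₂

    On : V → Set
    On u = ∃ λ i → at i ≡ u

    On? : Decidable On
    On? u = Fin.any? λ i → at i ≟ u

    hub-On : On v
    hub-On = zero , refl
    x₁-On : On x₁
    x₁-On = suc zero , refl
    y₁-On : On y₁
    y₁-On = suc (suc zero) , refl
    x₂-On : On x₂
    x₂-On = suc (suc (suc zero)) , refl
    y₂-On : On y₂
    y₂-On = suc (suc (suc (suc zero))) , refl

    On⇒R : On ⊆ R v
    On⇒R (zero , refl)                         = R-refl
    On⇒R (suc zero , refl)                     = near (inj₂ v~x₁)
    On⇒R (suc (suc zero) , refl)               = near (inj₂ v~y₁)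
    On⇒R (suc (suc (suc zero)) , refl)         = near (inj₂ v~x₂)
    On⇒R (suc (suc (suc (suc zero))) , refl)   = near (inj₂ v~y₂)

    Wing : V → Set
    Wing u = On u × u ≢ v

    Wing? : Decidable Wing
    Wing? u = On? u ×-dec ¬? (u ≟ v)

    wing : ∀ {u} → Wing u → E x₁ u ⊎ E x₂ u
    wing ((zero , refl) , ne)                       = ⊥-elim (ne refl)
    wing ((suc zero , refl) , _)                    = inj₁ (inj₁ refl)
    wing ((suc (suc zero) , refl) , _)              = inj₁ (inj₂ x₁~y₁)
    wing ((suc (suc (suc zero)) , refl) , _)        = inj₂ (inj₁ refl)
    wing ((suc (suc (suc (suc zero))) , refl) , _)  = inj₂ (inj₂ x₂~y₂)

    wing₁ : ∀ {u} → Wing u → E x₁ u → u ≡ x₁ ⊎ u ≡ y₁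
    wing₁ ((zero , refl) , ne) _                       = ⊥-elim (ne refl)
    wing₁ ((suc zero , refl) , _) _                    = inj₁ refl
    wing₁ ((suc (suc zero) , refl) , _) _              = inj₂ refl
    wing₁ ((suc (suc (suc zero)) , refl) , _) e        = ⊥-elim (x₁≁x₂ e)
    wing₁ ((suc (suc (suc (suc zero))) , refl) , _) e  = ⊥-elim (x₁≁y₂ e)

    wing₂ : ∀ {u} → Wing u → E x₂ u → u ≡ x₂ ⊎ u ≡ y₂
    wing₂ ((zero , refl) , ne) _                       = ⊥-elim (ne refl)
    wing₂ ((suc zero , refl) , _) e                    = ⊥-elim (x₁≁x₂ (E-sym e))
    wing₂ ((suc (suc zero) , refl) , _) e              = ⊥-elim (y₁≁x₂ (E-sym e))
    wing₂ ((suc (suc (suc zero)) , refl) , _) _        = inj₁ refl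
    wing₂ ((suc (suc (suc (suc zero))) , refl) , _) _  = inj₂ refl

    wing₁-clique : ∀ {u w} → Wing u → Wing w → E x₁ u → E x₁ w → E u w
    wing₁-clique p q e f with wing₁ p e | wing₁ q f
    ... | inj₁ refl | inj₁ refl = inj₁ refl
    ... | inj₁ refl | inj₂ refl = inj₂ x₁~y₁
    ... | inj₂ refl | inj₁ refl = inj₂ (~-sym x₁~y₁)
    ... | inj₂ refl | inj₂ refl = inj₁ refl

    wing₂-clique : ∀ {u w} → Wing u → Wing w → E x₂ u → E x₂ w → E u w
    wing₂-clique p q e f with wing₂ p e | wing₂ q f
    ... | inj₁ refl | inj₁ refl = inj₁ refl
    ... | inj₁ refl | inj₂ refl = inj₂ x₂~y₂
    ... | inj₂ refl | inj₁ refl = inj₂ (~-sym x₂~y₂)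
    ... | inj₂ refl | inj₂ refl = inj₁ refl

    wings-apart : ∀ {u w} → Wing u → Wing w → E x₁ u → E x₂ w → ¬ E u w
    wings-apart p q e f with wing₁ p e | wing₂ q f
    ... | inj₁ refl | inj₁ refl = x₁≁x₂
    ... | inj₁ refl | inj₂ refl = x₁≁y₂
    ... | inj₂ refl | inj₁ refl = y₁≁x₂
    ... | inj₂ refl | inj₂ refl = y₁≁y₂

    wings-Clu : Clu Wing
    wings-Clu p q r e f with wing p | wing q | wing r
    ... | inj₁ a | inj₁ b | inj₁ c = wing₁-clique p r a c
    ... | inj₂ a | inj₂ b | inj₂ c = wing₂-clique p r a c
    ... | inj₁ a | inj₂ b | _      = ⊥-elim (wings-apart p q a b e)
    ... | inj₂ a | inj₁ b | _      = ⊥-elim (wings-apart q p b a (E-sym e))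
    ... | _      | inj₁ b | inj₂ c = ⊥-elim (wings-apart q r b c f)
    ... | _      | inj₂ b | inj₁ c = ⊥-elim (wings-apart r q c b (E-sym f))

    wings-cliques : cliques Wing? ≤ 2
    wings-cliques = ≤-trans
      (cliques-remove Wing? B′? (E? x₁) (Clu-⊆ proj₁ wings-Clu)
        (λ p q e f → wings-Clu (x₁-On , ~⇒≢ (~-sym v~x₁)) p q f (inj₂ e)) wing₁-clique id)
      (s≤s (cliques-clique B′? λ (p , e) (q , f) → wing₂-clique p q (side p e) (side q f)))
      where
      B′? = λ u → Wing? u ×-dec ¬? (E? x₁ u)
      side : ∀ {u} → Wing u → ¬ E x₁ u → E x₂ u
      side p ¬e = [ ⊥-elim ∘ ¬e , id ]′ (wing p)

    F-butterfly : F On 2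
    F-butterfly = F-from (_≟ v) Wing? (λ { refl refl → ~-irrefl }) wings-Clu wings-cliques cov
      where
      cov : ∀ {u} → On u → u ≡ v ⊎ Wing u
      cov {u} o with u ≟ v
      ... | yes e = inj₁ e
      ... | no ¬e = inj₂ (o , ¬e)

    module _ {S : V → Set} {k : ℕ} (p : F S k) where
      open Cover p

      -- Each wing is an edge and so has an endpoint in the cluster part; endpoints from different
      -- wings lie in different cliques.
      F-wings : Wing ⊆ S → 2 ≤ k
      F-wings s = two (side₁ (s (x₁-On , ~⇒≢ (~-sym v~x₁))) (s (y₁-On , ~⇒≢ (~-sym v~y₁))) x₁~y₁)
                      (side₁ (s (x₂-On , ~⇒≢ (~-sym v~x₂))) (s (y₂-On , ~⇒≢ (~-sym v~y₂))) x₂~y₂)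
        where
        side₁ : ∀ {x y} → S x → S y → x ~ y → x ∈ b ⊎ y ∈ b
        side₁ sx sy e with cover sx | cover sy
        ... | inj₁ q | inj₁ r = ⊥-elim (good q r e)
        ... | inj₂ q | _      = inj₁ q
        ... | _      | inj₂ r = inj₂ r
        pair : ∀ {u w} → u ∈ b → w ∈ b → ¬ E u w → 2 ≤ k
        pair q r ne = ≤-trans (cliques-two (_∈? b) clu q r ne) bound
        two : x₁ ∈ b ⊎ y₁ ∈ b → x₂ ∈ b ⊎ y₂ ∈ b → 2 ≤ k
        two (inj₁ q) (inj₁ r) = pair q r x₁≁x₂
        two (inj₁ q) (inj₂ r) = pair q r x₁≁y₂
        two (inj₂ q) (inj₁ r) = pair q r y₁≁x₂
        two (inj₂ q) (inj₂ r) = pair q r y₁≁y₂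

      -- Each wing has an endpoint in the cluster part. With the hub there as well, these endpoints
      -- would belong to one clique.
      hub∈a : On ⊆ S → v ∈ a
      hub∈a s with cover (s hub-On)
      ... | inj₁ h = h
      ... | inj₂ h = ⊥-elim (clash (cover (s x₁-On)) (cover (s y₁-On)) (cover (s x₂-On)) (cover (s y₂-On)))
        where
        apart : ∀ {u w} → u ∈ b → w ∈ b → v ~ u → v ~ w → ¬ E u w → ⊥
        apart q r e f ne = ne (clu q h r (inj₂ (~-sym e)) (inj₂ f))
        clash : x₁ ∈ a ⊎ x₁ ∈ b → y₁ ∈ a ⊎ y₁ ∈ b → x₂ ∈ a ⊎ x₂ ∈ b → y₂ ∈ a ⊎ y₂ ∈ b → ⊥
        clash (inj₁ p) (inj₁ q) _ _ = good p q x₁~y₁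
        clash _ _ (inj₁ p) (inj₁ q) = good p q x₂~y₂
        clash (inj₂ p) _ (inj₂ q) _ = apart p q v~x₁ v~x₂ x₁≁x₂
        clash (inj₂ p) _ _ (inj₂ q) = apart p q v~x₁ v~y₂ x₁≁y₂
        clash _ (inj₂ p) (inj₂ q) _ = apart p q v~y₁ v~x₂ y₁≁x₂
        clash _ (inj₂ p) _ (inj₂ q) = apart p q v~y₁ v~y₂ y₁≁y₂

    -- Deleting a vertex other than the hub spares a vertex of each wing.
    centre-without : ∀ {w} → w ≢ v → Centre (U - w) v
    centre-without {w} w≢v with x₁ ≟ w | x₂ ≟ w
    ... | no a  | no b  = x₁ , x₂ , (_ , a) , (_ , w≢v ∘ sym) , (_ , b) , ~-sym v~x₁ , v~x₂ , x₁≁x₂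
    ... | yes refl | no b = y₁ , x₂ , (_ , ~⇒≢ x₁~y₁ ∘ sym) , (_ , w≢v ∘ sym) , (_ , b) , ~-sym v~y₁ , v~x₂ , y₁≁x₂
    ... | no a  | yes refl = x₁ , y₂ , (_ , a) , (_ , w≢v ∘ sym) , (_ , ~⇒≢ x₂~y₂ ∘ sym) , ~-sym v~x₁ , v~y₂ , x₁≁y₂
    ... | yes a | yes b = ⊥-elim (x₁≁x₂ (inj₁ (trans a (sym b))))

  -- If the rim has at most one clique with an edge, the hub joins that clique and the isolated rim
  -- vertices form the independent part. Two such cliques supply the wings.
  wheel : ∀ v → (∀ {u} → R v u → u ≢ v → v ~ u) → Clu (λ u → R v u × u ≢ v) →
          F (R v) 1 ⊎ Butterfly v
  wheel v hub clu with edge⊎Ind (λ u → R? v u ×-dec ¬? (u ≟ v))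
  ... | inj₂ ind = inj₁ (F-from (λ u → R? v u ×-dec ¬? (u ≟ v)) (_≟ v) ind
                          (clique⇒Clu clique) (cliques-clique (_≟ v) clique) cov)
    where
    clique : ∀ {u w} → u ≡ v → w ≡ v → E u w
    clique refl refl = inj₁ refl
    cov : ∀ {u} → R v u → (R v u × u ≢ v) ⊎ u ≡ v
    cov {u} r with u ≟ v
    ... | yes e = inj₂ e
    ... | no ¬e = inj₁ (r , ¬e)
  ... | inj₁ (x₁ , y₁ , p₁ , q₁ , e₁)
    with edge⊎Ind (λ u → (R? v u ×-dec ¬? (u ≟ v)) ×-dec ¬? (E? x₁ u))
  ... | inj₁ (x₂ , y₂ , (p₂ , f) , (q₂ , g) , e₂) = inj₂ record
    { x₁ = x₁ ; y₁ = y₁ ; x₂ = x₂ ; y₂ = y₂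
    ; v~x₁ = hub (proj₁ p₁) (proj₂ p₁) ; v~y₁ = hub (proj₁ q₁) (proj₂ q₁)
    ; v~x₂ = hub (proj₁ p₂) (proj₂ p₂) ; v~y₂ = hub (proj₁ q₂) (proj₂ q₂)
    ; x₁~y₁ = e₁ ; x₂~y₂ = e₂ ; x₁≁x₂ = f ; x₁≁y₂ = g
    ; y₁≁x₂ = λ h → f (clu p₁ q₁ p₂ (inj₂ e₁) h)
    ; y₁≁y₂ = λ h → g (clu p₁ q₁ q₂ (inj₂ e₁) h) }
  ... | inj₂ ind = inj₁ (F-from (λ u → (R? v u ×-dec ¬? (u ≟ v)) ×-dec ¬? (E? x₁ u)) Hand?
                          ind (clique⇒Clu clique) (cliques-clique Hand? clique) cov)
    where
    Hand : V → Set
    Hand u = u ≡ v ⊎ ((R v u × u ≢ v) × E x₁ u)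
    Hand? : Decidable Hand
    Hand? u = (u ≟ v) ⊎-dec ((R? v u ×-dec ¬? (u ≟ v)) ×-dec E? x₁ u)
    clique : ∀ {u w} → Hand u → Hand w → E u w
    clique (inj₁ refl) (inj₁ refl) = inj₁ refl
    clique (inj₁ refl) (inj₂ ((r , ne) , _)) = inj₂ (hub r ne)
    clique (inj₂ ((r , ne) , _)) (inj₁ refl) = inj₂ (~-sym (hub r ne))
    clique (inj₂ (p , e)) (inj₂ (q , f)) = clu p p₁ q (E-sym e) f
    cov : ∀ {u} → R v u → ((R v u × u ≢ v) × ¬ E x₁ u) ⊎ Hand u
    cov {u} r with u ≟ v | E? x₁ u
    ... | yes e | _     = inj₂ (inj₁ e)
    ... | no ¬e | yes f = inj₂ (inj₂ ((r , ¬e) , f))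
    ... | no ¬e | no ¬f = inj₁ ((r , ¬e) , ¬f)

-- Criticality under vertex deletion

module Critical (G : Graph) (p₄-free : P₄-free G) where

  open Basics G
  open Classes G p₄-free

  -- Minimal (1,k)-obstructions in terms of vertex deletion, for closed subsets of one ambient
  -- graph, so that pieces can be compared without changing the graph.
  record Crit (S : V → Set) (k : ℕ) : Set where
    field
      S?     : Decidable S
      isClosed : Closed S
      notF   : ¬ F S k
      remove : ∀ {w} → S w → F (S - w) k

  F-empty : ∀ {S A k} (A? : Decidable A) → Ind A → S ⊆ A → F S k
  F-empty A? ind s = F-from {B = λ _ → ⊥} A? (λ _ → no id) ind (λ ())
    (≤-trans (cliques-empty (λ _ → no id) id) z≤n) (inj₁ ∘ s)

  F-clique : ∀ {S} (S? : Decidable S) → (∀ {u v} → S u → S v → E u v) → F S 1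
  F-clique S? clique = F-clu S? (clique⇒Clu clique) (cliques-clique S? clique) id

  -- A clique component with at least three vertices keeps an edge after losing `o`, and thus costs
  -- the one clique that it costs as a whole.
  F-clique-vertex : ∀ {S k o p q} → (∀ {u v} → R o u → R o v → E u v) →
    o ~ p → o ~ q → p ≢ q → S p → S q → F (S - o) k → F S k
  F-clique-vertex {o = o} {p} {q} clique e f p≢q sp sq F-o with F-split (R? o) R-closed F-o
  ... | i , j , Fi , Fj , le = cover-mono id
      (≤-trans (+-monoˡ-≤ j 1≤i) le)
      (F-join (R? o) R-closed (F-clique (R? o) clique) Fj proj₂ λ (s , ¬r) → (s , λ { refl → ¬r R-refl }) , ¬r)
    where
    1≤i : 1 ≤ i
    1≤i with clique (near (inj₂ e)) (near (inj₂ f))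
    ... | inj₁ p≡q = ⊥-elim (p≢q p≡q)
    ... | inj₂ p~q = F-edge Fi ((sp , ~⇒≢ e ∘ sym) , near (inj₂ e)) ((sq , ~⇒≢ f ∘ sym) , near (inj₂ f)) p~q

  -- Degree one. If all vertices of a component have it, the component is K₂; matchings are
  -- expressed this way, without component records.
  UniqueNbr : V → Set
  UniqueNbr u = ∃ λ v → u ~ v × ∀ w → u ~ w → w ≡ v

  UniqueNbr? : Decidable UniqueNbr
  UniqueNbr? u = Fin.any? λ v → (u ~? v) ×-dec Fin.all? λ w → (u ~? w) →-dec (w ≟ v)

  unique-nbr : ∀ {u} → ∃ (u ~_) → (∀ {p q} → u ~ p → u ~ q → p ≢ q → ⊥) → UniqueNbr u
  unique-nbr (v , e) no-two = v , e , λ w f → decidable-stable (w ≟ v) (no-two f e)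

  UniqueNbr-Clu : ∀ {K} → (∀ {u} → K u → UniqueNbr u) → Clu K
  UniqueNbr-Clu un p q r (inj₁ refl) f = f
  UniqueNbr-Clu un p q r e (inj₁ refl) = e
  UniqueNbr-Clu un p q r (inj₂ e) (inj₂ f) with un q
  ... | _ , _ , unique = inj₁ (trans (unique _ (~-sym e)) (sym (unique _ f)))

  module _ {S : V → Set} {k : ℕ} (C : Crit S k) where
    open Crit C

    class⊆ : ∀ {x} → S x → R x ⊆ S
    class⊆ s r = Closed-R isClosed r s

    -- An isolated vertex could be added to the independent part at no cost.
    crit-nbr : ∀ {u} → S u → ∃ (u ~_)
    crit-nbr {u} su = decidable-stable (Fin.any? (u ~?_)) λ none → notF
      (F-join (_≟ u) (λ { e refl → ⊥-elim (none (_ , e)) })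
        (F-empty (_≟ u) (λ { refl refl → ~-irrefl }) id) (remove su) proj₂ id)

    replace-class : ∀ {x} → S x → F (R x) 1 → F S (suc k)
    replace-class {x} sx p = F-join (R? x) R-closed p (remove sx) proj₂
      λ (s , ¬r) → s , λ { refl → ¬r R-refl }

    -- A deletion changes only one class, so it suffices to restore that class at the price of one
    -- clique.
    regrow : ∀ {x w} → S w → R x w → (∀ {i} → F ((S - w) ∩ R x) i → F (R x) (suc i)) → F S (suc k)
    regrow {x} sw rw step with F-split (R? x) R-closed (remove sw)
    ... | i , j , Fi , Fj , le = cover-mono id (s≤s le)
        (F-join (R? x) R-closed (step Fi) Fj proj₂ λ (s , ¬r) → (s , λ { refl → ¬r rw }) , ¬r)

    private
      wheel-tight : ∀ {v} → S v → (∀ {u} → R v u → u ≢ v → v ~ u) →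
                    Clu (λ u → R v u × u ≢ v) → F S (suc k)
      wheel-tight {v} sv hub clu with wheel v hub clu
      ... | inj₁ p = replace-class sv p
      ... | inj₂ bf with Fin.any? (λ w → R? v w ×-dec ¬? (Butterfly.On? bf w))
      -- After deletion of `w` the butterfly remains and pins its hub to the independent part. All
      -- other rim vertices are then in the cluster part, and only the clique of `w` may be missing.
      ... | yes (w , rw , off) = regrow (class⊆ sv rw) rw λ q →
              F-from (_≟ v) Rim? (λ { refl refl → ~-irrefl }) clu
                (≤-trans (cliques-remove Rim? (_∈? Cover.b q) (E? w) (Cover.clu q)
                  (λ p r e f → clu wRim p r f (inj₂ e))
                  (λ p r e f → clu p wRim r (E-sym e) f) (rest q)) (s≤s (Cover.bound q))) cov
        where
        open Butterfly bf
        Rim? = λ u → R? v u ×-dec ¬? (u ≟ v)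
        wRim : R v w × w ≢ v
        wRim = rw , λ { refl → off hub-On }
        rest : ∀ {i} (q : F ((S - w) ∩ R v) i) → ∀ {u} → (R v u × u ≢ v) × ¬ E w u → u ∈ Cover.b q
        rest q ((r , ne) , ¬e) with Cover.cover q ((class⊆ sv r , λ { refl → ¬e (inj₁ refl) }) , r)
        ... | inj₂ h = h
        ... | inj₁ h = ⊥-elim (Cover.good q (hub∈a q on) h (hub r ne))
          where
          on : On ⊆ ((S - w) ∩ R v)
          on o = (class⊆ sv (On⇒R o) , λ { refl → off o }) , On⇒R o
        cov : ∀ {u} → R v u → u ≡ v ⊎ (R v u × u ≢ v)
        cov {u} r with u ≟ v
        ... | yes e = inj₁ e
        ... | no ¬e = inj₂ (r , ¬e)
      -- The class is the butterfly itself: without the hub it already needs two cliques, and two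
      -- suffice for the whole.
      ... | no none = regrow sv R-refl λ q → cover-mono on
              (m≤n⇒m≤1+n (F-wings q λ (o , ne) → (class⊆ sv (On⇒R o) , ne) , On⇒R o)) F-butterfly
        where
        open Butterfly bf
        on : R v ⊆ On
        on {u} r = decidable-stable (On? u) λ ¬o → none (u , r , ¬o)

      -- b₁ and b₂ cannot both lie on a given edge of b.
      off-edge : ∀ {x j} (J : Join x j) → let open Join J in
        ∃ λ w → w ∈ b × (Ind (λ v → v ∈ b × v ≢ w) → Ind (_∈ b))
      off-edge J with edge⊎Ind (_∈? Join.b J)
      ... | inj₂ ind = _ , Join.b₁∈ J , λ _ → ind
      ... | inj₁ (p , q , bp , bq , e) with Join.b₁ J ≟ p | Join.b₁ J ≟ q
      ... | no ¬p | no ¬q = _ , b₁∈ , λ i → ⊥-elim (i (bp , ¬p ∘ sym) (bq , ¬q ∘ sym) e)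
        where open Join J
      ... | yes refl | _ = _ , b₂∈ , λ i → ⊥-elim
          (i (bp , λ h → b₁≁b₂ (inj₁ h)) (bq , λ { refl → b₁≁b₂ (inj₂ e) }) e)
        where open Join J
      ... | _ | yes refl = _ , b₂∈ , λ i → ⊥-elim
          (i (bp , λ { refl → b₁≁b₂ (inj₂ (~-sym e)) }) (bq , λ h → b₁≁b₂ (inj₁ h)) e)
        where open Join J

      join-tight : ∀ {x j} → S x → Join x j → F S (suc k)
      join-tight {x} sx J = go (R-trans (R-sym (b⊆ b₁∈)) (b⊆ b₂∈))
        where
        open Join J
        two : ∀ {i₀ a₁} → i₀ ∈ a → a₁ ∈ a → a₁ ≢ i₀ → F S (suc k)
        two {i₀} {a₁} i₀∈ a₁∈ ne with off-edge J
        ... | w , w∈ , spread = regrow (class⊆ sx (b⊆ w∈)) (b⊆ w∈) step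
          where
          step : ∀ {i} → F ((S - w) ∩ R x) i → F (R x) (suc i)
          step {i} q with Fin.any? (λ v → (v ∈? a) ×-dec (v ∈? Cover.a q))
          -- `v` is adjacent to all of `b`, so nothing of `b` shares the independent part with it.
          ... | yes (v , v∈ , v∈q) = F-from (_∈? a) (_∈? b) ind clu
                (≤-trans (cliques-remove (_∈? b) (_∈? Cover.b q) (E? w) (Cover.clu q)
                  (λ y z e f → clu w∈ y z f (inj₂ e)) (λ y z e f → clu y w∈ z (E-sym e) f)
                  rest) (s≤s (Cover.bound q))) cover
            where
            rest : ∀ {u} → u ∈ b × ¬ E w u → u ∈ Cover.b q
            rest (u∈ , ¬e) with Cover.cover q ((class⊆ sx (b⊆ u∈) , λ { refl → ¬e (inj₁ refl) }) , b⊆ u∈)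
            ... | inj₁ h = ⊥-elim (Cover.good q v∈q h (joined v∈ u∈))
            ... | inj₂ h = h
          -- All of `a` is in the cluster part. Two non-adjacent vertices there bar their common
          -- neighbours from that part, so `b` without `w` is independent. By the choice of `w` so
          -- is `b`, and the two sides swap roles.
          ... | no none = cover-mono id (m≤n⇒m≤1+n ≤-refl)
              (F-from (_∈? b) (_∈? a) (spread sparse) (Clu-⊆ a⊆q (Cover.clu q))
                (≤-trans (cliques-mono (_∈? a) (_∈? Cover.b q) (Cover.clu q) a⊆q) (Cover.bound q))
                ([ inj₂ , inj₁ ]′ ∘ cover))
            where
            a⊆q : ∀ {v} → v ∈ a → v ∈ Cover.b q
            a⊆q v∈ with Cover.cover q ((class⊆ sx (a⊆ v∈) , ~⇒≢ (joined v∈ w∈)) , a⊆ v∈)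
            ... | inj₁ h = ⊥-elim (none (_ , v∈ , h))
            ... | inj₂ h = h
            b⊆q : ∀ {v} → v ∈ b → v ≢ w → v ∈ Cover.a q
            b⊆q v∈ v≢w with Cover.cover q ((class⊆ sx (b⊆ v∈) , v≢w) , b⊆ v∈)
            ... | inj₁ h = h
            ... | inj₂ h with Cover.clu q (a⊆q i₀∈) h (a⊆q a₁∈) (inj₂ (joined i₀∈ v∈)) (inj₂ (~-sym (joined a₁∈ v∈)))
            ...   | inj₁ f = ⊥-elim (ne (sym f))
            ...   | inj₂ f = ⊥-elim (ind i₀∈ a₁∈ f)
            sparse : Ind (λ v → v ∈ b × v ≢ w)
            sparse (p , p≢) (p′ , p′≢) = Cover.good q (b⊆q p p≢) (b⊆q p′ p′≢)
        one : ∀ {c} → c ∈ a → (∀ {v} → v ∈ a → v ≡ c) → F S (suc k)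
        one {c} c∈ only = wheel-tight (class⊆ sx (a⊆ c∈)) (λ r ne → joined c∈ (rim (r , ne))) (Clu-⊆ rim clu)
          where
          rim : ∀ {u} → R c u × u ≢ c → u ∈ b
          rim (r , ne) with cover (R-trans (a⊆ c∈) r)
          ... | inj₁ h = ⊥-elim (ne (only h))
          ... | inj₂ h = h
        go : R b₁ b₂ → F S (suc k)
        go (near e) = ⊥-elim (b₁≁b₂ e)
        go (via c e f) with cover (R-closed e (b⊆ b₁∈))
        ... | inj₂ h = ⊥-elim (b₁≁b₂ (clu b₁∈ h b₂∈ (inj₂ e) (inj₂ f)))
        ... | inj₁ c∈ with Fin.any? (λ v → (v ∈? a) ×-dec ¬? (v ≟ c))
        ...   | yes (a₁ , a₁∈ , ne) = two c∈ a₁∈ ne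
        ...   | no none = one c∈ λ {v} v∈ → decidable-stable (v ≟ c) λ ne → none (v , v∈ , ne)

    -- Criticality bounds f from below by k + 1. For the upper bound one class suffices: the class
    -- of an arbitrary edge, whose shape is known because f is finite.
    crit-tight : ∀ {j} → F S j → F S (suc k)
    crit-tight p with edge⊎Ind S?
    ... | inj₂ ind = ⊥-elim (notF (F-empty S? ind id))
    ... | inj₁ (x , y , sx , sy , e) with F-split (R? x) R-closed p
    ...   | i , _ , Fi , _ with class-shape (cover-mono (λ r → class⊆ sx r , r) ≤-refl Fi)
    ...     | inj₁ one = replace-class sx one
    ...     | inj₂ J   = join-tight sx J

    -- On a cluster without isolated vertices f is the number of cliques.
    crit-cliques : Clu S → cliques S? ≡ suc k
    crit-cliques clu = ≤-antisym
      (F-cliques S? clu (λ sv → let u , e = crit-nbr sv in u , isClosed e sv , e) id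
        (crit-tight (F-clu S? clu ≤-refl id)))
      (≰⇒> λ le → notF (F-clu S? clu le id))

    -- In a clique component with a third vertex, a deletion would not lower f.
    crit-unique : ∀ {u} → S u → (∀ {v w} → R u v → R u w → E v w) → UniqueNbr u
    crit-unique su clique = unique-nbr (crit-nbr su) λ e f p≢q →
      notF (F-clique-vertex clique e f p≢q (isClosed e su) (isClosed f su) (remove su))

-- A butterfly with disjoint edges

module Winged (G : Graph) (p₄-free : P₄-free G) where

  open Basics G
  open Classes G p₄-free
  open Critical G p₄-free

  -- The exceptional graph (kᵢ - 2)K₂ + (K₁ ⊕ 2K₂) with kᵢ = m + 2, located inside `G` instead of
  -- given up to isomorphism.
  record WingedSet (S : V → Set) (m : ℕ) : Set where
    field
      S?       : Decidable S
      isClosed : Closed S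
      {hub}    : V
      hub∈S    : S hub
      wings    : Butterfly hub
      whole    : R hub ⊆ Butterfly.On wings
      matched  : ∀ {u} → S u → ¬ R hub u → UniqueNbr u

    Rest? : Decidable (S ∖ R hub)
    Rest? u = S? u ×-dec ¬? (R? hub u)

    field
      size-rest : cliques Rest? ≡ m

    open Butterfly wings

    rest-Clu : Clu (S ∖ R hub)
    rest-Clu = UniqueNbr-Clu λ (s , ¬r) → matched s ¬r

    rest-nbr : ∀ {u} → (S ∖ R hub) u → ∃ λ w → (S ∖ R hub) w × u ~ w
    rest-nbr (s , ¬r) with matched s ¬r
    ... | w , e , _ = w , (isClosed e s , Closed-∁ R-closed e ¬r) , e

    On⊆S : On ⊆ S
    On⊆S o = Closed-R isClosed (On⇒R o) hub∈S

    -- The two wings and the m edges each still need a clique, so deleting the hub saves nothing;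
    -- hence such a set is never critical.
    F-hubless : ∀ {j} → F (S - hub) j → 2 + m ≤ j
    F-hubless p with F-split (R? hub) R-closed p
    ... | i , j , Fi , Fj , le = ≤-trans (+-mono-≤
      (F-wings Fi λ (o , ne) → (On⊆S o , ne) , On⇒R o)
      (subst (_≤ j) size-rest
        (F-cliques Rest? rest-Clu rest-nbr (λ (s , ¬r) → (s , λ { refl → ¬r R-refl }) , ¬r) Fj))) le

    F-rest : F (S ∖ R hub) m
    F-rest = F-clu Rest? rest-Clu (≤-reflexive size-rest) id

    F-winged : F S (2 + m)
    F-winged = F-join (R? hub) R-closed F-butterfly F-rest (λ (_ , r) → whole r) id

    -- Without the hub only disjoint edges remain, which leaves the multipartite part free for the
    -- other side.
    hubless-cover : Σ (Decidable (S - hub)) λ D? → Clu (S - hub) × cliques D? ≤ 2 + m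
    hubless-cover = D? , clu , ≤-trans (≤-reflexive (cliques-split D? (R? hub) (λ _ _ → R-closed)))
        (+-mono-≤ (≤-trans (cliques-mono (λ v → D? v ×-dec R? hub v) Wing? wings-Clu λ ((s , ne) , r) → whole r , ne) wings-cliques)
                  (≤-trans (cliques-mono (λ v → D? v ×-dec ¬? (R? hub v)) Rest? rest-Clu
                    λ ((s , _) , ¬r) → s , ¬r) (≤-reflexive size-rest)))
      where
      D? : Decidable (S - hub)
      D? = -? S? hub
      clu : Clu (S - hub)
      clu {u} {v} {w} (p , a) (q , b) (r , c) e f with R? hub v
      ... | yes h = wings-Clu (whole (Closed-E R-closed (E-sym e) h) , a) (whole h , b)
                              (whole (Closed-E R-closed f h) , c) e f
      ... | no ¬h = rest-Clu (p , λ h → ¬h (Closed-E R-closed e h)) (q , ¬h)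
                             (r , λ h → ¬h (Closed-E R-closed (E-sym f) h)) e f

    -- The hub and one wing form a triangle, which is complete multipartite; cliques are needed only
    -- for the other wing and the m edges.
    Q-winged : Q S (suc m)
    Q-winged = Q-join (R? hub) R-closed Rest? Q-on rest-Clu (≤-reflexive size-rest) (λ (_ , r) → whole r) id
      where
      Tri? : Decidable (λ u → u ≡ hub ⊎ (Wing u × E x₁ u))
      Tri? u = (u ≟ hub) ⊎-dec (Wing? u ×-dec E? x₁ u)
      Far? : Decidable (λ u → Wing u × ¬ E x₁ u)
      Far? u = Wing? u ×-dec ¬? (E? x₁ u)
      far-clique : ∀ {u w} → Wing u × ¬ E x₁ u → Wing w × ¬ E x₁ w → E u w
      far-clique (p , ¬e) (q , ¬f) = wing₂-clique p q ([ ⊥-elim ∘ ¬e , id ]′ (wing p)) ([ ⊥-elim ∘ ¬f , id ]′ (wing q))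
      hub~ : ∀ {u} → Wing u → E x₁ u → hub ~ u
      hub~ p e with wing₁ p e
      ... | inj₁ refl = v~x₁
      ... | inj₂ refl = v~y₁
      tri : ∀ {u w} → u ≡ hub ⊎ (Wing u × E x₁ u) → w ≡ hub ⊎ (Wing w × E x₁ w) → E u w
      tri (inj₁ refl) (inj₁ refl)    = inj₁ refl
      tri (inj₁ refl) (inj₂ (q , f)) = inj₂ (hub~ q f)
      tri (inj₂ (p , e)) (inj₁ refl) = inj₂ (~-sym (hub~ p e))
      tri (inj₂ (p , e)) (inj₂ (q , f)) = wing₁-clique p q e f
      Q-on : Q On 1
      Q-on = Q-from Tri? Far? (clique⇒MP tri) (clique⇒Clu far-clique) (cliques-clique Far? far-clique) cov
        where
        cov : ∀ {u} → On u → (u ≡ hub ⊎ (Wing u × E x₁ u)) ⊎ (Wing u × ¬ E x₁ u)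
        cov {u} o with u ≟ hub | E? x₁ u
        ... | yes e | _     = inj₁ (inj₁ e)
        ... | no ¬e | yes f = inj₁ (inj₂ ((o , ¬e) , f))
        ... | no ¬e | no ¬f = inj₂ ((o , ¬e) , ¬f)

    F-broken-wing : ∀ {y x′ y′} → ¬ E y x′ → hub ~ y′ →
                    F (λ u → u ≡ hub ⊎ u ≡ y ⊎ u ≡ x′ ⊎ u ≡ y′) 1
    F-broken-wing {y} {x′} {y′} ne h = F-from A? B? ind (clique⇒Clu clique) (cliques-clique B? clique)
        λ { (inj₁ e) → inj₂ (inj₁ e) ; (inj₂ (inj₁ e)) → inj₁ (inj₁ e)
          ; (inj₂ (inj₂ (inj₁ e))) → inj₁ (inj₂ e) ; (inj₂ (inj₂ (inj₂ e))) → inj₂ (inj₂ e) }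
      where
      A? : Decidable (λ u → u ≡ y ⊎ u ≡ x′)
      A? u = (u ≟ y) ⊎-dec (u ≟ x′)
      B? : Decidable (λ u → u ≡ hub ⊎ u ≡ y′)
      B? u = (u ≟ hub) ⊎-dec (u ≟ y′)
      ind : Ind (λ u → u ≡ y ⊎ u ≡ x′)
      ind (inj₁ refl) (inj₁ refl) = ~-irrefl
      ind (inj₁ refl) (inj₂ refl) = ne ∘ inj₂
      ind (inj₂ refl) (inj₁ refl) = ne ∘ inj₂ ∘ ~-sym
      ind (inj₂ refl) (inj₂ refl) = ~-irrefl
      clique : ∀ {u w} → u ≡ hub ⊎ u ≡ y′ → w ≡ hub ⊎ w ≡ y′ → E u w
      clique (inj₁ refl) (inj₁ refl) = inj₁ refl
      clique (inj₁ refl) (inj₂ refl) = inj₂ h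
      clique (inj₂ refl) (inj₁ refl) = inj₂ (~-sym h)
      clique (inj₂ refl) (inj₂ refl) = inj₁ refl

    F-wingless : ∀ {w} → On w → w ≢ hub → F (On - w) 1
    F-wingless (zero , refl) ne = ⊥-elim (ne refl)
    F-wingless (suc zero , refl) _ = cover-mono
      (λ { ((zero , refl) , _) → inj₁ refl ; ((suc zero , refl) , ne) → ⊥-elim (ne refl)
         ; ((suc (suc zero) , refl) , _) → inj₂ (inj₁ refl)
         ; ((suc (suc (suc zero)) , refl) , _) → inj₂ (inj₂ (inj₁ refl))
         ; ((suc (suc (suc (suc zero))) , refl) , _) → inj₂ (inj₂ (inj₂ refl)) })
      ≤-refl (F-broken-wing y₁≁x₂ v~y₂)
    F-wingless (suc (suc zero) , refl) _ = cover-mono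
      (λ { ((zero , refl) , _) → inj₁ refl ; ((suc (suc zero) , refl) , ne) → ⊥-elim (ne refl)
         ; ((suc zero , refl) , _) → inj₂ (inj₁ refl)
         ; ((suc (suc (suc zero)) , refl) , _) → inj₂ (inj₂ (inj₁ refl))
         ; ((suc (suc (suc (suc zero))) , refl) , _) → inj₂ (inj₂ (inj₂ refl)) })
      ≤-refl (F-broken-wing x₁≁x₂ v~y₂)
    F-wingless (suc (suc (suc zero)) , refl) _ = cover-mono
      (λ { ((zero , refl) , _) → inj₁ refl ; ((suc (suc (suc zero)) , refl) , ne) → ⊥-elim (ne refl)
         ; ((suc (suc (suc (suc zero))) , refl) , _) → inj₂ (inj₁ refl)
         ; ((suc zero , refl) , _) → inj₂ (inj₂ (inj₁ refl))
         ; ((suc (suc zero) , refl) , _) → inj₂ (inj₂ (inj₂ refl)) })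
      ≤-refl (F-broken-wing (x₁≁y₂ ∘ E-sym) v~y₁)
    F-wingless (suc (suc (suc (suc zero))) , refl) _ = cover-mono
      (λ { ((zero , refl) , _) → inj₁ refl ; ((suc (suc (suc (suc zero))) , refl) , ne) → ⊥-elim (ne refl)
         ; ((suc (suc (suc zero)) , refl) , _) → inj₂ (inj₁ refl)
         ; ((suc zero , refl) , _) → inj₂ (inj₂ (inj₁ refl))
         ; ((suc (suc zero) , refl) , _) → inj₂ (inj₂ (inj₂ refl)) })
      ≤-refl (F-broken-wing (x₁≁x₂ ∘ E-sym) v~y₁)

    F-remove : ∀ {w} → S w → w ≢ hub → F (S - w) (suc m)
    F-remove {w} sw ne with R? hub w
    ... | yes r = F-join (R? hub) R-closed (F-wingless (whole r) ne) F-rest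
                    (λ ((_ , n) , r) → whole r , n) (λ ((s , _) , ¬r) → s , ¬r)
    ... | no ¬r with matched sw ¬r
    -- The partner `w′` of the deleted vertex is now isolated and moves to the independent part, so
    -- one edge of the matching no longer counts.
    ...   | w′ , e , unique = cover-mono id le
              (F-join (R? hub) R-closed F-butterfly F-rest′ (λ (_ , r) → whole r) id)
      where
      Rest₀? : Decidable ((S ∖ R hub) ∖ E w)
      Rest₀? u = Rest? u ×-dec ¬? (E? w u)
      r₀ = cliques Rest₀?
      F-rest′ : F ((S - w) ∖ R hub) r₀
      F-rest′ = F-from (_≟ w′) Rest₀? (λ { refl refl → ~-irrefl }) (Clu-⊆ proj₁ rest-Clu) ≤-refl cov
        where
        cov : ∀ {u} → ((S - w) ∖ R hub) u → u ≡ w′ ⊎ ((S ∖ R hub) ∖ E w) u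
        cov {u} ((s , ne) , ¬r) with w ~? u
        ... | yes f = inj₁ (unique u f)
        ... | no ¬f = inj₂ ((s , ¬r) , [ ne ∘ sym , ¬f ]′)
      le : 2 + r₀ ≤ suc m
      le = s≤s (≤-trans (+-monoˡ-≤ r₀ (cliques-nonempty (λ u → Rest? u ×-dec E? w u) (Clu-⊆ proj₁ rest-Clu)
                                       ((sw , ¬r) , inj₁ refl)))
             (≤-trans (≤-reflexive (sym (cliques-split Rest? (E? w)
               (λ p q e f → rest-Clu (sw , ¬r) p q f (inj₂ e))))) (≤-reflexive size-rest)))

    winged-nbr : ∀ {u} → S u → ∃ (u ~_)
    winged-nbr {u} su with R? hub u
    ... | no ¬r with matched su ¬r
    ...   | w , e , _ = w , e
    winged-nbr {u} su | yes r with whole r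
    ... | zero , refl                       = x₁ , v~x₁
    ... | suc zero , refl                   = hub , ~-sym v~x₁
    ... | suc (suc zero) , refl             = hub , ~-sym v~y₁
    ... | suc (suc (suc zero)) , refl       = hub , ~-sym v~x₂
    ... | suc (suc (suc (suc zero))) , refl = hub , ~-sym v~y₂

    winged-centre : Centre S hub
    winged-centre = x₁ , x₂ , On⊆S x₁-On , hub∈S , On⊆S x₂-On , ~-sym v~x₁ , v~x₂ , x₁≁x₂

  -- The class of `d` is a join, so one of its cliques moves to the multipartite side; the other
  -- components are edges and get along with cliques alone.
  crit-Q : ∀ {S k d y} → Crit S k → F S (suc k) → Centre S y → S d →
           (∀ {u} → S u → ¬ R d u → UniqueNbr u) → Q S k
  crit-Q {S} {k} {d} {y} C p (x , z , sx , sy , sz , e , f , ne) sd uniq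
    with F-split (R? d) R-closed p
  ... | i , j , Fi , Fj , le with class-shape (cover-mono (λ r → class⊆ C sd r , r) ≤-refl Fi)
  ... | inj₂ J with Join⇒Q J
  ...   | i′ , q , le′ = cover-mono id (≤-pred (≤-trans (+-monoˡ-≤ j le′) le))
            (Q-join (R? d) R-closed Rest? q rest-Clu (F-cliques Rest? rest-Clu rest-nbr id Fj) proj₂ id)
    where
    open Crit C
    Rest? : Decidable (S ∖ R d)
    Rest? u = S? u ×-dec ¬? (R? d u)
    rest-Clu : Clu (S ∖ R d)
    rest-Clu = UniqueNbr-Clu λ (s , ¬r) → uniq s ¬r
    rest-nbr : ∀ {u} → (S ∖ R d) u → ∃ λ w → (S ∖ R d) w × u ~ w
    rest-nbr (s , ¬r) with uniq s ¬r
    ... | w , e , _ = w , (isClosed e s , Closed-∁ R-closed e ¬r) , e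
  crit-Q {S} {k} {d} {y} C p (x , z , sx , sy , sz , e , f , ne) sd uniq
      | i , j , Fi , Fj , le | inj₁ one with F-split (R? d) R-closed (Crit.remove C sz)
  -- A split class is impossible here: after deletion of `z` the edge between `x` and `y` still
  -- costs the one clique that the whole class needs.
  ... | i′ , j′ , Fi′ , Fj′ , le′ = ⊥-elim (Crit.notF C (cover-mono id
          (≤-trans (+-monoˡ-≤ j′ 1≤i′) le′)
          (F-join (R? d) R-closed one Fj′ proj₂ λ (s , ¬r) → (s , λ { refl → ¬r rz }) , ¬r)))
    where
    ry : R d y
    ry = decidable-stable (R? d y) λ ¬r → case (uniq sy ¬r)
      where
      case : UniqueNbr y → ⊥
      case (_ , _ , unique) = ne (inj₁ (trans (unique x (~-sym e)) (sym (unique z f))))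
    rz : R d z
    rz = R-closed f ry
    1≤i′ : 1 ≤ i′
    1≤i′ = F-edge Fi′ ((sx , λ { refl → ne (inj₁ refl) }) , R-closed (~-sym e) ry) ((sy , ~⇒≢ f) , ry) e

  -- Adding up the bounds of two sides

  module _ {S₁ S₂ : V → Set} {k₁ k₂ : ℕ} (S₁? : Decidable S₁) (S₁-closed : Closed S₁)
           (apart : ∀ {v} → S₁ v → S₂ v → ⊥) (cover : ∀ v → S₁ v ⊎ S₂ v) where

    private
      out : ∀ {v} → ¬ S₁ v → S₂ v
      out {v} ¬s = [ ⊥-elim ∘ ¬s , id ]′ (cover v)

    -- With P₃'s on both sides the multipartite part is independent, so the cover splits. The sides
    -- need k₁ + 1 and k₂ + 1 cliques, one more in total than allowed.
    sum-not-Q : ∀ {y₁ y₂} → ¬ F S₁ k₁ → ¬ F S₂ k₂ → Centre S₁ y₁ → Centre S₂ y₂ →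
                ¬ Q U (suc (k₁ + k₂))
    sum-not-Q ¬F₁ ¬F₂ c₁ c₂ q
      with F-split S₁? S₁-closed (two-centres q (Centre-⊆ _ c₁) (Centre-⊆ _ c₂)
             (λ r → apart (Closed-R S₁-closed r (centre∈ c₁)) (centre∈ c₂)))
      where
      centre∈ : ∀ {S y} → Centre S y → S y
      centre∈ (_ , _ , _ , s , _) = s
    ... | i , j , Fi , Fj , le with i ≤? k₁ | j ≤? k₂
    ... | yes p | _     = ¬F₁ (cover-mono (λ s → _ , s) p Fi)
    ... | no _  | yes p = ¬F₂ (cover-mono (λ s → _ , λ s₁ → apart s₁ s) p Fj)
    ... | no p  | no p′ = n≮n (suc (k₁ + k₂)) (≤-trans (≤-trans (s≤s (≤-reflexive (sym (+-suc k₁ k₂))))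
                            (+-mono-≤ (≰⇒> p) (≰⇒> p′))) le)

    sum-F : ∀ {w} → S₁ w → F (S₁ - w) k₁ → F S₂ (suc k₂) → Q (U - w) (suc (k₁ + k₂))
    sum-F sw p q = F⇒Q (cover-mono id (≤-reflexive (+-suc k₁ k₂))
      (F-join S₁? S₁-closed p q (λ ((_ , ne) , s) → s , ne) (λ (_ , ¬s) → out ¬s)))

    -- Meant for the deletion of a hub in `S₁`: that side is then a cluster, and the multipartite
    -- part is spent on `S₂`.
    sum-Q : ∀ {w} (D? : Decidable (S₁ - w)) → Clu (S₁ - w) → cliques D? ≤ suc k₁ → Q S₂ k₂ →
            Q (U - w) (suc (k₁ + k₂))
    sum-Q D? clu le q = cover-mono id (≤-reflexive (+-comm k₂ (suc k₁)))
      (Q-join (¬? ∘ S₁?) (Closed-∁ S₁-closed) D? q clu le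
        (λ (_ , ¬s) → out ¬s) (λ {v} ((_ , ne) , ¬¬s) → decidable-stable (S₁? v) ¬¬s , ne))

-- Decomposing an obstruction

module Obstruction (G : Graph) (p₄-free : P₄-free G) (k : ℕ) where

  open Basics G
  open Classes G p₄-free
  open Critical G p₄-free
  open Winged G p₄-free

  ∁R : V → V → Set
  ∁R x v = ¬ R x v

  ∁R? : ∀ x → Decidable (∁R x)
  ∁R? x v = ¬? (R? x v)

  centre-avoiding : ∀ {y w} → Centre U y → ¬ R w y → Centre (U - w) y
  centre-avoiding (x , z , _ , _ , _ , e , f , ne) ¬r =
    x , z , (_ , λ { refl → ¬r (near (inj₂ e)) }) , (_ , λ { refl → ¬r R-refl })
      , (_ , λ { refl → ¬r (near (inj₂ (~-sym f))) }) , e , f , ne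

  centre-outside : ∀ {v y} → Centre U y → ¬ R v y → Centre (∁R v) y
  centre-outside (x , z , _ , _ , _ , e , f , ne) ¬r =
    x , z , ¬r ∘ R-closed e , ¬r , ¬r ∘ R-closed (~-sym f) , e , f , ne

  centre-edge : ∀ {y j} → Centre U y → F (R y) j → 1 ≤ j
  centre-edge (x , _ , _ , _ , _ , e , _ , _) p = F-edge p (near (inj₂ (~-sym e))) R-refl e

  no-centre-class : ∀ {u} → (∀ {y} → Centre U y → ¬ R u y) → ∀ {v w} → R u v → R u w → E v w
  no-centre-class none rv rw = Clu-R R-closed (no-centre⇒Clu nc) rv (R-trans (R-sym rv) rw)
    where
    nc : ∀ {y} → ¬ Centre (R _) y
    nc c@(_ , _ , _ , r , _) = none (Centre-⊆ _ c) r

  least-F : ∀ {S j} → Decidable S → F S j → ¬ F S 0 → ∃ λ i → suc i ≤ j × ¬ F S i × F S (suc i)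
  least-F {j = zero} S? p ¬z = ⊥-elim (¬z p)
  least-F {j = suc j} S? p ¬z with F? S? j
  ... | no ¬p = j , ≤-refl , ¬p , p
  ... | yes q with least-F S? q ¬z
  ...   | i , le , rest = i , m≤n⇒m≤1+n le , rest

  -- Three cases: every deletion lowers f, or a hub on one side fails to, or a hub on each side
  -- does. The bounds `j₁` and `j₂` record that f is finite, which excludes (1,∞)-obstructions; the
  -- degree-one clause of `winged-critical` prepares condition (4).
  data Decomposition : Set where
    critical : ∀ {y y′ k₁ k₂ j₁ j₂} → Centre (R y) y → Centre (∁R y) y′ →
      Crit (R y) k₁ → Crit (∁R y) k₂ → F (R y) j₁ → F (∁R y) j₂ → k ≡ suc (k₁ + k₂) → Decomposition
    winged-critical : ∀ {v y k₂ j₂} → WingedSet (R v) 0 → Centre (∁R v) y → Crit (∁R v) k₂ →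
      F (∁R v) j₂ → (∀ {u} → ¬ R v u → ¬ R y u → UniqueNbr u) → k ≡ suc (suc k₂) → Decomposition
    winged-winged : ∀ {v m} → WingedSet (R v) 0 → WingedSet (∁R v) m → k ≡ suc (suc (suc m)) → Decomposition

  module _ (¬Q : ¬ Q U k) (minQ : ∀ w → Q (U - w) k) (nbr : ∀ v → ∃ (v ~_)) where

    private
      ¬F : ¬ F U k
      ¬F = ¬Q ∘ F⇒Q

    module _ {c o : V} (centres : ∀ {y} → Centre U y → R c y) (¬co : ¬ R c o) where

      private
        O = ∁R c
        O? = ∁R? c

        O-Clu : Clu O
        O-Clu = no-centre⇒Clu λ { z@(_ , _ , _ , ¬r , _) → ¬r (centres (Centre-⊆ _ z)) }

        O-R : ∀ {u v} → O u → R u v → E u v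
        O-R = Clu-R (Closed-∁ R-closed) O-Clu

        O-nbr : ∀ {u} → O u → ∃ λ w → O w × u ~ w
        O-nbr {u} ou with nbr u
        ... | w , e = w , Closed-∁ R-closed e ou , e

        cO = cliques O?

        clique : ∀ {p u v} → O u → R p u → R p v → E u v
        clique ou ru rv = O-R ou (R-trans (R-sym ru) rv)

        o-clique : ∀ {u v} → R o u → R o v → E u v
        o-clique ru = clique (λ r → ¬co (R-trans r (R-sym ru))) ru

        F-class : F (R c) 1 → ¬ suc cO ≤ k
        F-class p le = ¬F (cover-mono id le
          (F-join (R? c) R-closed p (F-clu O? O-Clu ≤-refl id) proj₂ proj₂))

        -- Three vertices violating the claim survive the deletion of a neighbour `v` of `z`, since
        -- `x` and `y` are not adjacent to `z`. Every cover of the remaining graph then shows that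
        -- one clique besides the `cO` outer ones fits into k, against `F-class`.
        class-MP : F (R c) 1 → MP (R c)
        class-MP one {x} {z} {y} rx rz ry x≁z z≁y x~y with nbr z
        ... | v , z~v = F-class one (cO<k (Q-cases (minQ v)))
          where
          q = minQ v
          open Cover q
          rv : R c v
          rv = R-closed z~v rz
          x≢ : x ≢ v
          x≢ refl = x≁z (~-sym z~v)
          y≢ : y ≢ v
          y≢ refl = z≁y z~v
          bClass? = λ u → (u ∈? b) ×-dec R? c u
          bRest?  = λ u → (u ∈? b) ×-dec O? u
          total : ∀ {i j} → i ≤ cliques bClass? → j ≤ cliques bRest? → i + j ≤ k
          total p p′ = ≤-trans (+-mono-≤ p p′)
            (≤-trans (≤-reflexive (sym (cliques-split (_∈? b) (R? c) (λ _ _ → R-closed)))) bound)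
          b-clu : ∀ {P : V → Set} → Clu (λ u → u ∈ b × P u)
          b-clu = Clu-⊆ proj₁ clu
          cO<k : F (U - v) k ⊎ (∃ λ p → (∀ {u} → u ∈ a → R p u) × (∀ {u} → (U - v) u → ¬ R p u → u ∈ b)) →
                  suc cO ≤ k
          cO<k (inj₁ f) with F-split (R? c) R-closed f
          ... | i , j , Fi , Fj , le = ≤-trans (+-mono-≤
                (F-edge Fi ((_ , x≢) , rx) ((_ , y≢) , ry) x~y)
                (F-cliques O? O-Clu O-nbr (λ ou → (_ , λ { refl → ou rv }) , ou) Fj)) le
          cO<k (inj₂ (p , inR , out)) with R? c p
          -- The multipartite edge is inside the class. Still `x`, `z`, `y` cannot all be in the
          -- multipartite part, so the cluster part meets the class.
          ... | yes rp = total (cliques-nonempty bClass? b-clu (proj₂ hit))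
                (cliques-mono O? bRest? b-clu λ ou → out (_ , λ { refl → ou rv }) (ou ∘ R-trans rp) , ou)
            where
            hit : ∃ λ u → u ∈ b × R c u
            hit with cover {x} (_ , x≢) | cover {z} (_ , ~⇒≢ z~v) | cover {y} (_ , y≢)
            ... | inj₂ h | _ | _ = x , h , rx
            ... | _ | inj₂ h | _ = z , h , rz
            ... | _ | _ | inj₂ h = y , h , ry
            ... | inj₁ h | inj₁ h′ | inj₁ h″ = ⊥-elim (good h h′ h″ x≁z z≁y x~y)
          -- The multipartite part may absorb one clique outside the class, but then the
          -- non-adjacent `x` and `z` cost two cliques inside.
          ... | no ¬rp = ≤-trans (s≤s (cliques-remove O? bRest? (R? p) b-clu (λ _ _ → R-closed)
                  (λ ou _ → clique ou) (λ (ou , ¬r) → out (_ , λ { refl → ou rv }) ¬r , ou)))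
                (total (cliques-two bClass? b-clu (in-b x≢ rx , rx) (in-b (~⇒≢ z~v) rz , rz)
                  (λ { (inj₁ refl) → z≁y x~y ; (inj₂ e) → x≁z e })) ≤-refl)
            where
            in-b : ∀ {u} → u ≢ v → R c u → u ∈ b
            in-b u≢ ru = out (_ , u≢) λ r → ¬rp (R-trans ru (R-sym r))

        -- Deleting `o` frees at most one clique outside the class of `c`. Restoring it is paid for
        -- by moving one clique of that class, or the whole class if it is split, to the
        -- multipartite side.
        independent : F (U - o) k → ⊥
        independent p with F-split (R? o) R-closed p
        ... | i , j , _ , Fj , le with F-split (R? c) R-closed Fj
        ... | i₁ , i₂ , F₁ , F₂ , le′ = final (class-shape F-c)
          where
          O∖o? : Decidable (O ∖ R o)
          O∖o? u = O? u ×-dec ¬? (R? o u)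
          F-c : F (R c) i₁
          F-c = cover-mono (λ {u} r → (((_ , λ { refl → ¬co r }) , λ r′ → ¬co (R-trans r (R-sym r′))) , r)) ≤-refl F₁
          cO≤ : cO ≤ suc i₂
          cO≤ = ≤-trans (cliques-remove O? O∖o? (R? o) (Clu-⊆ proj₁ O-Clu) (λ _ _ → R-closed) (λ ou _ → clique ou) id)
            (s≤s (F-cliques O∖o? (Clu-⊆ proj₁ O-Clu)
              (λ (ou , ¬r) → let w , ow , e = O-nbr ou in w , (ow , Closed-∁ R-closed e ¬r) , e)
              (λ (ou , ¬r) → ((_ , λ { refl → ¬r R-refl }) , ¬r) , ou) F₂))
          le″ : i₁ + i₂ ≤ k
          le″ = ≤-trans le′ (≤-trans (m≤n+m j i) le)
          Q-c : ∀ {i} → Q (R c) i → suc i ≤ i₁ → ⊥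
          Q-c {i} q lt = ¬Q (cover-mono id
            (≤-trans (+-monoʳ-≤ i cO≤) (≤-trans (≤-reflexive (+-suc i i₂)) (≤-trans (+-monoˡ-≤ i₂ lt) le″)))
            (Q-join (R? c) R-closed O? q O-Clu ≤-refl proj₂ proj₂))
          final : F (R c) 1 ⊎ Join c i₁ → ⊥
          final (inj₂ J) = let i , q , lt = Join⇒Q J in Q-c q lt
          final (inj₁ one) = Q-c (Q-from {B = λ _ → ⊥} (R? c) (λ _ → no id) (class-MP one) (λ ())
                                    (cliques-empty (λ _ → no id) id) inj₁)
                                 (let w , e = nbr c in F-edge F-c R-refl (near (inj₂ e)) e)

      -- The component of `o` is a clique, so a cover of the graph without `o` extends to `o`
      -- without a further clique.
      one-class : ⊥
      one-class with Q-cases (minQ o)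
      ... | inj₁ p = independent p
      ... | inj₂ (p , inR , out) with R? p o
      -- The multipartite edge lies in the clique of `o`, so this entire clique can serve as the
      -- multipartite part.
      ...   | yes r = ¬Q (Q-from (R? o) (_∈? b) (clique⇒MP o-clique) clu bound cov)
        where
        open Cover (minQ o)
        cov : ∀ {v} → U v → R o v ⊎ v ∈ b
        cov {v} _ with R? o v
        ... | yes s = inj₁ s
        ... | no ¬s = inj₂ (out (_ , λ { refl → ¬s R-refl }) λ s → ¬s (R-trans (R-sym r) s))
      -- A neighbour of `o` is in the cluster part, so its clique is already paid for and can be
      -- taken whole.
      ...   | no ¬r = ¬Q (cover-mono id le (Q-join (∁R? o) (Closed-∁ R-closed) (R? o) q
                        (clique⇒Clu o-clique) (cliques-clique (R? o) o-clique) proj₂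
                        (λ {v} (_ , ¬¬s) → decidable-stable (R? o v) ¬¬s)))
        where
        open Cover (minQ o)
        Far? : Decidable (λ v → v ∈ b × ¬ R o v)
        Far? v = (v ∈? b) ×-dec ∁R? o v
        Near? : Decidable (λ v → v ∈ b × R o v)
        Near? v = (v ∈? b) ×-dec R? o v
        q : Q (∁R o) (cliques Far?)
        q = Q-from (_∈? a) Far? good (Clu-⊆ proj₁ clu) ≤-refl
              λ {v} ¬s → [ inj₁ , (λ h → inj₂ (h , ¬s)) ]′ (cover (_ , λ { refl → ¬s R-refl }))
        near-o : ∃ λ v → v ∈ b × R o v
        near-o with nbr o
        ... | w , e = w , out (_ , ~⇒≢ e ∘ sym) (λ s → ¬r (R-closed (~-sym e) s)) , near (inj₂ e)
        le : cliques Far? + 1 ≤ k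
        le = ≤-trans (≤-reflexive (+-comm (cliques Far?) 1)) (≤-trans
          (+-monoˡ-≤ (cliques Far?) (cliques-nonempty Near? (Clu-⊆ proj₁ clu) (proj₂ near-o)))
          (≤-trans (≤-reflexive (sym (cliques-split (_∈? b) (R? o) (λ _ _ → R-closed)))) bound))

    two-classes : ∀ {u v} → ¬ R u v → ∃₂ λ y y′ → Centre U y × Centre U y′ × ¬ R y y′
    two-classes {u} {v} ¬r = decidable-stable
      (Fin.any? λ y → Fin.any? λ y′ → Centre? U? y ×-dec Centre? U? y′ ×-dec ∁R? y y′) λ none → go none (Fin.any? (Centre? U?))
      where
      elsewhere : ∀ c → ∃ λ o → ¬ R c o
      elsewhere c with R? c u
      ... | no ¬s = u , ¬s
      ... | yes s = v , λ t → ¬r (R-trans (R-sym s) t)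
      go : ¬ (∃₂ λ y y′ → Centre U y × Centre U y′ × ¬ R y y′) → Dec (∃ (Centre U)) → ⊥
      go none (yes (y , c)) = one-class (λ {y′} c′ → decidable-stable (R? y y′) λ ¬s → none (y , y′ , c , c′ , ¬s))
                                        (proj₂ (elsewhere y))
      go none (no ¬c) = one-class (λ c → ⊥-elim (¬c (_ , c))) (proj₂ (elsewhere u))

    module _ (no-P₃ : ∀ {x y z} → x ~ y → y ~ z → ¬ E x z → ∃ λ w → R y w × w ≢ x × w ≢ y × w ≢ z) where

      private
        -- The class has a fourth vertex `w`. Its deletion keeps the P₃ and therefore an edge, so a
        -- class with f = 1 would not become cheaper.
        not-split : ∀ {y y′} → Centre U y → Centre U y′ → ¬ R y y′ → ¬ F (R y) 1
        not-split {y} {y′} (x , z , _ , _ , _ , e , f , ne) c′ ¬r one with no-P₃ e f ne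
        ... | w , rw , w≢x , w≢y , w≢z
          with F-split (R? y) R-closed (two-centres (minQ w)
                 (x , z , (_ , w≢x ∘ sym) , (_ , w≢y ∘ sym) , (_ , w≢z ∘ sym) , e , f , ne)
                 (centre-avoiding c′ λ s → ¬r (R-trans rw s)) ¬r)
        ... | i , j , Fi , Fj , le = ¬F (cover-mono id
              (≤-trans (+-monoˡ-≤ j (F-edge Fi ((_ , w≢x ∘ sym) , near (inj₂ (~-sym e))) ((_ , w≢y ∘ sym) , R-refl) e)) le)
              (F-join (R? y) R-closed one Fj proj₂ λ (_ , ¬s) → (_ , λ { refl → ¬s rw }) , ¬s))

        IsWing : V → Set
        IsWing v = (Σ (Butterfly v) λ bf → R v ⊆ Butterfly.On bf) × ∃ λ d → Centre U d × ¬ R v d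

        -- If the vertex w of the class were not on the butterfly, a cover of
        -- the graph without w would have v in its independent part, and
        -- exchanging v for w would give a cover of the graph without v.
        exchange : ∀ {v d w} → ¬ F (U - v) k → (∀ {u} → R v u → u ≢ v → v ~ u) →
          (bf : Butterfly v) → Centre U d → ¬ R v d → R v w → ¬ Butterfly.On bf w → ⊥
        exchange {v} {d} {w} ¬Fv hub bf cd ¬r rw off = ¬Fv
            (F-from (λ u → ((u ∈? a) ×-dec ¬? (u ≟ v)) ⊎-dec (u ≟ w)) (_∈? b) ind clu bound cov)
          where
          open Butterfly bf
          w≢v : w ≢ v
          w≢v refl = off hub-On
          p : F (U - w) k
          p = two-centres (minQ w) (centre-without w≢v) (centre-avoiding cd λ s → ¬r (R-trans rw s)) ¬r
          open Cover p
          v∈a : v ∈ a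
          v∈a = hub∈a p λ o → _ , λ { refl → off o }
          far : ∀ {u} → u ∈ a × u ≢ v → ¬ u ~ w
          far (h , ne) e = good v∈a h (hub (R-closed (~-sym e) rw) ne)
          ind : Ind (λ u → (u ∈ a × u ≢ v) ⊎ u ≡ w)
          ind (inj₁ (h , _)) (inj₁ (h′ , _)) = good h h′
          ind (inj₁ h) (inj₂ refl)           = far h
          ind (inj₂ refl) (inj₁ h)           = far h ∘ ~-sym
          ind (inj₂ refl) (inj₂ refl)        = ~-irrefl
          cov : ∀ {u} → (U - v) u → ((u ∈ a × u ≢ v) ⊎ u ≡ w) ⊎ u ∈ b
          cov {u} (_ , ne) with u ≟ w
          ... | yes e = inj₁ (inj₂ e)
          ... | no ¬e = [ (λ h → inj₁ (inj₁ (h , ne))) , inj₂ ]′ (cover (_ , ¬e))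

        -- The class is not split, so without `v` it has two cliques; the complete join with the
        -- singleton `v` makes `v` adjacent to everything. `wheel` then yields a butterfly and
        -- `exchange` leaves no room for more.
        wing-at : ∀ {v y y′} → ¬ F (U - v) k → Centre U y → Centre U y′ → ¬ R y y′ →
          R v y → Clu (R v - v) → IsWing v
        wing-at {v} {y} {y′} ¬Fv c c′ ¬r rvy rim-Clu = go (wheel v hub rim-Clu)
          where
          ¬vy′ : ¬ R v y′
          ¬vy′ s = ¬r (R-trans (R-sym rvy) s)
          ¬one : ¬ F (R v) 1
          ¬one p = not-split c c′ ¬r (cover-mono (R-trans rvy) ≤-refl p)
          cov : ∀ {u} → R v u → u ≡ v ⊎ (R v - v) u
          cov {u} r with u ≟ v
          ... | yes e = inj₁ e
          ... | no ¬e = inj₂ (r , ¬e)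
          hub : ∀ {u} → R v u → u ≢ v → v ~ u
          hub r ne with Fin.any? (λ b → Fin.any? λ b′ → -? (R? v) v b ×-dec -? (R? v) v b′ ×-dec ¬? (E? b b′))
          ... | yes (b , b′ , p , p′ , ne′) = complete-join {x = v} {A = _≡ v} {B = R v - v}
                  (λ { refl → R-refl }) proj₁ (λ { refl refl → ~-irrefl }) rim-Clu cov
                  (λ { refl (_ , n) → n refl }) p p′ ne′ refl (r , ne)
          ... | no none = ⊥-elim (¬one (F-from (_≟ v) (-? (R? v) v) (λ { refl refl → ~-irrefl }) rim-Clu
                  (cliques-clique (-? (R? v) v) λ {b} {b′} p p′ → decidable-stable (E? b b′) λ n → none (b , b′ , p , p′ , n)) cov))
          go : F (R v) 1 ⊎ Butterfly v → IsWing v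
          go (inj₁ p) = ⊥-elim (¬one p)
          go (inj₂ bf) = (bf , λ {u} r → decidable-stable (Butterfly.On? bf u) (exchange ¬Fv hub bf c′ ¬vy′ r)) ,
                         y′ , c′ , ¬vy′

        -- The cover after deleting `v` has a multipartite edge, in a class that misses `y` or `y′`.
        -- The P₃ at the missed vertex cannot survive in the cluster part, so `v` belongs to that
        -- class and the rest of it is a cluster.
        find-wing : ∀ {v y y′} → Centre U y → Centre U y′ → ¬ R y y′ → ¬ F (U - v) k → IsWing v
        find-wing {v} {y} {y′} c c′ ¬r ¬Fv with Q-cases (minQ v)
        ... | inj₁ p = ⊥-elim (¬Fv p)
        ... | inj₂ (p , inR , out) = pick (R? p y)
          where
          open Cover (minQ v)
          go : ∀ {y y′} → Centre U y → Centre U y′ → ¬ R y y′ → ¬ R p y → IsWing v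
          go {y} c c′ ¬r ¬py = wing-at ¬Fv c c′ ¬r rvy
              (Clu-⊆ (λ (r , ne) → out (_ , ne) λ s → ¬py (R-trans (R-trans s (R-sym r)) rvy)) clu)
            where
            rvy : R v y
            rvy = decidable-stable (R? v y) λ ¬vy → case (centre-avoiding c ¬vy)
              where
              case : Centre (U - v) y → ⊥
              case (x , z , s , t , u , e , f , ne) = ¬Clu-centre clu
                (x , z , out s (¬py ∘ R-closed e) , out t ¬py , out u (¬py ∘ R-closed (~-sym f)) , e , f , ne)
          pick : Dec (R p y) → IsWing v
          pick (no ¬py) = go c c′ ¬r ¬py
          pick (yes py) = go c′ c (¬r ∘ R-sym) λ py′ → ¬r (R-trans (R-sym py) py′)

        -- A P₃ in a third class would outlive the deletion of `v` together with the one at `d`, and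
        -- so make the multipartite part independent. The other classes are thus cliques, and
        -- minimality allows them only two vertices.
        elsewhere-unique : ∀ {v d} → ¬ F (U - v) k → Butterfly v → Centre U d → ¬ R v d →
                           ∀ {u} → ¬ R v u → ¬ R d u → UniqueNbr u
        elsewhere-unique {v} {d} ¬Fv bf cd ¬vd {u} ¬vu ¬du = unique-nbr (nbr u) λ {p} {q} e f p≢q →
            ¬F (F-clique-vertex (no-centre-class none) e f p≢q _ _ (two-centres (minQ u)
              (Butterfly.centre-without bf λ { refl → ¬vu R-refl }) (centre-avoiding cd (¬du ∘ R-sym)) ¬vd))
          where
          none : ∀ {y} → Centre U y → ¬ R u y
          none c r = ¬Fv (two-centres (minQ v) (centre-avoiding c λ s → ¬vu (R-trans s (R-sym r)))
                       (centre-avoiding cd ¬vd) λ s → ¬du (R-trans (R-sym s) (R-sym r)))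

        module _ {v d : V} (¬Fv : ¬ F (U - v) k) (bf : Butterfly v) (whole : R v ⊆ Butterfly.On bf)
                 (cd : Centre U d) (¬vd : ¬ R v d) where

          open Butterfly bf

          -- Here f of the rest is k - 1. After deletion of `x₁` the butterfly still has an edge, so
          -- the rest costs at most k - 1; the whole butterfly needs only two cliques, so the rest
          -- costs more than k - 2.
          rest-bounds : ∃ λ k₂ → k ≡ suc (suc k₂) × F (∁R v) (suc k₂) × ¬ F (∁R v) k₂
          rest-bounds with F-split (R? v) R-closed (two-centres (minQ x₁)
                             (centre-without (~⇒≢ v~x₁ ∘ sym)) (centre-avoiding cd λ s → ¬vd (R-trans (near (inj₂ v~x₁)) s)) ¬vd)
          ... | i , j , Fi , Fj , le = go F-rest (centre-edge cd (cover-mono (λ r s → ¬vd (R-trans s (R-sym r))) ≤-refl F-rest))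
                (≤-trans (+-monoˡ-≤ j (F-edge Fi ((_ , ~⇒≢ v~x₁) , R-refl)
                  ((_ , ~⇒≢ x₁~y₁ ∘ sym) , near (inj₂ v~y₁)) v~y₁)) le)
            where
            F-rest : F (∁R v) j
            F-rest = cover-mono (λ ¬s → (_ , λ { refl → ¬s (near (inj₂ v~x₁)) }) , ¬s) ≤-refl Fj
            ¬F-rest : ∀ {j} → suc (suc j) ≤ k → ¬ F (∁R v) j
            ¬F-rest le p = ¬F (cover-mono id le (F-join (R? v) R-closed F-butterfly p (whole ∘ proj₂) proj₂))
            go : ∀ {j} → F (∁R v) j → 1 ≤ j → suc j ≤ k → ∃ λ k₂ → k ≡ suc (suc k₂) × F (∁R v) (suc k₂) × ¬ F (∁R v) k₂
            go {suc j} p (s≤s _) le with m≤n⇒∃[o]m+o≡n le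
            ... | o , eq = j + o , sym eq , cover-mono id (s≤s (m≤m+n j o)) p , ¬F-rest (≤-reflexive eq)

          winged-class : WingedSet (R v) 0
          winged-class = record
            { S? = R? v ; isClosed = R-closed ; hub∈S = R-refl ; wings = bf ; whole = whole
            ; matched = λ r ¬r → ⊥-elim (¬r r)
            ; size-rest = n≤0⇒n≡0 (cliques-empty (λ u → R? v u ×-dec ∁R? v u) λ (r , ¬r) → ¬r r) }

          decompose-wing : Decomposition
          decompose-wing with rest-bounds
          ... | k₂ , eq , p , ¬p with Fin.any? (λ w → ∁R? v w ×-dec ¬? (F? (-? (∁R? v) w) k₂))
          ... | no none = winged-critical winged-class (centre-outside cd ¬vd) record
                  { S? = ∁R? v ; isClosed = Closed-∁ R-closed ; notF = ¬p
                  ; remove = λ {w} s → decidable-stable (F? (-? (∁R? v) w) k₂) λ ¬f → none (w , s , ¬f) }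
                  p (elsewhere-unique ¬Fv bf cd ¬vd) eq
          -- Since the wings at `v` always cost two cliques, a deletion that fails in the rest also
          -- fails in `G`; hence `w` is a second hub.
          ... | yes (w , ¬vw , ¬f) = second (find-wing (Centre-⊆ _ centre-v) cd ¬vd ¬Fw)
            where
            centre-v : Centre (U - w) v
            centre-v = centre-without λ { refl → ¬vw R-refl }
            ¬Fw : ¬ F (U - w) k
            ¬Fw q with F-split (R? v) R-closed q
            ... | i , j , Fi , Fj , le = ¬f (cover-mono (λ (¬r , ne) → (_ , ne) , ¬r)
                  (≤-pred (≤-pred (≤-trans (+-monoˡ-≤ j (F-wings Fi λ (o , _) → (_ , λ { refl → ¬vw (On⇒R o) }) , On⇒R o))
                    (subst (i + j ≤_) eq le)))) Fj)
            second : IsWing w → Decomposition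
            second ((bf′ , whole′) , _) = winged-winged winged-class (record
                { S? = ∁R? v ; isClosed = Closed-∁ R-closed ; hub∈S = ¬vw ; wings = bf′ ; whole = whole′
                ; matched = matched ; size-rest = refl }) (trans eq (cong (λ n → suc (suc n)) (≤-antisym lower upper)))
              where
              open Butterfly bf′ using () renaming (x₁ to x′; x₂ to z′; v~x₁ to w~x′; v~x₂ to w~z′; x₁≁x₂ to x′≁z′)
              centre-w : Centre U w
              centre-w = x′ , z′ , _ , _ , _ , ~-sym w~x′ , w~z′ , x′≁z′
              matched : ∀ {u} → ¬ R v u → ¬ R w u → UniqueNbr u
              matched = elsewhere-unique ¬Fv bf centre-w ¬vw
              Rest? : Decidable (∁R v ∖ R w)
              Rest? u = ∁R? v u ×-dec ¬? (R? w u)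
              rest-Clu : Clu (∁R v ∖ R w)
              rest-Clu = UniqueNbr-Clu λ (a , b) → matched a b
              lower : k₂ ≤ suc (cliques Rest?)
              lower = ≤-pred (≰⇒> λ le → ¬p (cover-mono id le
                (F-join (R? w) R-closed (Butterfly.F-butterfly bf′) (F-clu Rest? rest-Clu ≤-refl id) (whole′ ∘ proj₂) id)))
              upper : suc (cliques Rest?) ≤ k₂
              upper with F-split (R? w) R-closed p
              ... | i , j , Fi , Fj , le = ≤-pred (≤-trans (+-mono-≤
                  (Butterfly.F-wings bf′ Fi λ (o , _) → (λ s → ¬vw (R-trans s (R-sym (Butterfly.On⇒R bf′ o)))) , Butterfly.On⇒R bf′ o)
                  (F-cliques Rest? rest-Clu (λ {u} (a , b) → let x , e = nbr u in
                      x , (Closed-∁ R-closed e a , Closed-∁ R-closed e b) , e) id Fj)) le)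

        -- The value f = i + 1 of the class of `y` fixes how k is divided. A deletion on one side
        -- cannot lower f on the other, so it must lower f on its own side.
        decompose-critical : ∀ {y y′} → Centre U y → Centre U y′ → ¬ R y y′ → (∀ w → F (U - w) k) → Decomposition
        decompose-critical {y} {y′} c@(x , z , _ , _ , _ , e , f , ne) c′ ¬r all
          -- Deleting a vertex of the opposite side leaves a side intact and shows that its f is
          -- finite.
          with F-split (R? y) R-closed (all y′) | F-split (R? y) R-closed (all y)
        ... | i₀ , j₀ , Fi₀ , _ , le₀ | _ , j₁ , _ , Fj₁ , _
          with least-F (R? y) (cover-mono (λ s → (_ , λ { refl → ¬r s }) , s) ≤-refl Fi₀)
                 (λ p → n≮n 0 (centre-edge c p))
        ... | i , lt , ¬Fi , Fi with m≤n⇒∃[o]m+o≡n (≤-trans lt (≤-trans (m≤m+n i₀ j₀) le₀))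
        ... | k₂ , eq = critical
              (x , z , near (inj₂ (~-sym e)) , R-refl , near (inj₂ f) , e , f , ne)
              (centre-outside c′ ¬r)
              (record { S? = R? y ; isClosed = R-closed ; notF = ¬Fi ; remove = remove₁ })
              (record { S? = ∁R? y ; isClosed = Closed-∁ R-closed ; notF = ¬F₂ ; remove = remove₂ })
              Fi (cover-mono (λ ¬s → (_ , λ { refl → ¬s R-refl }) , ¬s) ≤-refl Fj₁) (sym eq)
          where
          ¬F₂ : ¬ F (∁R y) k₂
          ¬F₂ p = ¬F (cover-mono id (≤-reflexive eq) (F-join (R? y) R-closed Fi p proj₂ proj₂))
          remove₁ : ∀ {w} → R y w → F (R y - w) i
          remove₁ {w} rw with F-split (R? y) R-closed (all w)
          ... | a , b , Fa , Fb , le with a ≤? i | b ≤? k₂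
          ... | yes p | _     = cover-mono (λ (s , n) → (_ , n) , s) p Fa
          ... | no _  | yes p = ⊥-elim (¬F₂ (cover-mono (λ ¬s → (_ , λ { refl → ¬s rw }) , ¬s) p Fb))
          ... | no p  | no p′ = ⊥-elim (n≮n k (≤-trans (s≤s (≤-reflexive (sym eq)))
                  (≤-trans (≤-reflexive (sym (+-suc (suc i) k₂))) (≤-trans (+-mono-≤ (≰⇒> p) (≰⇒> p′)) le))))
          remove₂ : ∀ {w} → ∁R y w → F (∁R y - w) k₂
          remove₂ {w} ¬rw with F-split (R? y) R-closed (all w)
          ... | a , b , Fa , Fb , le with a ≤? i | b ≤? k₂
          ... | _     | yes p = cover-mono (λ (s , n) → (_ , n) , s) p Fb
          ... | yes p | no _  = ⊥-elim (¬Fi (cover-mono (λ s → (_ , λ { refl → ¬rw s }) , s) p Fa))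
          ... | no p  | no p′ = ⊥-elim (n≮n k (≤-trans (s≤s (≤-reflexive (sym eq)))
                  (≤-trans (≤-reflexive (sym (+-suc (suc i) k₂))) (≤-trans (+-mono-≤ (≰⇒> p) (≰⇒> p′)) le))))

      decompose : ∀ {u v} → ¬ R u v → Decomposition
      decompose ¬uv with two-classes ¬uv
      ... | y , y′ , c , c′ , ¬r with Fin.any? (λ w → ¬? (F? (-? U? w) k))
      ... | no none = decompose-critical c c′ ¬r λ w → decidable-stable (F? (-? U? w) k) λ ¬f → none (w , ¬f)
      ... | yes (v , ¬Fv) with find-wing c c′ ¬r ¬Fv
      ...   | (bf , whole) , d , cd , ¬vd = decompose-wing ¬Fv bf whole cd ¬vd

false⇒¬true : ∀ {b : Bool} → b ≡ false → ¬ b ≡ true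
false⇒¬true refl ()


-- Induced copies and disjoint unions as vertex sets of one graph

cograph⇒P₄-free : ∀ G → IsCograph G → P₄-free G
cograph⇒P₄-free G cog {a} {b} {c} {d} ab bc cd a≁c b≁d = decidable-stable (a ~? d) λ a≁d → cog
    (record { emb = at ; inj = at-inj a≁d _ _ } , record
      { to = id ; from = id ; from-to = λ _ → refl ; to-from = λ _ → refl ; preserve = same a≁d })
  where
  open Basics G
  at : Fin 4 → V
  at 0F = a
  at 1F = b
  at 2F = c
  at 3F = d
  same : ¬ a ~ d → ∀ i j → adj P₄ i j ≡ adj G (at i) (at j)
  same n 0F 0F = sym (adj-irrefl G a)
  same n 0F 1F = sym ab
  same n 0F 2F = sym (¬-not a≁c)
  same n 0F 3F = sym (¬-not n)
  same n 1F 0F = sym (~-sym ab)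
  same n 1F 1F = sym (adj-irrefl G b)
  same n 1F 2F = sym bc
  same n 1F 3F = sym (¬-not b≁d)
  same n 2F 0F = sym (¬-not (a≁c ∘ ~-sym))
  same n 2F 1F = sym (~-sym bc)
  same n 2F 2F = sym (adj-irrefl G c)
  same n 2F 3F = sym cd
  same n 3F 0F = sym (¬-not (n ∘ ~-sym))
  same n 3F 1F = sym (¬-not (b≁d ∘ ~-sym))
  same n 3F 2F = sym (~-sym cd)
  same n 3F 3F = sym (adj-irrefl G d)
  -- The rows of the adjacency matrix of P₄ are pairwise different, so preservation of adjacency
  -- already implies injectivity.
  at-inj : ¬ a ~ d → ∀ i j → at i ≡ at j → i ≡ j
  at-inj n i j e = rows i j λ l → trans (same n i l) (trans (cong (λ v → adj G v (at l)) e) (sym (same n j l)))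
    where
    rows : ∀ i j → (∀ l → adj P₄ i l ≡ adj P₄ j l) → i ≡ j
    rows 0F 0F _ = refl
    rows 1F 1F _ = refl
    rows 2F 2F _ = refl
    rows 3F 3F _ = refl
    rows 0F 1F h with () ← h 0F
    rows 0F 2F h with () ← h 3F
    rows 0F 3F h with () ← h 1F
    rows 1F 0F h with () ← h 0F
    rows 1F 2F h with () ← h 0F
    rows 1F 3F h with () ← h 0F
    rows 2F 0F h with () ← h 3F
    rows 2F 1F h with () ← h 0F
    rows 2F 3F h with () ← h 1F
    rows 3F 0F h with () ← h 1F
    rows 3F 1F h with () ← h 0F
    rows 3F 2F h with () ← h 1F

P₄-free⇒cograph : ∀ G → P₄-free G → IsCograph G
P₄-free⇒cograph G p₄ (D , iso) = false⇒¬true (same 0F 3F)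
    (p₄ (same 0F 1F) (same 1F 2F) (same 2F 3F) (false⇒¬true (same 0F 2F)) (false⇒¬true (same 1F 3F)))
  where
  open _≅_ iso renaming (to to to′; from to from′)
  at : Fin 4 → Fin (size G)
  at i = emb D (from′ i)
  same : ∀ i j → adj G (at i) (at j) ≡ adj P₄ i j
  same i j = trans (sym (preserve (from′ i) (from′ j))) (cong₂ (adj P₄) (to-from i) (to-from j))

-- `H` is a copy of the subgraph that `S` induces in `G`. Statements about pieces become statements
-- about vertex sets of `G`, which avoids nested induced subgraphs.
record Image (H G : Graph) (S : Fin (size G) → Set) : Set where
  field
    em      : Fin (size H) → Fin (size G)
    em-inj  : ∀ {i j} → em i ≡ em j → i ≡ j
    em-adj  : ∀ i j → adj G (em i) (em j) ≡ adj H i j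
    em∈     : ∀ i → S (em i)
    pre     : ∀ {v} → S v → ∃ λ i → em i ≡ v

  em-~ : ∀ {i j} → Adj H i j → Adj G (em i) (em j)
  em-~ {i} {j} = trans (em-adj i j)

  ~-em : ∀ {i j} → Adj G (em i) (em j) → Adj H i j
  ~-em {i} {j} = trans (sym (em-adj i j))

Image-id : ∀ G → Image G G U
Image-id G = record { em = id ; em-inj = id ; em-adj = λ _ _ → refl ; em∈ = λ _ → _ ; pre = λ {v} _ → v , refl }

Image-≅ : ∀ {H X G S} → H ≅ X → Image H G S → Image X G S
Image-≅ {H} {X} iso I = record
  { em = em ∘ from′
  ; em-inj = λ {i} {j} e → trans (sym (to-from i)) (trans (cong to′ (em-inj e)) (to-from j))
  ; em-adj = λ i j → trans (em-adj _ _) (trans (sym (preserve _ _)) (cong₂ (adj X) (to-from i) (to-from j)))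
  ; em∈ = λ i → em∈ _
  ; pre = λ s → let i , e = pre s in to′ i , trans (cong em (from-to i)) e }
  where
  open _≅_ iso renaming (to to to′; from to from′)
  open Image I

Image⇒≅ : ∀ {H G} → Image H G U → G ≅ H
Image⇒≅ {H} {G} I = record
  { to = λ v → proj₁ (pre {v} _) ; from = em ; from-to = λ v → proj₂ (pre {v} _)
  ; to-from = λ i → em-inj (proj₂ (pre {em i} _))
  ; preserve = λ u v → trans (sym (em-adj _ _)) (cong₂ (adj G) (proj₂ (pre {u} _)) (proj₂ (pre {v} _))) }
  where open Image I

module _ (H₁ H₂ : Graph) where

  private
    n₁ = size H₁
    n₂ = size H₂

  ⊹-ll : ∀ i j → adj (H₁ ⊹ H₂) (i ↑ˡ n₂) (j ↑ˡ n₂) ≡ adj H₁ i j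
  ⊹-ll i j rewrite Fin.splitAt-↑ˡ n₁ i n₂ | Fin.splitAt-↑ˡ n₁ j n₂ = refl

  ⊹-rr : ∀ i j → adj (H₁ ⊹ H₂) (n₁ ↑ʳ i) (n₁ ↑ʳ j) ≡ adj H₂ i j
  ⊹-rr i j rewrite Fin.splitAt-↑ʳ n₁ n₂ i | Fin.splitAt-↑ʳ n₁ n₂ j = refl

  ⊹-lr : ∀ i j → adj (H₁ ⊹ H₂) (i ↑ˡ n₂) (n₁ ↑ʳ j) ≡ false
  ⊹-lr i j rewrite Fin.splitAt-↑ˡ n₁ i n₂ | Fin.splitAt-↑ʳ n₁ n₂ j = refl

  data View : Fin (n₁ + n₂) → Set where
    left  : ∀ i → View (i ↑ˡ n₂)
    right : ∀ j → View (n₁ ↑ʳ j)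

  view : ∀ x → View x
  view x with splitAt n₁ x in eq
  ... | inj₁ i = subst View (Fin.splitAt⁻¹-↑ˡ eq) (left i)
  ... | inj₂ j = subst View (Fin.splitAt⁻¹-↑ʳ eq) (right j)

  left≢right : ∀ {i j} → i ↑ˡ n₂ ≢ n₁ ↑ʳ j
  left≢right {i} {j} e with trans (sym (Fin.splitAt-↑ˡ n₁ i n₂)) (trans (cong (splitAt n₁) e) (Fin.splitAt-↑ʳ n₁ n₂ j))
  ... | ()

module _ {H₁ H₂ G : Graph} where

  open Basics G

  record Split (S : V → Set) : Set₁ where
    field
      {S₁ S₂}  : V → Set
      S₁?      : Decidable S₁
      S₂?      : Decidable S₂
      S₁⊆      : S₁ ⊆ S
      S₂⊆      : S₂ ⊆ S
      cover    : ∀ {v} → S v → S₁ v ⊎ S₂ v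
      disjoint : ∀ {v} → S₁ v → S₂ v → ⊥
      no-edge  : ∀ {u v} → S₁ u → S₂ v → ¬ u ~ v
      image₁   : Image H₁ G S₁
      image₂   : Image H₂ G S₂

    S₁-closed : Closed S → Closed S₁
    S₁-closed cl e s with cover (cl e (S₁⊆ s))
    ... | inj₁ t = t
    ... | inj₂ t = ⊥-elim (no-edge s t e)

    S₂-closed : Closed S → Closed S₂
    S₂-closed cl e s with cover (cl e (S₂⊆ s))
    ... | inj₁ t = ⊥-elim (no-edge t s (~-sym e))
    ... | inj₂ t = t

  Image-split : ∀ {S} → Image (H₁ ⊹ H₂) G S → Split S
  Image-split {S} I = record
    { S₁ = λ v → ∃ λ i → em (i ↑ˡ size H₂) ≡ v ; S₂ = λ v → ∃ λ j → em (size H₁ ↑ʳ j) ≡ v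
    ; S₁? = λ v → Fin.any? λ i → em (i ↑ˡ size H₂) ≟ v ; S₂? = λ v → Fin.any? λ j → em (size H₁ ↑ʳ j) ≟ v
    ; S₁⊆ = λ { (i , refl) → em∈ _ } ; S₂⊆ = λ { (i , refl) → em∈ _ }
    ; cover = λ s → cov (pre s)
    ; disjoint = λ { (i , refl) (j , e) → left≢right H₁ H₂ (em-inj (sym e)) }
    ; no-edge = λ { (i , refl) (j , refl) → false⇒¬true (trans (em-adj _ _) (⊹-lr H₁ H₂ i j)) }
    ; image₁ = record
      { em = λ i → em (i ↑ˡ size H₂) ; em-inj = Fin.↑ˡ-injective _ _ _ ∘ em-inj
      ; em-adj = λ i j → trans (em-adj _ _) (⊹-ll H₁ H₂ i j) ; em∈ = λ i → i , refl ; pre = id }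
    ; image₂ = record
      { em = λ i → em (size H₁ ↑ʳ i) ; em-inj = Fin.↑ʳ-injective _ _ _ ∘ em-inj
      ; em-adj = λ i j → trans (em-adj _ _) (⊹-rr H₁ H₂ i j) ; em∈ = λ i → i , refl ; pre = id } }
    where
    open Image I
    cov : ∀ {v} → (∃ λ x → em x ≡ v) → (∃ λ i → em (i ↑ˡ size H₂) ≡ v) ⊎ (∃ λ j → em (size H₁ ↑ʳ j) ≡ v)
    cov (x , e) with view H₁ H₂ x
    ... | left i  = inj₁ (i , e)
    ... | right j = inj₂ (j , e)

  Image-⊹ : ∀ {S S₁ S₂} → Image H₁ G S₁ → Image H₂ G S₂ → S₁ ⊆ S → S₂ ⊆ S →
    (∀ {v} → S v → S₁ v ⊎ S₂ v) → (∀ {v} → S₁ v → S₂ v → ⊥) →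
    (∀ {u v} → S₁ u → S₂ v → ¬ u ~ v) → Image (H₁ ⊹ H₂) G S
  Image-⊹ {S} {S₁} {S₂} I₁ I₂ S₁⊆ S₂⊆ cover disjoint no-edge = record
    { em = em ; em-inj = λ {x} {y} → em-inj (view H₁ H₂ x) (view H₁ H₂ y) ; em-adj = λ x y → em-adj (view H₁ H₂ x) (view H₁ H₂ y)
    ; em∈ = λ x → em∈ (view H₁ H₂ x) ; pre = λ s → pre (cover s) }
    where
    module I₁ = Image I₁
    module I₂ = Image I₂
    n₂ = size H₂
    em : Fin (size H₁ + n₂) → V
    em x = [ I₁.em , I₂.em ]′ (splitAt (size H₁) x)
    em-l : ∀ i → em (i ↑ˡ n₂) ≡ I₁.em i
    em-l i rewrite Fin.splitAt-↑ˡ (size H₁) i n₂ = refl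
    em-r : ∀ j → em (size H₁ ↑ʳ j) ≡ I₂.em j
    em-r j rewrite Fin.splitAt-↑ʳ (size H₁) n₂ j = refl
    em∈ : ∀ {x} → View H₁ H₂ x → S (em x)
    em∈ (left i)  = subst S (sym (em-l i)) (S₁⊆ (I₁.em∈ i))
    em∈ (right j) = subst S (sym (em-r j)) (S₂⊆ (I₂.em∈ j))
    em-inj : ∀ {x y} → View H₁ H₂ x → View H₁ H₂ y → em x ≡ em y → x ≡ y
    em-inj (left i) (left j) e = cong (_↑ˡ n₂) (I₁.em-inj (trans (sym (em-l i)) (trans e (em-l j))))
    em-inj (right i) (right j) e = cong (size H₁ ↑ʳ_) (I₂.em-inj (trans (sym (em-r i)) (trans e (em-r j))))
    em-inj (left i) (right j) e = ⊥-elim (disjoint (I₁.em∈ i)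
      (subst S₂ (sym (trans (sym (em-l i)) (trans e (em-r j)))) (I₂.em∈ j)))
    em-inj (right j) (left i) e = ⊥-elim (disjoint (I₁.em∈ i)
      (subst S₂ (trans (sym (em-r j)) (trans e (em-l i))) (I₂.em∈ j)))
    em-adj : ∀ {x y} → View H₁ H₂ x → View H₁ H₂ y → adj G (em x) (em y) ≡ adj (H₁ ⊹ H₂) x y
    em-adj (left i) (left j) = trans (cong₂ (adj G) (em-l i) (em-l j)) (trans (I₁.em-adj i j) (sym (⊹-ll H₁ H₂ i j)))
    em-adj (right i) (right j) = trans (cong₂ (adj G) (em-r i) (em-r j)) (trans (I₂.em-adj i j) (sym (⊹-rr H₁ H₂ i j)))
    em-adj (left i) (right j) = trans (cong₂ (adj G) (em-l i) (em-r j))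
      (trans (¬-not (no-edge (I₁.em∈ i) (I₂.em∈ j))) (sym (⊹-lr H₁ H₂ i j)))
    em-adj (right j) (left i) = trans (cong₂ (adj G) (em-r j) (em-l i))
      (trans (¬-not (no-edge (I₁.em∈ i) (I₂.em∈ j) ∘ ~-sym))
        (sym (trans (adj-sym (H₁ ⊹ H₂) (size H₁ ↑ʳ j) (i ↑ˡ n₂)) (⊹-lr H₁ H₂ i j))))
    pre : ∀ {v} → S₁ v ⊎ S₂ v → ∃ λ x → em x ≡ v
    pre (inj₁ s) = let i , e = I₁.pre s in i ↑ˡ n₂ , trans (em-l i) e
    pre (inj₂ s) = let j , e = I₂.pre s in size H₁ ↑ʳ j , trans (em-r j) e

-- Polar partitions and covers

module Polarity {H G : Graph} where

  open Basics G
  private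
    module H = Basics H

  module _ {S : V → Set} {em : Fin (size H) → V} (em-inj : ∀ {i j} → em i ≡ em j → i ≡ j)
           (em-adj : ∀ i j → adj G (em i) (em j) ≡ adj H i j) (em∈ : ∀ i → S (em i)) where

    private
      E⁻ : ∀ {i j} → i ≢ j → E (em i) (em j) → H._~_ i j
      E⁻ ne (inj₁ e) = ⊥-elim (ne (em-inj e))
      E⁻ {i} {j} ne (inj₂ e) = trans (sym (em-adj i j)) e

      E⁺ : ∀ {i j} → H._~_ i j → E (em i) (em j)
      E⁺ {i} {j} e = inj₂ (trans (em-adj i j) e)

    module _ {Good k} (p : Cover Good S k) where
      open Cover p

      private
        in-b : ∀ {i} → a (em i) ≡ false → em i ∈ b
        in-b {i} e = [ (λ (mem t) → ⊥-elim (false⇒¬true e t)) , id ]′ (cover (em∈ i))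

      -- Membership in `a` decides the side, so a vertex in both parts goes to the first. The
      -- injection `lab` serves bounded and unbounded numbers of cliques alike.
      polar-from : ∀ {s t} (part : ∀ i → a (em i) ≡ true → Lab s) (lab : Fin k → Lab t) →
        (∀ {i j} → lab i ≡ lab j → i ≡ j) →
        (∀ i j (pi : a (em i) ≡ true) (pj : a (em j) ≡ true) → i ≢ j → (Adj H i j ⇔ (part i pi ≢ part j pj))) →
        IsPolar s t H
      polar-from part lab lab-inj mult with cliques-labelling (_∈? b) clu bound
      ... | label , spec = record
        { inA = a ∘ em ; part = part ; clust = λ i e → lab (label (em i) (in-b e))
        ; multipartite = mult
        ; cluster = λ i j pi pj ne → mk⇔ (λ e → cong lab (proj₁ (spec (in-b pi) (in-b pj)) (E⁺ e)))
                                         (λ e → E⁻ ne (proj₂ (spec (in-b pi) (in-b pj)) (lab-inj e))) }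

    F⇒polar : ∀ {k} → F S k → IsPolar (fin 1) (fin k) H
    F⇒polar p = polar-from p {fin 1} {fin _} (λ _ _ → zero) id id λ i j pi pj ne →
      mk⇔ (λ e → ⊥-elim (Cover.good p (mem pi) (mem pj) (trans (em-adj i j) e))) (λ n → ⊥-elim (n refl))

    F⇒polar∞ : ∀ {k} → F S k → IsPolar (fin 1) ∞ H
    F⇒polar∞ p = polar-from p {fin 1} {∞} (λ _ _ → zero) toℕ Fin.toℕ-injective λ i j pi pj ne →
      mk⇔ (λ e → ⊥-elim (Cover.good p (mem pi) (mem pj) (trans (em-adj i j) e))) (λ n → ⊥-elim (n refl))

    -- A part consists of the non-neighbours within `a` of any of its vertices; its least vertex
    -- provides the label.
    Q⇒polar : ∀ {k} → Q S k → IsPolar ∞ (fin k) H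
    Q⇒polar p = polar-from p {∞} {fin _} (λ i _ → toℕ (least (em i))) id id λ i j pi pj ne →
        mk⇔ (λ e h → least-reflects (mem pi) (mem pj) (Fin.toℕ-injective h) (trans (em-adj i j) e))
            (λ h → decidable-stable (i H.~? j) λ ≁ → h (cong toℕ (least-cong (mem pi) (mem pj)
                     λ e → ≁ (trans (sym (em-adj i j)) e))))
      where
      open Cover p
      Part? : ∀ v → Decidable (λ u → u ∈ a × ¬ u ~ v)
      Part? v u = (u ∈? a) ×-dec ¬? (u ~? v)
      least : V → V
      least v = first (Part? v) v
      least-cong : ∀ {u v} → u ∈ a → v ∈ a → ¬ u ~ v → least u ≡ least v
      least-cong {u} {v} p q ≁ = first-cong (Part? u) (Part? v)
        (λ (r , n) → r , good r p q n ≁) (λ (r , n) → r , good r q p n (≁ ∘ ~-sym))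
        u v (p , ~-irrefl) (q , ~-irrefl)
      least-reflects : ∀ {u v} → u ∈ a → v ∈ a → least u ≡ least v → ¬ u ~ v
      least-reflects {u} {v} p q e with first-holds (Part? u) u (p , ~-irrefl) | first-holds (Part? v) v (q , ~-irrefl)
      ... | r , n | r′ , n′ = good p r q (n ∘ ~-sym) (subst (λ z → ¬ z ~ v) (sym e) n′)

  module _ {S : V → Set} (I : Image H G S) where

    open Image I

    module _ {s t} (P : PolarPartition s t H) where
      open PolarPartition P

      private
        A B : V → Set
        A v = ∃ λ i → em i ≡ v × inA i ≡ true
        B v = ∃ λ i → em i ≡ v × inA i ≡ false
        A? : Decidable A
        A? v = Fin.any? λ i → (em i ≟ v) ×-dec (inA i ≟ᵇ true)
        B? : Decidable B
        B? v = Fin.any? λ i → (em i ≟ v) ×-dec (inA i ≟ᵇ false)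

        label : ∀ v → B v → Lab t
        label v (i , _ , e) = clust i e

        clust-irr : ∀ {i} (p q : inA i ≡ false) → clust i p ≡ clust i q
        clust-irr p q = cong (clust _) (uip p q)

        E⇒label : ∀ {u v} (p : B u) (q : B v) → E u v → label u p ≡ label v q
        E⇒label (i , refl , p) (j , e , q) (inj₁ refl) with em-inj e
        ... | refl = clust-irr p q
        E⇒label (i , refl , p) (j , refl , q) (inj₂ e) =
          to (cluster i j p q λ { refl → ~-irrefl e }) (~-em e)

        label⇒E : ∀ {u v} (p : B u) (q : B v) → label u p ≡ label v q → E u v
        label⇒E (i , refl , p) (j , refl , q) e with i ≟ j
        ... | yes refl = inj₁ refl
        ... | no ne    = inj₂ (em-~ (from (cluster i j p q ne) e))

        B-Clu : Clu B
        B-Clu p q r e f = label⇒E p r (trans (E⇒label p q e) (E⇒label q r f))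

        cov : ∀ {v} → S v → A v ⊎ B v
        cov s with pre s
        ... | i , e with inA i ≟ᵇ true
        ...   | yes p = inj₁ (i , e , p)
        ...   | no ¬p = inj₂ (i , e , ¬-not ¬p)

      cover-polar : ∀ {Good} → (∀ {X Y} → Y ⊆ X → Good X → Good Y) → Good A →
                    Cover Good S (cliques B?)
      cover-polar hered good = cover-from hered A? B? good B-Clu ≤-refl cov

      cliques-polar : ∀ {k} → t ≡ fin k → cliques B? ≤ k
      cliques-polar {k} refl = subst (cliques B? ≤_) (count-U k)
        (cliques-count B? B-Clu (U? {A = Fin k}) label (λ _ _ → _) (λ u v p q e → label⇒E p q e))

      polar-Ind : s ≡ fin 1 → Ind A
      polar-Ind refl (i , refl , p) (j , refl , q) e = to (multipartite i j p q λ { refl → ~-irrefl e }) (~-em e) (only _ _)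
        where
        only : ∀ (x y : Fin 1) → x ≡ y
        only 0F 0F = refl

      polar-MP : s ≡ ∞ → MP A
      polar-MP refl {u} {v} {w} p q r u≁v v≁w u~w = differ p r u~w (trans (same p q u≁v) (same q r v≁w))
        where
        plab : ∀ {u} → A u → ℕ
        plab (i , _ , p) = part i p
        differ : ∀ {u v} (p : A u) (q : A v) → u ~ v → plab p ≢ plab q
        differ (i , refl , p) (j , refl , q) e = to (multipartite i j p q λ { refl → ~-irrefl e }) (~-em e)
        same : ∀ {u v} (p : A u) (q : A v) → ¬ u ~ v → plab p ≡ plab q
        same (i , refl , p) (j , refl , q) ≁ with i ≟ j
        ... | yes refl = cong (part i) (uip p q)
        ... | no ne = decidable-stable (part i p ≟ⁿ part j q) λ n → ≁ (em-~ (from (multipartite i j p q ne) n))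

    polar⇒F : ∀ {k} → IsPolar (fin 1) (fin k) H → F S k
    polar⇒F P = cover-mono id (cliques-polar P refl) (cover-polar P Ind-⊆ (polar-Ind P refl))

    polar∞⇒F : IsPolar (fin 1) ∞ H → ∃ λ k → F S k
    polar∞⇒F P = _ , cover-polar P Ind-⊆ (polar-Ind P refl)

    polar⇒Q : ∀ {k} → IsPolar ∞ (fin k) H → Q S k
    polar⇒Q P = cover-mono id (cliques-polar P refl) (cover-polar P MP-⊆ (polar-MP P refl))

deletion : ∀ {n} (i : Fin n) → ∃ λ m → m < n × Enumeration (λ j → U j × j ≢ i) m
deletion {n} i = _ , ≤-trans (count-remove (U? {A = Fin n}) i _) (≤-reflexive (count-U n)) ,
                 enumerate (λ j → U? j ×-dec ¬? (j ≟ i))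

-- Every proper induced subgraph omits some vertex, so minimality has to be checked for vertex
-- deletions only.
missed : ∀ {m n} (f : Fin m → Fin n) → m < n → ∃ λ i → ∀ j → f j ≢ i
missed f lt with Fin.any? (λ i → Fin.all? λ j → ¬? (f j ≟ i))
... | yes found = found
... | no none = ⊥-elim (<⇒≱ lt (Fin.injective⇒≤ {f = λ i → proj₁ (hit i)}
        λ {i} {j} e → trans (sym (proj₂ (hit i))) (trans (cong f e) (proj₂ (hit j)))))
  where
  hit : ∀ i → ∃ λ j → f j ≡ i
  hit i = decidable-stable (Fin.any? λ j → f j ≟ i) λ ¬h → none (i , λ j e → ¬h (j , e))

P₄-free-Image : ∀ {H G S} → Image H G S → P₄-free G → P₄-free H
P₄-free-Image I p₄ e f g ac bd = ~-em (p₄ (em-~ e) (em-~ f) (em-~ g) (ac ∘ ~-em) (bd ∘ ~-em))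
  where open Image I

polar-weaken : ∀ {k H} → IsPolar (fin 1) (fin k) H → IsPolar (fin 1) ∞ H
polar-weaken P = record
  { inA = inA ; part = part ; clust = λ v p → toℕ (clust v p) ; multipartite = multipartite
  ; cluster = λ u v p q ne → mk⇔ (cong toℕ ∘ to (cluster u v p q ne)) (from (cluster u v p q ne) ∘ Fin.toℕ-injective) }
  where open PolarPartition P

W : Graph
W = K₁ ⊕ copies 2 K₂


-- Minimal obstructions and critical sets

module Transfer (G : Graph) (p₄-free : P₄-free G) where

  open Basics G
  open Classes G p₄-free
  open Critical G p₄-free
  open Winged G p₄-free
  open Polarity

  module _ {H : Graph} {S : V → Set} (I : Image H G S) where

    open Image I

    Image-delete : ∀ {w} → S w → ∃ λ m → m < size H × Σ (InducedEmb H m) λ D → Image (sub H D) G (S - w)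
    Image-delete {w} sw with pre sw
    ... | i , refl with deletion i
    ... | m , lt , en = m , lt , record { emb = at ; inj = at-inj } , record
      { em = em ∘ at ; em-inj = at-inj ∘ em-inj ; em-adj = λ _ _ → em-adj _ _
      ; em∈ = λ j → em∈ _ , λ e → proj₂ (at-sound j) (em-inj e)
      ; pre = λ (s , ne) → let j , e = pre s ; j≢ = λ h → ne (trans (sym e) (cong em h)) in
               index j (_ , j≢) , trans (cong em (at-index j (_ , j≢))) e }
      where open Enumeration en

    obstruction⇒Crit : ∀ {k} → Decidable S → Closed S → CographMinObstruction (fin 1) (fin k) H → Crit S k
    obstruction⇒Crit S? cl O = record
      { S? = S? ; isClosed = cl ; notF = notPolar ∘ F⇒polar em-inj em-adj em∈
      ; remove = λ sw → let m , lt , D , J = Image-delete sw in polar⇒F J (minimal D lt) }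
      where open CographMinObstruction O

    Crit⇒obstruction : ∀ {k} → Crit S k → CographMinObstruction (fin 1) (fin k) H
    Crit⇒obstruction C = record
      { cograph = P₄-free⇒cograph H (P₄-free-Image I p₄-free)
      ; notPolar = Crit.notF C ∘ polar⇒F I
      ; minimal = λ D lt → let i , miss = missed (emb D) lt in
          F⇒polar (inj D ∘ em-inj) (λ _ _ → em-adj _ _) (λ j → em∈ _ , λ e → miss j (em-inj e))
            (Crit.remove C (em∈ i)) }

    F⇒¬obstruction∞ : ∀ {j} → F S j → ¬ CographMinObstruction (fin 1) ∞ H
    F⇒¬obstruction∞ p O = CographMinObstruction.notPolar O (F⇒polar∞ em-inj em-adj em∈ p)

    -- All proper induced subgraphs are (1,∞)-polar, so the only way not to be a (1,∞)-obstruction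
    -- is to be (1,∞)-polar, which means finite f. This is read off from a refutation, hence the
    -- double negation.
    obstruction-finite : ∀ {k} → CographMinObstruction (fin 1) (fin k) H →
      ¬ CographMinObstruction (fin 1) ∞ H → ¬ ¬ (∃ λ j → F S j)
    obstruction-finite O ¬O∞ none = ¬O∞ record
      { cograph = cograph ; notPolar = none ∘ polar∞⇒F I ; minimal = λ D lt → polar-weaken (minimal D lt) }
      where open CographMinObstruction O

  obstruction⇒Q : ∀ {k} → CographMinObstruction ∞ (fin k) G → ¬ Q U k × (∀ w → Q (U - w) k)
  obstruction⇒Q O = notPolar ∘ Q⇒polar {S = U} {em = id} id (λ _ _ → refl) (λ _ → _) ,
      λ w → let m , lt , D , J = Image-delete (Image-id G) {w} _ in polar⇒Q J (minimal D lt)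
    where open CographMinObstruction O

  Q⇒obstruction : ∀ {k} → ¬ Q U k → (∀ w → Q (U - w) k) → CographMinObstruction ∞ (fin k) G
  Q⇒obstruction ¬q rem = record
    { cograph = P₄-free⇒cograph G p₄-free
    ; notPolar = ¬q ∘ polar⇒Q (Image-id G)
    ; minimal = λ D lt → let i , miss = missed (emb D) lt in
        Q⇒polar (inj D) (λ _ _ → refl) (λ j → _ , miss j) (rem i) }

  Image-K₂ : ∀ {S u v} → u ~ v → S u → S v → (∀ {w} → S w → w ≡ u ⊎ w ≡ v) → Image K₂ G S
  Image-K₂ {S} {u} {v} e su sv only = record
    { em = at ; em-inj = at-inj _ _ ; em-adj = same ; em∈ = at∈ ; pre = pre ∘ only }
    where
    at : Fin 2 → V
    at 0F = u
    at 1F = v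
    at-inj : ∀ i j → at i ≡ at j → i ≡ j
    at-inj 0F 0F _ = refl
    at-inj 0F 1F h = ⊥-elim (~⇒≢ e h)
    at-inj 1F 0F h = ⊥-elim (~⇒≢ e (sym h))
    at-inj 1F 1F _ = refl
    same : ∀ i j → adj G (at i) (at j) ≡ adj K₂ i j
    same 0F 0F = adj-irrefl G u
    same 0F 1F = e
    same 1F 0F = ~-sym e
    same 1F 1F = adj-irrefl G v
    at∈ : ∀ i → S (at i)
    at∈ 0F = su
    at∈ 1F = sv
    pre : ∀ {w} → w ≡ u ⊎ w ≡ v → ∃ λ i → at i ≡ w
    pre (inj₁ refl) = 0F , refl
    pre (inj₂ refl) = 1F , refl

  Image-K₂-cases : ∀ {S} (I : Image K₂ G S) → let open Image I in ∀ {w} → S w → w ≡ em 0F ⊎ w ≡ em 1F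
  Image-K₂-cases I s with Image.pre I s
  ... | 0F , e = inj₁ (sym e)
  ... | 1F , e = inj₂ (sym e)

  matching⇒Image : ∀ m {K} (K? : Decidable K) → Closed K → (∀ {u} → K u → UniqueNbr u) →
                   cliques K? ≡ m → Image (copies m K₂) G K
  matching⇒Image zero K? cl un eq = record
    { em = λ () ; em-inj = λ {} ; em-adj = λ () ; em∈ = λ () ; pre = λ k → ⊥-elim (n≮n 0
        (≤-trans (cliques-nonempty K? (UniqueNbr-Clu un) k) (≤-reflexive eq))) }
  matching⇒Image (suc m) {K} K? cl un eq with Fin.any? K?
  ... | no none = ⊥-elim (n≮n 0 (≤-trans (s≤s z≤n) (≤-trans (≤-reflexive (sym eq)) (cliques-empty K? λ k → none (_ , k)))))
  ... | yes (u , ku) = Image-⊹ (Image-K₂ (proj₁ (proj₂ (un ku))) (ku , inj₁ refl) (cl (proj₁ (proj₂ (un ku))) ku , inj₂ (proj₁ (proj₂ (un ku)))) only)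
          (matching⇒Image m Rest? rest-closed (un ∘ proj₁) size-eq) proj₁ proj₁ cov
          (λ (_ , e) (_ , ¬e) → ¬e e) (λ (p , e) (q , ¬e) f → ¬e (E-trans ku p q e (inj₂ f)))
    where
    E-trans : Clu K
    E-trans = UniqueNbr-Clu un
    Rest? : Decidable (K ∖ E u)
    Rest? w = K? w ×-dec ¬? (E? u w)
    rest-closed : Closed (K ∖ E u)
    rest-closed e (k , ¬e) = cl e k , λ f → ¬e (E-trans ku (cl e k) k f (inj₂ (~-sym e)))
    only : ∀ {w} → K w × E u w → w ≡ u ⊎ w ≡ proj₁ (un ku)
    only (_ , inj₁ e) = inj₁ (sym e)
    only (_ , inj₂ e) = inj₂ (proj₂ (proj₂ (un ku)) _ e)
    cov : ∀ {w} → K w → (K w × E u w) ⊎ (K ∖ E u) w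
    cov {w} k with E? u w
    ... | yes e = inj₁ (k , e)
    ... | no ¬e = inj₂ (k , ¬e)
    Near? : Decidable (λ w → K w × E u w)
    Near? w = K? w ×-dec E? u w
    one : cliques Near? ≡ 1
    one = ≤-antisym (cliques-clique Near? λ (p , e) (q , f) → E-trans p ku q (E-sym e) f)
                    (cliques-nonempty Near? (Clu-⊆ proj₁ E-trans) (ku , inj₁ refl))
    size-eq : cliques Rest? ≡ m
    size-eq = suc-injective (trans (cong (_+ cliques Rest?) (sym one))
      (trans (sym (cliques-split K? (E? u) (λ p q e f → E-trans ku p q f (inj₂ e)))) eq))

  Image⇒matching : ∀ m {K} (K? : Decidable K) → Closed K → Image (copies m K₂) G K →
                   (∀ {u} → K u → UniqueNbr u) × cliques K? ≡ m
  Image⇒matching zero K? cl I = (λ k → ⊥-elim (Fin.¬Fin0 (proj₁ (Image.pre I k)))) ,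
    n≤0⇒n≡0 (cliques-empty K? λ k → Fin.¬Fin0 (proj₁ (Image.pre I k)))
  Image⇒matching (suc m) {K} K? cl I = un , (trans (cliques-split K? S₁? λ _ _ → cl₁)
      (cong₂ _+_ (≤-antisym (cliques-clique In? (λ (_ , p) (_ , q) → pair p q))
                            (cliques-nonempty In? (Clu-⊆ proj₁ K-Clu) (S₁⊆ (em∈ 0F) , em∈ 0F)))
                 (trans (≤-antisym (cliques-mono Out? S₂? (UniqueNbr-Clu un₂) λ (k , ¬s) → [ ⊥-elim ∘ ¬s , id ]′ (cover k))
                                   (cliques-mono S₂? Out? (Clu-⊆ proj₁ K-Clu) λ s → S₂⊆ s , λ t → disjoint t s))
                        (proj₂ rec))))
    where
    sp = Image-split {K₂} {copies m K₂} I
    open Split sp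
    open Image image₁
    cl₁ : Closed S₁
    cl₁ = S₁-closed cl
    rec = Image⇒matching m S₂? (S₂-closed cl) image₂
    un₂ = proj₁ rec
    In? = λ v → K? v ×-dec S₁? v
    Out? = λ v → K? v ×-dec ¬? (S₁? v)
    01~ : em 0F ~ em 1F
    01~ = em-adj 0F 1F
    pair : ∀ {u v} → S₁ u → S₁ v → E u v
    pair p q with Image-K₂-cases image₁ p | Image-K₂-cases image₁ q
    ... | inj₁ refl | inj₁ refl = inj₁ refl
    ... | inj₁ refl | inj₂ refl = inj₂ 01~
    ... | inj₂ refl | inj₁ refl = inj₂ (~-sym 01~)
    ... | inj₂ refl | inj₂ refl = inj₁ refl
    un₁ : ∀ {u} → S₁ u → UniqueNbr u
    un₁ s with Image-K₂-cases image₁ s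
    ... | inj₁ refl = em 1F , 01~ , λ w e → [ (λ { refl → ⊥-elim (~-irrefl e) }) , id ]′ (Image-K₂-cases image₁ (cl₁ e s))
    ... | inj₂ refl = em 0F , ~-sym 01~ , λ w e → [ id , (λ { refl → ⊥-elim (~-irrefl e) }) ]′ (Image-K₂-cases image₁ (cl₁ e s))
    un : ∀ {u} → K u → UniqueNbr u
    un k = [ un₁ , un₂ ]′ (cover k)
    K-Clu : Clu K
    K-Clu = UniqueNbr-Clu un

  Butterfly⇒Image : ∀ {v} (bf : Butterfly v) → Image W G (Butterfly.On bf)
  Butterfly⇒Image {v} bf = record
    { em = at ; em-inj = λ {i} {j} → at-inj i j ; em-adj = same ; em∈ = λ i → i , refl ; pre = id }
    where
    open Butterfly bf
    no~ : ∀ {u w} → ¬ E u w → adj G u w ≡ false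
    no~ ne = ¬-not (ne ∘ inj₂)
    ~no : ∀ {u w} → ¬ E u w → adj G w u ≡ false
    ~no ne = ¬-not (ne ∘ inj₂ ∘ ~-sym)
    same : ∀ i j → adj G (at i) (at j) ≡ adj W i j
    same 0F 0F = adj-irrefl G v
    same 0F 1F = v~x₁
    same 0F 2F = v~y₁
    same 0F 3F = v~x₂
    same 0F 4F = v~y₂
    same 1F 0F = ~-sym v~x₁
    same 1F 1F = adj-irrefl G x₁
    same 1F 2F = x₁~y₁
    same 1F 3F = no~ x₁≁x₂
    same 1F 4F = no~ x₁≁y₂
    same 2F 0F = ~-sym v~y₁
    same 2F 1F = ~-sym x₁~y₁
    same 2F 2F = adj-irrefl G y₁
    same 2F 3F = no~ y₁≁x₂
    same 2F 4F = no~ y₁≁y₂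
    same 3F 0F = ~-sym v~x₂
    same 3F 1F = ~no x₁≁x₂
    same 3F 2F = ~no y₁≁x₂
    same 3F 3F = adj-irrefl G x₂
    same 3F 4F = x₂~y₂
    same 4F 0F = ~-sym v~y₂
    same 4F 1F = ~no x₁≁y₂
    same 4F 2F = ~no y₁≁y₂
    same 4F 3F = ~-sym x₂~y₂
    same 4F 4F = adj-irrefl G y₂
    at-inj : ∀ i j → at i ≡ at j → i ≡ j
    at-inj 0F 0F e = refl
    at-inj 1F 1F e = refl
    at-inj 2F 2F e = refl
    at-inj 3F 3F e = refl
    at-inj 4F 4F e = refl
    at-inj 0F 1F e = ⊥-elim (~⇒≢ v~x₁ e)
    at-inj 0F 2F e = ⊥-elim (~⇒≢ v~y₁ e)
    at-inj 0F 3F e = ⊥-elim (~⇒≢ v~x₂ e)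
    at-inj 0F 4F e = ⊥-elim (~⇒≢ v~y₂ e)
    at-inj 1F 0F e = ⊥-elim (~⇒≢ v~x₁ (sym e))
    at-inj 2F 0F e = ⊥-elim (~⇒≢ v~y₁ (sym e))
    at-inj 3F 0F e = ⊥-elim (~⇒≢ v~x₂ (sym e))
    at-inj 4F 0F e = ⊥-elim (~⇒≢ v~y₂ (sym e))
    at-inj 1F 2F e = ⊥-elim (~⇒≢ x₁~y₁ e)
    at-inj 2F 1F e = ⊥-elim (~⇒≢ x₁~y₁ (sym e))
    at-inj 3F 4F e = ⊥-elim (~⇒≢ x₂~y₂ e)
    at-inj 4F 3F e = ⊥-elim (~⇒≢ x₂~y₂ (sym e))
    at-inj 1F 3F e = ⊥-elim (x₁≁x₂ (inj₁ e))
    at-inj 1F 4F e = ⊥-elim (x₁≁y₂ (inj₁ e))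
    at-inj 2F 3F e = ⊥-elim (y₁≁x₂ (inj₁ e))
    at-inj 2F 4F e = ⊥-elim (y₁≁y₂ (inj₁ e))
    at-inj 3F 1F e = ⊥-elim (x₁≁x₂ (inj₁ (sym e)))
    at-inj 4F 1F e = ⊥-elim (x₁≁y₂ (inj₁ (sym e)))
    at-inj 3F 2F e = ⊥-elim (y₁≁x₂ (inj₁ (sym e)))
    at-inj 4F 2F e = ⊥-elim (y₁≁y₂ (inj₁ (sym e)))

  Image⇒Butterfly : ∀ {S} (I : Image W G S) → Σ (Butterfly (Image.em I 0F)) λ bf → S ⊆ Butterfly.On bf
  Image⇒Butterfly {S} I = bf , on
    where
    open Image I
    ne : ∀ i j → i ≢ j → adj W i j ≡ false → ¬ E (em i) (em j)
    ne i j i≢j f (inj₁ e) = i≢j (em-inj e)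
    ne i j i≢j f (inj₂ e) = false⇒¬true (trans (em-adj i j) f) e
    bf : Butterfly (em 0F)
    bf = record
      { x₁ = em 1F ; y₁ = em 2F ; x₂ = em 3F ; y₂ = em 4F
      ; v~x₁ = em-adj 0F 1F ; v~y₁ = em-adj 0F 2F ; v~x₂ = em-adj 0F 3F ; v~y₂ = em-adj 0F 4F
      ; x₁~y₁ = em-adj 1F 2F ; x₂~y₂ = em-adj 3F 4F
      ; x₁≁x₂ = ne 1F 3F (λ ()) refl ; x₁≁y₂ = ne 1F 4F (λ ()) refl
      ; y₁≁x₂ = ne 2F 3F (λ ()) refl ; y₁≁y₂ = ne 2F 4F (λ ()) refl }
    on : S ⊆ Butterfly.On bf
    on s with pre s
    ... | 0F , e = 0F , e
    ... | 1F , e = 1F , e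
    ... | 2F , e = 2F , e
    ... | 3F , e = 3F , e
    ... | 4F , e = 4F , e

  winged⇒Image : ∀ {S m} → WingedSet S m → Image (copies m K₂ ⊹ W) G S
  winged⇒Image {S} {m} w = Image-⊹
      (matching⇒Image m Rest? (λ e (s , ¬r) → isClosed e s , Closed-∁ R-closed e ¬r) (λ (s , ¬r) → matched s ¬r) size-rest)
      (Butterfly⇒Image wings) proj₁ On⊆S cov (λ (_ , ¬r) o → ¬r (Butterfly.On⇒R wings o))
      (λ (_ , ¬r) o e → ¬r (R-closed (~-sym e) (Butterfly.On⇒R wings o)))
    where
    open WingedSet w
    cov : ∀ {v} → S v → (S ∖ R hub) v ⊎ Butterfly.On wings v
    cov {v} s with R? hub v
    ... | yes r = inj₂ (whole r)
    ... | no ¬r = inj₁ (s , ¬r)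

  Image⇒winged : ∀ {S m} → Decidable S → Closed S → Image (copies m K₂ ⊹ W) G S → WingedSet S m
  Image⇒winged {S} {m} S? cl I = record
      { S? = S? ; isClosed = cl ; hub∈S = S₂⊆ (em∈ 0F) ; wings = proj₁ bf ; whole = proj₂ bf ∘ r⇒S₂
      ; matched = λ s ¬r → proj₁ match (out s ¬r)
      ; size-rest = trans (≤-antisym
          (cliques-mono Rest? S₁? (UniqueNbr-Clu (proj₁ match)) λ (s , ¬r) → out s ¬r)
          (cliques-mono S₁? Rest? (UniqueNbr-Clu λ (s , ¬r) → proj₁ match (out s ¬r))
            λ s → S₁⊆ s , λ r → disjoint s (r⇒S₂ r))) (proj₂ match) }
    where
    sp = Image-split {copies m K₂} {W} I
    open Split sp
    open Image image₂
    bf = Image⇒Butterfly image₂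
    match = Image⇒matching m S₁? (S₁-closed cl) image₁
    r⇒S₂ : ∀ {u} → R (em 0F) u → S₂ u
    r⇒S₂ r = Closed-R (S₂-closed cl) r (em∈ 0F)
    out : ∀ {u} → S u → ¬ R (em 0F) u → S₁ u
    out s ¬r = [ id , (λ t → ⊥-elim (¬r (Butterfly.On⇒R (proj₁ bf) (proj₂ bf t)))) ]′ (cover s)
    Rest? : Decidable (S ∖ R (em 0F))
    Rest? u = S? u ×-dec ¬? (R? (em 0F) u)

-- After deletion of its hub such a graph still needs k cliques.
winged-not-critical : ∀ k H → H ≅ copies (k ∸ 2) K₂ ⊹ (K₁ ⊕ copies 2 K₂) →
                      ¬ CographMinObstruction (fin 1) (fin (k ∸ 1)) H
winged-not-critical k H iso O = arith k (F-hubless (Crit.remove C hub∈S))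
  where
  p₄ = cograph⇒P₄-free H (CographMinObstruction.cograph O)
  open Classes H p₄
  open Critical H p₄
  open Winged H p₄
  open Transfer H p₄
  open WingedSet (Image⇒winged {m = k ∸ 2} U? (λ _ _ → _) (Image-≅ iso (Image-id H)))
  C = obstruction⇒Crit (Image-id H) U? (λ _ _ → _) O
  -- For k below 2 truncated subtraction leaves the butterfly alone and the bound 0, which two
  -- cliques still exceed.
  arith : ∀ k → ¬ 2 + (k ∸ 2) ≤ k ∸ 1
  arith zero ()
  arith (suc zero) ()
  arith (suc (suc k)) le = n≮n _ le

Image-iso : ∀ {A B G S} → Image A G S → Image B G S → A ≅ B
Image-iso {A} {B} {G} I J = record
  { to = λ i → proj₁ (J.pre (I.em∈ i)) ; from = λ j → proj₁ (I.pre (J.em∈ j))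
  ; from-to = λ i → I.em-inj (trans (proj₂ (I.pre _)) (proj₂ (J.pre _)))
  ; to-from = λ j → J.em-inj (trans (proj₂ (J.pre _)) (proj₂ (I.pre _)))
  ; preserve = λ i j → trans (sym (J.em-adj _ _))
      (trans (cong₂ (adj G) (proj₂ (J.pre (I.em∈ i))) (proj₂ (J.pre (I.em∈ j)))) (I.em-adj i j)) }
  where
  module I = Image I
  module J = Image J

≅-refl : ∀ {G} → G ≅ G
≅-refl = record { to = id ; from = id ; from-to = λ _ → refl ; to-from = λ _ → refl ; preserve = λ _ _ → refl }

induced : ∀ G {S : Fin (size G) → Set} → Decidable S → ∃ λ H → Image H G S
induced G S? = sub G D , record
  { em = at ; em-inj = at-inj ; em-adj = λ _ _ → refl ; em∈ = at-sound ; pre = λ s → index _ s , at-index _ s }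
  where
  open Enumeration (enumerate S?)
  D : InducedEmb G _
  D = record { emb = at ; inj = at-inj }

-- Component records and classes

module Components (G : Graph) (p₄-free : P₄-free G) where

  open Basics G
  open Classes G p₄-free
  open Critical G p₄-free
  open Transfer G p₄-free

  class-component : ∀ {m} u (e : Fin m → V) → (∀ {i j} → e i ≡ e j → i ≡ j) →
    (∀ i → R u (e i)) → (∀ {v} → R u v → ∃ λ i → e i ≡ v) → Component G
  class-component {m} u e e-inj sound onto = record
    { csize = m ; nonempty = positive (proj₁ (onto R-refl)) ; cemb = D
    ; connected = λ i j → path i j (R-trans (R-sym (sound i)) (sound j))
    ; closed = λ i v f → onto (R-closed f (sound i)) }
    where
    D : InducedEmb G m
    D = record { emb = e ; inj = e-inj }
    positive : ∀ {n} → Fin n → 0 < n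
    positive {suc _} _ = s≤s z≤n
    path : ∀ i j → R (e i) (e j) → Reach (sub G D) i j
    path i j (near (inj₁ f)) with e-inj f
    ... | refl = ε
    path i j (near (inj₂ f)) = f ◅ ε
    path i j (via c f g) with onto (R-closed f (sound i))
    ... | l , refl = f ◅ g ◅ ε

  class-of : V → Component G
  class-of u = class-component u at at-inj at-sound (λ r → index _ r , at-index _ r)
    where open Enumeration (enumerate (R? u))

  module _ (C : Component G) where

    private
      c : Fin (csize C) → V
      c = emb (cemb C)

    start : Fin (csize C)
    start with csize C | nonempty C
    ... | suc _ | _ = zero

    component-absorbs : ∀ i {v} → R (c i) v → ∃ λ j → c j ≡ v
    component-absorbs i r = Closed-R {K = λ v → ∃ λ j → c j ≡ v}
      (λ { e (j , refl) → closed C j _ e }) r (i , refl)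

    component-R : ∀ i j → R (c i) (c j)
    component-R i j = walk R-refl (connected C i j)
      where
      walk : ∀ {x i j} → R x (c i) → Reach (sub G (cemb C)) i j → R x (c j)
      walk r ε       = r
      walk r (e ◅ p) = walk (R-closed e r) p

    component-Image : Image (sub G (cemb C)) G (λ v → ∃ λ j → c j ≡ v)
    component-Image = record
      { em = c ; em-inj = inj (cemb C) ; em-adj = λ _ _ → refl ; em∈ = λ i → i , refl ; pre = id }

    K₂⇒unique : sub G (cemb C) ≅ K₂ → ∀ i → UniqueNbr (c i)
    K₂⇒unique iso i = proj₁ (Image⇒matching 1 (λ v → Fin.any? λ j → c j ≟ v)
      (λ { e (j , refl) → closed C j _ e })
      -- `copies 1 K₂` is K₂ plus the empty graph, so an empty summand has to be supplied.
      (Image-⊹ (Image-≅ iso component-Image) (matching⇒Image 0 {λ _ → ⊥} (λ _ → no id) (λ _ ()) (λ ()) (n≤0⇒n≡0 (cliques-empty (λ _ → no id) id)))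
        id (λ ()) inj₁ (λ _ ()) (λ _ ()))) (i , refl)

    unique⇒K₂ : (∀ i → UniqueNbr (c i)) → sub G (cemb C) ≅ K₂
    unique⇒K₂ un with un start
    ... | v , e , only = Image-iso component-Image (Image-K₂ e (start , refl) (closed C start v e)
            λ { (j , refl) → place (component-R start j) })
      where
      back : ∀ {w} → v ~ w → w ≡ c start
      back f with closed C start v e
      ... | j , refl with un j
      ...   | x , _ , only′ = trans (only′ _ f) (sym (only′ _ (~-sym e)))
      place : ∀ {w} → R (c start) w → w ≡ c start ⊎ w ≡ v
      place (near (inj₁ f)) = inj₁ (sym f)
      place (near (inj₂ f)) = inj₂ (only _ f)
      place (via x f g) with only x f
      ... | refl = inj₁ (back g)

  centre-not-unique : ∀ {S y} → Centre S y → ¬ UniqueNbr y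
  centre-not-unique (x , z , _ , _ , _ , e , f , ne) (_ , _ , only) =
    ne (inj₁ (trans (only x (~-sym e)) (sym (only z f))))

  OnlyNonK₂ : Component G → Set
  OnlyNonK₂ C = ¬ (sub G (cemb C) ≅ K₂) × (∀ D → ¬ (sub G (cemb D) ≅ K₂) → SameComponent C D)

  unique⇒component : ∀ {y} → Centre U y → (∀ {u} → ¬ R y u → UniqueNbr u) → Σ (Component G) OnlyNonK₂
  unique⇒component {y} cy un = C , not-K₂ , same
    where
    C = class-of y
    open Enumeration (enumerate (R? y))
    not-K₂ : ¬ (sub G (cemb C) ≅ K₂)
    not-K₂ iso = centre-not-unique cy
      (subst UniqueNbr (at-index y R-refl) (K₂⇒unique C iso (index y R-refl)))
    same : ∀ D → ¬ (sub G (cemb D) ≅ K₂) → SameComponent C D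
    same D ¬K₂ with R? y (emb (cemb D) (start D))
    ... | no ¬r = ⊥-elim (¬K₂ (unique⇒K₂ D λ i → un λ r → ¬r (R-trans r (component-R D i (start D)))))
    ... | yes r = (λ i → let j , e = component-absorbs D (start D) (R-trans (R-sym r) (at-sound i)) in j , sym e) ,
                  (λ j → let r′ = R-trans r (component-R D (start D) j) in index _ r′ , sym (at-index _ r′))

  -- The class of a vertex that is not of degree one is no K₂, so it is the exceptional component.
  component⇒unique : Σ (Component G) OnlyNonK₂ → ∃ λ d → ∀ {u} → ¬ R d u → UniqueNbr u
  component⇒unique (C , _ , same) = emb (cemb C) (start C) , λ {u} ¬r →
    decidable-stable (UniqueNbr? u) λ ¬un → ¬r (meet u (same (class-of u) λ iso → ¬un (unique u iso)))
    where
    unique : ∀ u → sub G (cemb (class-of u)) ≅ K₂ → UniqueNbr u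
    unique u iso = subst UniqueNbr (at-index u R-refl) (K₂⇒unique (class-of u) iso (index u R-refl))
      where open Enumeration (enumerate (R? u))
    meet : ∀ u → SameComponent C (class-of u) → R (emb (cemb C) (start C)) u
    meet u (s , _) with s (start C)
    ... | j , e = R-sym (subst (R u) (sym e) (Enumeration.at-sound (enumerate (R? u)) j))

  disconnected⇒apart : Disconnected G → ∃₂ λ u v → ¬ R u v
  disconnected⇒apart disc = decidable-stable (Fin.any? λ u → Fin.any? λ v → ¬? (R? u v)) λ none →
      disc λ u v → path (decidable-stable (R? u v) λ ¬r → none (u , v , ¬r))
    where
    path : ∀ {u v} → R u v → Reach G u v
    path (near (inj₁ refl)) = ε
    path (near (inj₂ e))    = e ◅ ε
    path (via c e f)        = e ◅ f ◅ ε

  -- Otherwise `x`, `y`, `z` make up a whole class, which is a component P₃.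
  another-vertex : ¬ HasComponentIso G P₃ → ∀ {x y z} → x ~ y → y ~ z → ¬ E x z →
                   ∃ λ w → R y w × w ≢ x × w ≢ y × w ≢ z
  another-vertex ¬P₃ {x} {y} {z} e f ne = decidable-stable
      (Fin.any? λ w → R? y w ×-dec ¬? (w ≟ x) ×-dec ¬? (w ≟ y) ×-dec ¬? (w ≟ z)) λ none →
      ¬P₃ (class-component y at (at-inj _ _) sound (onto none) , record
        { to = id ; from = id ; from-to = λ _ → refl ; to-from = λ _ → refl ; preserve = same })
    where
    at : Fin 3 → V
    at 0F = x
    at 1F = y
    at 2F = z
    at-inj : ∀ i j → at i ≡ at j → i ≡ j
    at-inj 0F 0F _ = refl
    at-inj 1F 1F _ = refl
    at-inj 2F 2F _ = refl
    at-inj 0F 1F h = ⊥-elim (~⇒≢ e h)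
    at-inj 1F 0F h = ⊥-elim (~⇒≢ e (sym h))
    at-inj 1F 2F h = ⊥-elim (~⇒≢ f h)
    at-inj 2F 1F h = ⊥-elim (~⇒≢ f (sym h))
    at-inj 0F 2F h = ⊥-elim (ne (inj₁ h))
    at-inj 2F 0F h = ⊥-elim (ne (inj₁ (sym h)))
    sound : ∀ i → R y (at i)
    sound 0F = near (inj₂ (~-sym e))
    sound 1F = R-refl
    sound 2F = near (inj₂ f)
    onto : ¬ (∃ λ w → R y w × w ≢ x × w ≢ y × w ≢ z) → ∀ {v} → R y v → ∃ λ i → at i ≡ v
    onto none {v} r with v ≟ x | v ≟ y | v ≟ z
    ... | yes h | _ | _ = 0F , sym h
    ... | _ | yes h | _ = 1F , sym h
    ... | _ | _ | yes h = 2F , sym h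
    ... | no a | no b | no c = ⊥-elim (none (v , r , a , b , c))
    same : ∀ i j → adj P₃ i j ≡ adj G (at i) (at j)
    same 0F 0F = sym (adj-irrefl G x)
    same 0F 1F = sym e
    same 0F 2F = sym (¬-not (ne ∘ inj₂))
    same 1F 0F = sym (~-sym e)
    same 1F 1F = sym (adj-irrefl G y)
    same 1F 2F = sym f
    same 2F 0F = sym (¬-not (ne ∘ inj₂ ∘ ~-sym))
    same 2F 1F = sym (~-sym f)
    same 2F 2F = sym (adj-irrefl G z)

-- Classes, degrees and P₃'s of a piece compared with those of the ambient graph

module Restrict {H G : Graph} {S : Fin (size G) → Set} (I : Image H G S)
                (p₄ᴴ : P₄-free H) (p₄ : P₄-free G) (isClosed : Basics.Closed G S) where

  open Image I
  open Basics G
  open Classes G p₄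
  open Critical G p₄
  private
    module R′ = Classes H p₄ᴴ
    module C′ = Critical H p₄ᴴ

  R-em : ∀ {i j} → R (em i) (em j) → R′.R i j
  R-em (near (inj₁ e)) = R′.near (inj₁ (em-inj e))
  R-em (near (inj₂ e)) = R′.near (inj₂ (~-em e))
  R-em {i} (via c e f) with pre (isClosed e (em∈ i))
  ... | l , refl = R′.via l (~-em e) (~-em f)

  em-R : ∀ {i j} → R′.R i j → R (em i) (em j)
  em-R (R′.near (inj₁ refl)) = R-refl
  em-R (R′.near (inj₂ e)) = near (inj₂ (em-~ e))
  em-R (R′.via c e f) = via (em c) (em-~ e) (em-~ f)

  unique-em : ∀ {i} → UniqueNbr (em i) → C′.UniqueNbr i
  unique-em {i} (v , e , only) with pre (isClosed e (em∈ i))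
  ... | j , refl = j , ~-em e , λ w f → em-inj (only _ (em-~ f))

  em-unique : ∀ {i} → C′.UniqueNbr i → UniqueNbr (em i)
  em-unique {i} (j , e , only) = em j , em-~ e , λ w f → case f (pre (isClosed f (em∈ i)))
    where
    case : ∀ {w} → em i ~ w → (∃ λ l → em l ≡ w) → w ≡ em j
    case f (l , refl) = cong em (only l (~-em f))

  centre-em : ∀ {y} → Centre S (em y) → R′.Centre U y
  centre-em (x , z , sx , _ , sz , e , f , ne) with pre sx | pre sz
  ... | i , refl | j , refl = i , j , _ , _ , _ , ~-em e , ~-em f ,
        λ { (inj₁ h) → ne (inj₁ (cong em h)) ; (inj₂ h) → ne (inj₂ (em-~ h)) }

-- One half of condition (3). Together with `Exclusion` and `Pieces` it unfolds to the right-hand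
-- side of the theorem.
Piece : ℕ → Graph → Set
Piece k H = (CographMinObstruction (fin 1) (fin (k ∸ 1)) H
              × ¬ CographMinObstruction (fin 1) ∞ H × ¬ (H ≅ copies k K₂))
            ⊎ (2 ≤ k × H ≅ copies (k ∸ 2) K₂ ⊹ (K₁ ⊕ copies 2 K₂))

Exclusion : ℕ → Graph → ℕ → Graph → Set
Exclusion k H k′ H′ = H ≅ copies (k ∸ 2) K₂ ⊹ (K₁ ⊕ copies 2 K₂)
  → CographMinObstruction (fin 1) (fin (k′ ∸ 1)) H′
  → Σ (Component H′) λ C → ¬ (sub H′ (cemb C) ≅ K₂)
       × (∀ (D : Component H′) → ¬ (sub H′ (cemb D) ≅ K₂) → SameComponent C D)

Pieces : ℕ → Graph → Set
Pieces k G = Σ ℕ λ k₁ → Σ ℕ λ k₂ → Σ Graph λ H₁ → Σ Graph λ H₂ →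
  1 ≤ k₁ × 1 ≤ k₂ × IsCograph H₁ × IsCograph H₂ ×
  (G ≅ H₁ ⊹ H₂) × (k + 1 ≡ k₁ + k₂) ×
  Piece k₁ H₁ × Piece k₂ H₂ × (Exclusion k₁ H₁ k₂ H₂ × Exclusion k₂ H₂ k₁ H₁)

-- Necessity: an obstruction yields two pieces

suc-shift : ∀ {k k₁ k₂} → k ≡ suc (k₁ + k₂) → k + 1 ≡ suc k₁ + suc k₂
suc-shift {k₁ = k₁} {k₂} refl = cong suc (trans (+-comm (k₁ + k₂) 1) (sym (+-suc k₁ k₂)))

shift-suc : ∀ {k k₁ k₂} → k + 1 ≡ suc k₁ + suc k₂ → k ≡ suc (k₁ + k₂)
shift-suc {k} {k₁} {k₂} e = suc-injective (trans (+-comm 1 k) (trans e (cong suc (+-suc k₁ k₂))))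

obstruction⇒pieces : ∀ k G → ¬ HasComponentIso G P₃ →
  Disconnected G × CographMinObstruction ∞ (fin k) G × NoIsolatedVertices G → Pieces k G
obstruction⇒pieces k G ¬P₃ (disc , O , noiso) = assemble (decompose ¬q minQ nbr (another-vertex ¬P₃) ¬r)
  where
  p₄ = cograph⇒P₄-free G (CographMinObstruction.cograph O)
  open Basics G
  open Classes G p₄
  open Critical G p₄
  open Winged G p₄
  open Obstruction G p₄ k
  open Transfer G p₄
  open Components G p₄
  ¬q = proj₁ (obstruction⇒Q O)
  minQ = proj₂ (obstruction⇒Q O)
  ¬r = proj₂ (proj₂ (disconnected⇒apart disc))
  nbr : ∀ v → ∃ (v ~_)
  nbr v = decidable-stable (Fin.any? (v ~?_)) λ none → noiso v λ u → ¬-not λ e → none (u , e)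
  cog : ∀ {H S} → Image H G S → IsCograph H
  cog I = P₄-free⇒cograph _ (P₄-free-Image I p₄)
  glue : ∀ {H₁ H₂ x} → Image H₁ G (R x) → Image H₂ G (∁R x) → G ≅ H₁ ⊹ H₂
  glue {x = x} I₁ I₂ = Image⇒≅ (Image-⊹ I₁ I₂ _ _ cov (λ r ¬r → ¬r r) (λ r ¬r e → ¬r (R-closed e r)))
    where
    cov : ∀ {v} → U v → R x v ⊎ ∁R x v
    cov {v} _ with R? x v
    ... | yes r = inj₁ r
    ... | no ¬r = inj₂ ¬r
  not-copies : ∀ {H S y m} → Image H G S → Decidable S → Closed S → Centre S y → ¬ (H ≅ copies m K₂)
  not-copies {m = m} I S? cl c@(_ , _ , _ , sy , _) iso =
    centre-not-unique c (proj₁ (Image⇒matching m S? cl (Image-≅ iso I)) sy)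
  critical-piece : ∀ {H S y j k} → Image H G S → Crit S k → F S j → Centre S y → Piece (suc k) H
  critical-piece {k = k} I C p c = inj₁ (Crit⇒obstruction I C , F⇒¬obstruction∞ I p ,
    not-copies {m = suc k} I (Crit.S? C) (Crit.isClosed C) c)
  winged-piece : ∀ {H m} → H ≅ copies m K₂ ⊹ W → Piece (2 + m) H
  winged-piece iso = inj₂ (s≤s (s≤s z≤n) , iso)
  not-winged : ∀ {H S k} → Image H G S → Crit S k → ¬ (H ≅ copies (suc k ∸ 2) K₂ ⊹ W)
  not-winged {H} {k = k} I C iso = winged-not-critical (suc k) H iso (Crit⇒obstruction I C)
  assemble : Decomposition → Pieces k G
  assemble (critical {y} c₁ c₂ C₁ C₂ p₁ p₂ eq) with induced G (R? y) | induced G (∁R? y)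
  ... | H₁ , I₁ | H₂ , I₂ = _ , _ , H₁ , H₂ , s≤s z≤n , s≤s z≤n , cog I₁ , cog I₂ , glue I₁ I₂ , suc-shift eq ,
        critical-piece I₁ C₁ p₁ c₁ , critical-piece I₂ C₂ p₂ c₂ ,
        -- A critical piece is never a butterfly with disjoint edges, so condition (4) holds
        -- vacuously.
        (λ iso _ → ⊥-elim (not-winged I₁ C₁ iso)) , (λ iso _ → ⊥-elim (not-winged I₂ C₂ iso))
  assemble (winged-critical {v} w c₂ C₂ p₂ un eq) with induced G (∁R? v)
  -- The butterfly is a piece by itself, with no K₂ beside it; this makes its index 2.
  ... | H₂ , I₂ = 2 , _ , H₁ , H₂ , s≤s z≤n , s≤s z≤n , cog I₁ , cog I₂ , glue I₁ I₂ , suc-shift {k₁ = 1} eq ,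
        winged-piece ≅-refl , critical-piece I₂ C₂ p₂ c₂ ,
        (λ _ _ → only-component c₂) , (λ _ O₁ → ⊥-elim (winged-not-critical 2 H₁ ≅-refl O₁))
    where
    H₁ = copies 0 K₂ ⊹ W
    I₁ = winged⇒Image w
    p₄₂ = P₄-free-Image I₂ p₄
    open Restrict I₂ p₄₂ p₄ (Crit.isClosed C₂)
    module C₂ = Components H₂ p₄₂
    only-component : Centre (∁R v) _ → Σ (Component H₂) C₂.OnlyNonK₂
    only-component c@(_ , _ , _ , sy , _) with Image.pre I₂ sy
    ... | i , refl = C₂.unique⇒component (centre-em c) λ {u} ¬r →
          unique-em (un (Image.em∈ I₂ u) (¬r ∘ R-em))
  assemble (winged-winged {m = m} w₁ w₂ eq) =
      2 , 2 + m , H₁ , H₂ , s≤s z≤n , s≤s z≤n , cog I₁ , cog I₂ , glue I₁ I₂ , suc-shift {k₁ = 1} eq ,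
      winged-piece ≅-refl , winged-piece ≅-refl ,
      (λ _ O₂ → ⊥-elim (winged-not-critical (2 + m) H₂ ≅-refl O₂)) ,
      (λ _ O₁ → ⊥-elim (winged-not-critical 2 H₁ ≅-refl O₁))
    where
    H₁ = copies 0 K₂ ⊹ W
    H₂ = copies m K₂ ⊹ W
    I₁ = winged⇒Image w₁
    I₂ = winged⇒Image w₂

-- Sufficiency: two pieces yield an obstruction

module Sides (G : Graph) (p₄ : P₄-free G) where

  open Basics G
  open Classes G p₄
  open Critical G p₄
  open Winged G p₄
  open Transfer G p₄
  open Components G p₄

  -- The two alternatives of condition (3). The index is kᵢ - 1, so that f of the side is one more
  -- than the index in both cases.
  data Side (S : V → Set) : ℕ → Set where
    critical : ∀ {k y} → Crit S k → F S (suc k) → Centre S y → Side S k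
    winged   : ∀ {m} → WingedSet S m → Side S (suc m)

  piece⇒side : ∀ {H S k} → Image H G S → Decidable S → Closed S → Piece (suc k) H → Side S k
  piece⇒side I S? cl (inj₂ (s≤s (s≤s z≤n) , iso)) = winged (Image⇒winged S? cl (Image-≅ iso I))
  piece⇒side {S = S} {k} I S? cl (inj₁ (O , ¬O∞ , ¬copies)) = critical C tight (proj₂ centre)
    where
    C : Crit S k
    C = obstruction⇒Crit I S? cl O
    tight : F S (suc k)
    -- The bound is decidable, which removes the double negation around the finiteness of f.
    tight = decidable-stable (F? S? (suc k)) λ ¬p → obstruction-finite I O ¬O∞ λ (j , p) → ¬p (crit-tight C p)
    centre : ∃ (Centre S)
    -- A critical set without P₃ would be a matching with k + 1 edges, the graph excluded in
    -- condition (3).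
    centre = decidable-stable (Fin.any? (Centre? S?)) λ none → ¬copies
      (let clu = no-centre⇒Clu λ c → none (_ , c) in
       Image-iso I (matching⇒Image (suc k) S? cl
        (λ su → crit-unique C su λ ru rv → Clu-R cl clu (class⊆ C su ru) (R-trans (R-sym ru) rv))
        (crit-cliques C clu)))

  side-notF : ∀ {S k} → Side S k → ¬ F S k
  side-notF (critical C _ _) = Crit.notF C
  side-notF (winged w) p = n≮n _ (WingedSet.F-hubless w (cover-mono proj₁ ≤-refl p))

  side-tight : ∀ {S k} → Side S k → F S (suc k)
  side-tight (critical _ p _) = p
  side-tight (winged w) = WingedSet.F-winged w

  side-centre : ∀ {S k} → Side S k → ∃ (Centre S)
  side-centre (critical _ _ c) = _ , c
  side-centre (winged w) = _ , WingedSet.winged-centre w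

  side-nbr : ∀ {S k} → Side S k → ∀ {u} → S u → ∃ (u ~_)
  side-nbr (critical C _ _) = crit-nbr C
  side-nbr (winged w) = WingedSet.winged-nbr w

  -- Condition (4) puts all P₃'s of the critical side into one component, where a multipartite part
  -- saves a clique.
  exclusion⇒Q : ∀ {H₁ H₂ S₁ S₂ m k₂ y} → Image H₁ G S₁ → Image H₂ G S₂ → WingedSet S₁ m →
    Exclusion (2 + m) H₁ (suc k₂) H₂ → Crit S₂ k₂ → F S₂ (suc k₂) → Centre S₂ y → Q S₂ k₂
  exclusion⇒Q {H₂ = H₂} {S₂ = S₂} I₁ I₂ w ex C p c with C₂.component⇒unique
      (ex (Image-iso I₁ (winged⇒Image w)) (Crit⇒obstruction I₂ C))
    where
    p₄₂ = P₄-free-Image I₂ p₄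
    module C₂ = Components H₂ p₄₂
  ... | d , un = crit-Q C p c (Image.em∈ I₂ d) unique
    where
    open Restrict I₂ (P₄-free-Image I₂ p₄) p₄ (Crit.isClosed C)
    unique : ∀ {u} → S₂ u → ¬ R (Image.em I₂ d) u → UniqueNbr u
    unique s ¬r with Image.pre I₂ s
    ... | i , refl = em-unique (un (¬r ∘ em-R))

  remove-side : ∀ {H₁ H₂ S₁ S₂ k₁ k₂} → Image H₁ G S₁ → Image H₂ G S₂ →
    Decidable S₁ → Closed S₁ → (∀ {v} → S₁ v → S₂ v → ⊥) → (∀ v → S₁ v ⊎ S₂ v) →
    Side S₁ k₁ → Side S₂ k₂ → Exclusion (suc k₁) H₁ (suc k₂) H₂ →
    ∀ {w} → S₁ w → Q (U - w) (suc (k₁ + k₂))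
  remove-side I₁ I₂ S₁? cl apart cover (critical C _ _) s₂ ex sw =
    sum-F S₁? cl apart cover sw (Crit.remove C sw) (side-tight s₂)
  remove-side {H₁} {H₂} {S₂ = S₂} I₁ I₂ S₁? cl apart cover (winged {m} w) s₂ ex {u} su with u ≟ WingedSet.hub w
  ... | no ne = sum-F S₁? cl apart cover su (WingedSet.F-remove w su ne) (side-tight s₂)
  ... | yes refl with WingedSet.hubless-cover w
  -- The loss of the hub saves no clique on its own side, so the other side has to save one.
  ...   | D? , clu , le = sum-Q S₁? cl apart cover D? clu le (other s₂ ex)
    where
    other : ∀ {k₂} → Side S₂ k₂ → Exclusion (2 + m) H₁ (suc k₂) H₂ → Q S₂ k₂
    other (winged w₂) _ = WingedSet.Q-winged w₂
    other (critical C p c) ex = exclusion⇒Q I₁ I₂ w ex C p c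

pieces⇒obstruction : ∀ k G → Pieces k G →
  Disconnected G × CographMinObstruction ∞ (fin k) G × NoIsolatedVertices G
pieces⇒obstruction k G (suc k₁ , suc k₂ , H₁ , H₂ , s≤s z≤n , s≤s z≤n , cog₁ , cog₂ , iso , eq , P₁ , P₂ , ex₁ , ex₂) =
    disconnected , subst (λ k → CographMinObstruction ∞ (fin k) G) (sym (shift-suc {k} {k₁} {k₂} eq)) obstruction , no-isolated
  where
  open Basics G
  open Split (Image-split {H₁} {H₂} {G} (Image-≅ iso (Image-id G)))
  cl₁ : Closed S₁
  cl₁ = S₁-closed λ _ _ → _
  cl₂ : Closed S₂
  cl₂ = S₂-closed λ _ _ → _
  -- A path stays on the side where it starts, so its four vertices come from one piece.
  within : ∀ {H S} → Image H G S → Closed S → P₄-free H → ∀ {a b c d} → S a →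
    a ~ b → b ~ c → c ~ d → ¬ a ~ c → ¬ b ~ d → a ~ d
  within I cl p₄ sa e f g ac bd with pre sa | pre (cl e sa) | pre (cl f (cl e sa)) | pre (cl g (cl f (cl e sa)))
    where open Image I
  ... | _ , refl | _ , refl | _ , refl | _ , refl =
      em-~ (p₄ (~-em e) (~-em f) (~-em g) (ac ∘ em-~) (bd ∘ em-~))
    where open Image I
  p₄ : P₄-free G
  p₄ e f g ac bd with cover _
  ... | inj₁ s = within image₁ cl₁ (cograph⇒P₄-free H₁ cog₁) s e f g ac bd
  ... | inj₂ s = within image₂ cl₂ (cograph⇒P₄-free H₂ cog₂) s e f g ac bd
  open Classes G p₄
  open Transfer G p₄
  open Winged G p₄
  open Sides G p₄
  side₁ : Side S₁ k₁
  side₁ = piece⇒side image₁ S₁? cl₁ P₁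
  side₂ : Side S₂ k₂
  side₂ = piece⇒side image₂ S₂? cl₂ P₂
  cover′ : ∀ v → S₁ v ⊎ S₂ v
  cover′ v = cover _
  disconnected : Disconnected G
  disconnected conn with side-centre side₁ | side-centre side₂
  ... | y₁ , _ , _ , _ , s₁ , _ | y₂ , _ , _ , _ , s₂ , _ = disjoint (walk s₁ (conn y₁ y₂)) s₂
    where
    walk : ∀ {u v} → S₁ u → Reach G u v → S₁ v
    walk s ε       = s
    walk s (e ◅ p) = walk (cl₁ e s) p
  no-isolated : NoIsolatedVertices G
  no-isolated v iso with [ side-nbr side₁ , side-nbr side₂ ]′ (cover′ v)
  ... | u , e = false⇒¬true (iso u) e
  removal : ∀ w → Q (U - w) (suc (k₁ + k₂))
  removal w with cover′ w
  ... | inj₁ s = remove-side image₁ image₂ S₁? cl₁ disjoint cover′ side₁ side₂ ex₁ s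
  ... | inj₂ s = cover-mono id (≤-reflexive (cong suc (+-comm k₂ k₁)))
        (remove-side image₂ image₁ S₂? cl₂ (λ p q → disjoint q p) ([ inj₂ , inj₁ ]′ ∘ cover′) side₂ side₁ ex₂ s)
  obstruction : CographMinObstruction ∞ (fin (suc (k₁ + k₂))) G
  obstruction = Q⇒obstruction
    (sum-not-Q S₁? cl₁ disjoint cover′ (side-notF side₁) (side-notF side₂)
      (proj₂ (side-centre side₁)) (proj₂ (side-centre side₂)))
    removal

theorem5 : (k : ℕ) → 1 ≤ k → (G : Graph) → ¬ HasComponentIso G P₃ →
  ((Disconnected G × CographMinObstruction ∞ (fin k) G × NoIsolatedVertices G)
   ⇔
   Σ ℕ λ k₁ → Σ ℕ λ k₂ → Σ Graph λ H₁ → Σ Graph λ H₂ →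
     1 ≤ k₁ × 1 ≤ k₂ × IsCograph H₁ × IsCograph H₂ ×
     (G ≅ H₁ ⊹ H₂) ×
     (k + 1 ≡ k₁ + k₂) ×
     ((CographMinObstruction (fin 1) (fin (k₁ ∸ 1)) H₁
        × ¬ CographMinObstruction (fin 1) ∞ H₁ × ¬ (H₁ ≅ copies k₁ K₂))
      ⊎ (2 ≤ k₁ × H₁ ≅ copies (k₁ ∸ 2) K₂ ⊹ (K₁ ⊕ copies 2 K₂))) ×
     ((CographMinObstruction (fin 1) (fin (k₂ ∸ 1)) H₂
        × ¬ CographMinObstruction (fin 1) ∞ H₂ × ¬ (H₂ ≅ copies k₂ K₂))
      ⊎ (2 ≤ k₂ × H₂ ≅ copies (k₂ ∸ 2) K₂ ⊹ (K₁ ⊕ copies 2 K₂))) ×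
     ((H₁ ≅ copies (k₁ ∸ 2) K₂ ⊹ (K₁ ⊕ copies 2 K₂)
        → CographMinObstruction (fin 1) (fin (k₂ ∸ 1)) H₂
        → Σ (Component H₂) λ C → ¬ (sub H₂ (cemb C) ≅ K₂)
             × (∀ (D : Component H₂) → ¬ (sub H₂ (cemb D) ≅ K₂) → SameComponent C D)) ×
      (H₂ ≅ copies (k₂ ∸ 2) K₂ ⊹ (K₁ ⊕ copies 2 K₂)
        → CographMinObstruction (fin 1) (fin (k₁ ∸ 1)) H₁
        → Σ (Component H₁) λ C → ¬ (sub H₁ (cemb C) ≅ K₂)
             × (∀ (D : Component H₁) → ¬ (sub H₁ (cemb D) ≅ K₂) → SameComponent C D))))
theorem5 k _ G ¬P₃ = mk⇔ (obstruction⇒pieces k G ¬P₃) (pieces⇒obstruction k G)
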